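{- For every fixed integer $d\geq 3$, if $G$ is the uniformly random $d$-regular graph on the vertex set $[n]$ (with $dn$ even), then with probability tending to $1$ as $n\to\infty$ the following hold: (1) for every integer $k$ with $\frac{d}{2}+\sqrt{d}\leq k\leq d$, $r_\ell(G,\mathcal{K}^E_k)=d-k+1$; (2) for every integer $k$ with $1\leq k<\frac{d}{2}+\sqrt{d}$, $\frac{d}{2}-\sqrt{d}< r_\ell(G,\mathcal{K}^E_k)\leq\min\{d-k+1,\frac{d}{2}+4\sqrt{d\ln d}\}$.
   Context: For a monotone increasing graph property $\mathcal{P}$ (closed under adding edges) and a graph $G$, the local resilience is $r_\ell(G,\mathcal{P})=\min\{r: \exists H\subseteq G \text{ with } \Delta(H)=r \text{ and } G- H\notin\mathcal{P}\}$, where $H\subseteq G$ is a subgraph on the same vertex set, $\Delta(H)$ its maximum degree, and $G-H$ the graph obtained by deleting the edges of $H$. $\mathcal{K}^E_k$ denotes the property of being $k$-edge connected (removing any $k-1$ edges leaves the graph connected). -}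

module Defs where

open import Data.Nat using (ℕ; zero; suc; _+_; _*_; _∸_; _^_; _≤_; _<_)
open import Data.Nat using (_!)
open import Data.Nat.Divisibility using (_∣_)
open import Data.Bool using (Bool; true; false; _∧_; not; if_then_else_)
open import Data.Fin using (Fin)
open import Data.Vec using (Vec; lookup; zipWith; map; sum; tabulate)
open import Data.List using (List; length)
open import Data.List.Relation.Unary.All using (All)
open import Data.List.Relation.Unary.Unique.Propositional using (Unique)
open import Data.List.Membership.Propositional using (_∈_)
open import Data.Product using (Σ; ∃; _×_)
open import Relation.Nullary using (¬_)
open import Relation.Binary.PropositionalEquality using (_≡_)

Graph : ℕ → Set
Graph n = Vec (Vec Bool n) n

Adj : {n : ℕ} → Graph n → Fin n → Fin n → Set
Adj G i j = lookup (lookup G i) j ≡ true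

IsSimple : {n : ℕ} → Graph n → Set
IsSimple G = (∀ i → lookup (lookup G i) i ≡ false)
           × (∀ i j → lookup (lookup G i) j ≡ lookup (lookup G j) i)

deg : {n : ℕ} → Graph n → Fin n → ℕ
deg G i = sum (map (λ b → if b then 1 else 0) (lookup G i))

-- sum of all degrees = twice the number of edges
degSum : {n : ℕ} → Graph n → ℕ
degSum {n} G = sum (tabulate (deg G))

Regular : {n : ℕ} → ℕ → Graph n → Set
Regular d G = IsSimple G × (∀ i → deg G i ≡ d)

_⊆G_ : {n : ℕ} → Graph n → Graph n → Set
H ⊆G G = IsSimple H × (∀ i j → Adj H i j → Adj G i j)

MaxDeg : {n : ℕ} → Graph n → ℕ → Set
MaxDeg H r = (∀ i → deg H i ≤ r) × ∃ (λ i → deg H i ≡ r)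

_−G_ : {n : ℕ} → Graph n → Graph n → Graph n
G −G H = zipWith (zipWith (λ a b → a ∧ not b)) G H

data Reach {n : ℕ} (G : Graph n) (i : Fin n) : Fin n → Set where
  here : Reach G i i
  step : ∀ {j l} → Reach G i j → Adj G j l → Reach G i l

Connected : {n : ℕ} → Graph n → Set
Connected G = ∀ i j → Reach G i j

EdgeConn : ℕ → {n : ℕ} → Graph n → Set
EdgeConn k G = ∀ H → H ⊆G G → degSum H ≤ 2 * (k ∸ 1) → Connected (G −G H)

IsLocRes : {n : ℕ} → (Graph n → Set) → Graph n → ℕ → Set
IsLocRes P G r =
  Σ _ (λ H → H ⊆G G × MaxDeg H r × ¬ P (G −G H))
  × (∀ H s → H ⊆G G → MaxDeg H s → s < r → P (G −G H))

-- expT m N = N! * Σ_{j ≤ N} m^j / j!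
expT : ℕ → ℕ → ℕ
expT m zero = 1
expT m (suc N) = suc N * expT m N + m ^ suc N

-- r ≤ d/2 + 4 sqrt(d ln d)  ⇔  (2r-d)_+^2 ≤ 64 d ln d  ⇔  e^((2r-d)_+^2) ≤ d^(64 d)
-- ⇔ every partial sum of the exponential series is ≤ d^(64 d).
UpperLn : ℕ → ℕ → Set
UpperLn d r = ∀ N → expT ((2 * r ∸ d) ^ 2) N ≤ d ^ (64 * d) * (N !)

Good : {n : ℕ} → ℕ → Graph n → Set
Good d G =
  -- (1): d/2 + sqrt d ≤ k ≤ d
  (∀ k → 4 * d ≤ (2 * k ∸ d) ^ 2 → k ≤ d → IsLocRes (EdgeConn k) G (d ∸ k + 1))
  -- (2): 1 ≤ k < d/2 + sqrt d
  × (∀ k → 1 ≤ k → (2 * k ∸ d) ^ 2 < 4 * d →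
       Σ ℕ (λ r → IsLocRes (EdgeConn k) G r
                  × (d ∸ 2 * r) ^ 2 < 4 * d
                  × r ≤ d ∸ k + 1
                  × UpperLn d r))

-- w.h.p. statement: for every m ≥ 1, for all large n with dn even,
-- P(Good) ≥ 1 - 1/m, probabilities being counts among labelled d-regular graphs.
WHP : ℕ → Set
WHP d = ∀ m → 1 ≤ m → ∃ λ N → ∀ n → N ≤ n → 2 ∣ d * n →
  (Lall : List (Graph n)) → Unique Lall → All (Regular d) Lall →
  (∀ G → Regular d G → G ∈ Lall) →
  Σ (List (Graph n)) (λ L → Unique L × All (λ G → Regular d G × Good d G) L
     × m * length Lall ≤ m * length L + length Lall)

{-# OPTIONS --safe #-}
-- Removing H with Δ(H) ≤ r destroys at most r|S| edges of the cut of S.  So with K the least integer ≥ d/2 + √d,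
-- all lower bounds follow once no S with 2 ≤ |S| ≤ n/2 spans more than K(|S| - 1)/2 edges.  This holds with high
-- probability by a first moment argument in the spirit of Bollobás: switching an edge ab inside S and an edge ce
-- outside S to ac, be bounds N(E + 2) / N(E), where N(E) counts the d-regular graphs whose internal degrees in S
-- add up to E.  The product of these ratios is a Gaussian tail, about (4/5)^|S| after multiplying with the number
-- of sets of size |S|; when |S| is a small fraction of n, already the crudest bound on the ratios suffices.
-- The upper bounds hold for every d-regular graph: either leave only k - 1 edges at one vertex, or separate the two
-- sides of a partition in which every vertex has at least ⌊(d - 1)/2⌋ neighbours on its own side.

module Submission where

open import Defs
open import Algebra.Properties.CommutativeSemigroup using (interchange)
open import Data.Nat
open import Data.Nat.DivMod using (_/_; _%_; m≡m%n+[m/n]*n; m%n<n)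
open import Data.Nat.Properties
open import Data.Nat.Tactic.RingSolver using (solve-∀)
import Data.Bool as B
open import Data.Bool using (Bool; true; false; _∧_; _∨_; _xor_; not; if_then_else_)
open import Data.Bool.ListAction using (any)
open import Data.Bool.Properties using (∧-comm; ∧-zeroʳ; ∨-comm; ∨-identityʳ; xor-comm; xor-identityʳ; not-involutive)
open import Data.Fin using (Fin; zero; suc)
import Data.Fin.Properties as F
open import Data.Vec using (Vec; []; _∷_; lookup; tabulate; _[_]≔_)
import Data.Vec as V
import Data.Vec.Properties as V
open import Data.List using (List; []; _∷_; _++_; length; filter)
import Data.List as L
open import Data.List.Relation.Unary.All using (All)
import Data.List.Relation.Unary.All as All
open import Data.List.Relation.Unary.Any using (here; there)
open import Data.List.Relation.Unary.Unique.Propositional using (Unique)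
import Data.List.Relation.Unary.Unique.Propositional.Properties as Unique
open import Data.List.Relation.Unary.AllPairs using (_∷_)
open import Data.List.Membership.Propositional using (_∈_)
open import Data.List.Membership.Propositional.Properties using (∈-++⁺ˡ; ∈-++⁺ʳ; ∈-++⁻; ∈-∃++; ∈-map⁺; ∈-filter⁻)
open import Data.Product using (Σ; ∃; _×_; _,_; proj₁; proj₂)
open import Data.Sum using (_⊎_; inj₁; inj₂)
open import Function using (_∘_)
open import Relation.Nullary using (¬_; Dec; yes; no; contradiction)
open import Relation.Nullary.Decidable using (⌊_⌋; _×-dec_; _→-dec_; toWitness)
open import Relation.Binary.PropositionalEquality hiding (J)
open import Algebra.Properties.Semiring.Sum +-*-semiring
  using (∑-comm; sum-cong-≗; *-distribˡ-sum; *-distribʳ-sum; ∑-distrib-+) renaming (sum to ∑)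

-- With l = d - Δ(H) ≥ K, a set of size σ ≤ n/2 keeps at least dσ - K(σ - 1) - Δ(H)σ ≥ l edges to
-- its complement: the -1 is what leaves l of them. The first moment argument is decided by a
-- comparison of constants. There are at most (4(n - σ)/σ)^σ sets of size σ. A surplus of √d per
-- vertex makes the switching ratios multiply to at most (σ/(n - σ))^ρ ((B - 1)/(B + 1))^(Bρ) with B
-- about σd/4, and ((B - 1)/(B + 1))^B ≤ 1/5, its limit being e^-2; so 5 meets 4. Blocked switchings
-- and rounding shorten the exponent from σ to ρ = σ - 2c, where c depends on d only. This costs
-- (5(n - σ)/σ)^(2c), which is bounded only while n/σ is bounded by some Q; smaller sets need the
-- crude bound for this reason. In the second range of k the resilience is obtained as the result of
-- a search, so the failure of k-edge connectivity is expressed through a decidable property of H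
-- and a vertex set. All probabilities are counts, and all ratios are cross-multiplied in the
-- natural numbers.

∑-mono : ∀ {n} {f g : Fin n → ℕ} → (∀ i → f i ≤ g i) → ∑ f ≤ ∑ g
∑-mono {zero}  h = z≤n
∑-mono {suc n} h = +-mono-≤ (h zero) (∑-mono (h ∘ suc))

∑-const : ∀ n c → ∑ {n} (λ _ → c) ≡ n * c
∑-const zero    c = refl
∑-const (suc n) c = cong (c +_) (∑-const n c)

∑-0 : ∀ n → ∑ {n} (λ _ → 0) ≡ 0
∑-0 n = trans (∑-const n 0) (*-zeroʳ n)

term≤∑ : ∀ {n} (f : Fin n → ℕ) i → f i ≤ ∑ f
term≤∑ {suc n} f zero    = m≤m+n _ _
term≤∑ {suc n} f (suc i) = ≤-trans (term≤∑ (f ∘ suc) i) (m≤n+m _ _)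

∑-pos : ∀ {n} (f : Fin n → ℕ) → 0 < ∑ f → ∃ λ i → 0 < f i
∑-pos {suc n} f h with f zero in eq
... | suc _ = zero , subst (0 <_) (sym eq) z<s
... | 0     with ∑-pos (f ∘ suc) h
...   | i , p = suc i , p

-- Indicators of Booleans and of equality

β : Bool → ℕ
β b = if b then 1 else 0

β-∧ : ∀ x y → β (x ∧ y) ≡ β x * β y
β-∧ true  y = sym (+-identityʳ _)
β-∧ false y = refl

β≤1 : ∀ x → β x ≤ 1
β≤1 true  = ≤-refl
β≤1 false = z≤n

β-not : ∀ x → β x + β (not x) ≡ 1
β-not true  = refl
β-not false = refl

β-idem : ∀ x → β x * β x ≡ β x
β-idem true  = refl
β-idem false = refl

β-mono : ∀ {x y} → (x ≡ true → y ≡ true) → β x ≤ β y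
β-mono {false} h = z≤n
β-mono {true}  h rewrite h refl = ≤-refl

δ : ∀ {n} → Fin n → Fin n → ℕ
δ i j = β ⌊ i F.≟ j ⌋

δ-refl : ∀ {n} (i : Fin n) → δ i i ≡ 1
δ-refl i with i F.≟ i
... | yes _ = refl
... | no ¬p = contradiction refl ¬p

δ-≢ : ∀ {n} {i j : Fin n} → i ≢ j → δ i j ≡ 0
δ-≢ {i = i} {j} i≢j with i F.≟ j
... | yes p = contradiction p i≢j
... | no _  = refl

δ-suc : ∀ {n} (i j : Fin n) → δ (suc i) (suc j) ≡ δ i j
δ-suc i j with i F.≟ j
... | yes _ = refl
... | no _  = refl

∑-δ : ∀ {n} (i : Fin n) (f : Fin n → ℕ) → ∑ (λ j → δ i j * f j) ≡ f i
∑-δ {suc n} zero f = trans (cong₂ _+_ (+-identityʳ (f zero))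
  (trans (sum-cong-≗ (λ j → cong (_* f (suc j)) (δ-≢ {i = zero} {suc j} λ ()))) (∑-0 n))) (+-identityʳ _)
∑-δ {suc n} (suc i) f = trans (sum-cong-≗ (λ j → cong (_* f (suc j)) (δ-suc i j))) (∑-δ i (f ∘ suc))

∑-δ′ : ∀ {n} (i : Fin n) (f : Fin n → ℕ) → ∑ (λ j → f j * δ i j) ≡ f i
∑-δ′ i f = trans (sum-cong-≗ (λ j → *-comm (f j) (δ i j))) (∑-δ i f)

∑-δ1 : ∀ {n} (i : Fin n) → ∑ (δ i) ≡ 1
∑-δ1 i = trans (sum-cong-≗ (λ j → sym (*-identityʳ (δ i j)))) (∑-δ i (λ _ → 1))

≤-by : ∀ {a b} c → b ≡ a + c → a ≤ b
≤-by c refl = m≤m+n _ c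

-- Adjacency entries, degree sums and vertex sets

ad : ∀ {n} → Graph n → Fin n → Fin n → ℕ
ad G i j = β (lookup (lookup G i) j)

Σβ : ∀ {n} (v : Vec Bool n) → V.sum (V.map (λ b → if b then 1 else 0) v) ≡ ∑ (β ∘ lookup v)
Σβ []      = refl
Σβ (b ∷ v) = cong (β b +_) (Σβ v)

deg-∑ : ∀ {n} (G : Graph n) i → deg G i ≡ ∑ (ad G i)
deg-∑ G i = Σβ (lookup G i)

sum-tabulate : ∀ {n} (f : Fin n → ℕ) → V.sum (tabulate f) ≡ ∑ f
sum-tabulate {zero}  f = refl
sum-tabulate {suc n} f = cong (f zero +_) (sum-tabulate (f ∘ suc))

degSum-∑ : ∀ {n} (G : Graph n) → degSum G ≡ ∑ λ i → ∑ (ad G i)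
degSum-∑ G = trans (sum-tabulate (deg G)) (sum-cong-≗ (deg-∑ G))

graph : ∀ {n} → (Fin n → Fin n → Bool) → Graph n
graph f = tabulate λ i → tabulate (f i)

lookup-graph : ∀ {n} (f : Fin n → Fin n → Bool) i j → lookup (lookup (graph f) i) j ≡ f i j
lookup-graph f i j = trans (cong (λ v → lookup v j) (V.lookup∘tabulate _ i)) (V.lookup∘tabulate _ j)

vec-ext : ∀ {n} {X : Set} {u v : Vec X n} → (∀ i → lookup u i ≡ lookup v i) → u ≡ v
vec-ext {u = u} {v} h = trans (sym (V.tabulate∘lookup u)) (trans (V.tabulate-cong h) (V.tabulate∘lookup v))

graph-ext : ∀ {n} {G H : Graph n} → (∀ i j → lookup (lookup G i) j ≡ lookup (lookup H i) j) → G ≡ H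
graph-ext h = vec-ext λ i → vec-ext (h i)

lookup-− : ∀ {n} (G H : Graph n) i j → lookup (lookup (G −G H) i) j ≡ lookup (lookup G i) j ∧ not (lookup (lookup H i) j)
lookup-− G H i j = trans (cong (λ v → lookup v j) (V.lookup-zipWith _ i G H)) (V.lookup-zipWith _ j (lookup G i) (lookup H i))

-- counts each edge inside S twice
inn : ∀ {n} → Vec Bool n → Graph n → ℕ
inn S G = ∑ λ i → ∑ λ j → β (lookup S i) * β (lookup S j) * ad G i j

cut : ∀ {n} → Vec Bool n → Graph n → ℕ
cut S G = ∑ λ i → ∑ λ j → β (lookup S i) * β (not (lookup S j)) * ad G i j

size : ∀ {n} → Vec Bool n → ℕ
size S = ∑ (β ∘ lookup S)

-- Sums and counts over lists

Σl : {X : Set} → (X → ℕ) → List X → ℕ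
Σl f []       = 0
Σl f (x ∷ xs) = f x + Σl f xs

module _ {X : Set} where

  Σl-mono : ∀ {f g : X → ℕ} (xs : List X) → (∀ x → x ∈ xs → f x ≤ g x) → Σl f xs ≤ Σl g xs
  Σl-mono []       h = z≤n
  Σl-mono (x ∷ xs) h = +-mono-≤ (h x (here refl)) (Σl-mono xs λ y y∈ → h y (there y∈))

  Σl-cong : ∀ {f g : X → ℕ} (xs : List X) → (∀ x → f x ≡ g x) → Σl f xs ≡ Σl g xs
  Σl-cong []       h = refl
  Σl-cong (x ∷ xs) h = cong₂ _+_ (h x) (Σl-cong xs h)

  Σl-*ʳ : ∀ (f : X → ℕ) c xs → Σl f xs * c ≡ Σl (λ x → f x * c) xs
  Σl-*ʳ f c []       = refl
  Σl-*ʳ f c (x ∷ xs) = trans (*-distribʳ-+ c (f x) _) (cong (f x * c +_) (Σl-*ʳ f c xs))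

  Σl-+ : ∀ (f g : X → ℕ) xs → Σl (λ x → f x + g x) xs ≡ Σl f xs + Σl g xs
  Σl-+ f g []       = refl
  Σl-+ f g (x ∷ xs) rewrite Σl-+ f g xs = interchange +-commutativeSemigroup (f x) (g x) (Σl f xs) (Σl g xs)

  Σl-0 : ∀ (xs : List X) → Σl (λ _ → 0) xs ≡ 0
  Σl-0 []       = refl
  Σl-0 (x ∷ xs) = Σl-0 xs

  Σl-∑ : ∀ {n} (f : Fin n → X → ℕ) xs → Σl (λ x → ∑ λ i → f i x) xs ≡ ∑ λ i → Σl (f i) xs
  Σl-∑ {n} f []       = sym (∑-0 n)
  Σl-∑ {n} f (x ∷ xs) = trans (cong ((∑ λ i → f i x) +_) (Σl-∑ f xs)) (sym (∑-distrib-+ (λ i → f i x) _))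

  Σl-++ : ∀ (f : X → ℕ) xs ys → Σl f (xs ++ ys) ≡ Σl f xs + Σl f ys
  Σl-++ f []       ys = refl
  Σl-++ f (x ∷ xs) ys = trans (cong (f x +_) (Σl-++ f xs ys)) (sym (+-assoc (f x) _ _))

  count : (X → Bool) → List X → ℕ
  count p = Σl (β ∘ p)

  count≤length : ∀ p xs → count p xs ≤ length xs
  count≤length p []       = z≤n
  count≤length p (x ∷ xs) = +-mono-≤ (β≤1 (p x)) (count≤length p xs)

  count-split : ∀ p (xs : List X) x ys → count p (xs ++ x ∷ ys) ≡ β (p x) + count p (xs ++ ys)
  count-split p xs x ys = begin
    count p (xs ++ x ∷ ys)                      ≡⟨ Σl-++ _ xs (x ∷ ys) ⟩
    count p xs + (β (p x) + count p ys)         ≡⟨ +-assoc (count p xs) _ _ ⟨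
    count p xs + β (p x) + count p ys           ≡⟨ cong (_+ count p ys) (+-comm (count p xs) _) ⟩
    β (p x) + count p xs + count p ys           ≡⟨ +-assoc (β (p x)) _ _ ⟩
    β (p x) + (count p xs + count p ys)         ≡⟨ cong (β (p x) +_) (Σl-++ _ xs ys) ⟨
    β (p x) + count p (xs ++ ys)                ∎
    where open ≡-Reasoning

  ∈-drop : ∀ {y x : X} (xs : List X) ys → y ∈ xs ++ x ∷ ys → y ≢ x → y ∈ xs ++ ys
  ∈-drop xs ys y∈ y≢x with ∈-++⁻ xs y∈
  ... | inj₁ p         = ∈-++⁺ˡ p
  ... | inj₂ (here eq) = contradiction eq y≢x
  ... | inj₂ (there p) = ∈-++⁺ʳ xs p

  -- Each image is cut out of `ys`; injectivity and the uniqueness of `xs` ensure that the later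
  -- images survive in what remains.
  count-inj : ∀ (p q : X → Bool) (f : X → X) → (∀ {x y} → f x ≡ f y → x ≡ y) →
              ∀ xs ys → Unique xs → (∀ x → x ∈ xs → p x ≡ true → f x ∈ ys × q (f x) ≡ true) →
              count p xs ≤ count q ys
  count-inj p q f inj []       ys u h = z≤n
  count-inj p q f inj (x ∷ xs) ys (x∉ ∷ u) h with p x in px
  ... | false = count-inj p q f inj xs ys u (λ y y∈ → h y (there y∈))
  ... | true with h x (here refl) px
  ...   | fx∈ , qfx with ∈-∃++ fx∈
  ...     | as , bs , refl = subst (suc (count p xs) ≤_)
            (sym (trans (count-split q as (f x) bs) (cong (λ b → β b + count q (as ++ bs)) qfx)))
            (s≤s (count-inj p q f inj xs (as ++ bs) u λ y y∈ py →
              ∈-drop as bs (proj₁ (h y (there y∈) py)) (λ eq → All.lookup x∉ y∈ (sym (inj eq))) ,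
              proj₂ (h y (there y∈) py)))

∑-pull : ∀ {n} c (f : Fin n → ℕ) → ∑ (λ i → c * f i) ≡ c * ∑ f
∑-pull c f = sym (*-distribˡ-sum c f)

∑-pullʳ : ∀ {n} c (f : Fin n → ℕ) → ∑ (λ i → f i * c) ≡ ∑ f * c
∑-pullʳ c f = sym (*-distribʳ-sum c f)

∑-+ : ∀ {n} (f g : Fin n → ℕ) → ∑ (λ i → f i + g i) ≡ ∑ f + ∑ g
∑-+ = ∑-distrib-+

∑∑-pullʳ : ∀ {m n} c (f : Fin m → Fin n → ℕ) → ∑ (λ i → ∑ λ j → f i j * c) ≡ (∑ λ i → ∑ (f i)) * c
∑∑-pullʳ c f = trans (sum-cong-≗ λ i → ∑-pullʳ c (f i)) (∑-pullʳ c (λ i → ∑ (f i)))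

∑∑-pull : ∀ {m n} c (f : Fin m → Fin n → ℕ) → ∑ (λ i → ∑ λ j → c * f i j) ≡ c * (∑ λ i → ∑ (f i))
∑∑-pull c f = trans (sum-cong-≗ λ i → ∑-pull c (f i)) (∑-pull c (λ i → ∑ (f i)))

∑∑-+ : ∀ {m n} (f g : Fin m → Fin n → ℕ) → ∑ (λ i → ∑ λ j → f i j + g i j) ≡ (∑ λ i → ∑ (f i)) + (∑ λ i → ∑ (g i))
∑∑-+ f g = trans (sum-cong-≗ λ i → ∑-+ (f i) (g i)) (∑-+ (λ i → ∑ (f i)) (λ i → ∑ (g i)))

-- Edges inside, outside and across a vertex set

ad-sym : ∀ {n} {G : Graph n} → IsSimple G → ∀ i j → ad G i j ≡ ad G j i
ad-sym (_ , sy) i j = cong β (sy i j)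

ad-diag : ∀ {n} {G : Graph n} → IsSimple G → ∀ i → ad G i i ≡ 0
ad-diag (dg , _) i = cong β (dg i)

inn̄ : ∀ {n} → Vec Bool n → Graph n → ℕ
inn̄ S G = ∑ λ i → ∑ λ j → β (not (lookup S i)) * β (not (lookup S j)) * ad G i j

size̅ : ∀ {n} → Vec Bool n → ℕ
size̅ S = ∑ (β ∘ not ∘ lookup S)

size+size̅ : ∀ {n} (S : Vec Bool n) → size S + size̅ S ≡ n
size+size̅ {n} S = trans (sym (∑-+ (β ∘ lookup S) (β ∘ not ∘ lookup S)))
  (trans (sum-cong-≗ (λ i → β-not (lookup S i))) (trans (∑-const n 1) (*-identityʳ n)))

cut-sym : ∀ {n} {G : Graph n} → IsSimple G → ∀ S →
          (∑ λ i → ∑ λ j → β (not (lookup S i)) * β (lookup S j) * ad G i j) ≡ cut S G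
cut-sym {G = G} simple S = trans (∑-comm (λ i j → β (not (lookup S i)) * β (lookup S j) * ad G i j))
  (sum-cong-≗ λ j → sum-cong-≗ λ i →
    cong₂ _*_ (*-comm (β (not (lookup S i))) (β (lookup S j))) (ad-sym {G = G} simple i j))

module _ {n d} {G : Graph n} (reg : Regular d G) where

  row-sum : ∀ i → ∑ (ad G i) ≡ d
  row-sum i = trans (sym (deg-∑ G i)) (proj₂ reg i)

  -- Each row sum d is split by `u` and `v`. With `w` the indicator of S or of its complement this
  -- gives the two identities below.
  weighted-split : ∀ (w u v : Fin n → ℕ) → (∀ j → u j + v j ≡ 1) →
    (∑ λ i → ∑ λ j → w i * u j * ad G i j) + (∑ λ i → ∑ λ j → w i * v j * ad G i j) ≡ ∑ w * d
  weighted-split w u v uv = begin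
    (∑ λ i → ∑ λ j → w i * u j * ad G i j) + (∑ λ i → ∑ λ j → w i * v j * ad G i j)
      ≡⟨ ∑∑-+ (λ i j → w i * u j * ad G i j) (λ i j → w i * v j * ad G i j) ⟨
    (∑ λ i → ∑ λ j → w i * u j * ad G i j + w i * v j * ad G i j)
      ≡⟨ sum-cong-≗ (λ i → trans (sum-cong-≗ λ j → pt i j) (trans (∑-pull (w i) (ad G i)) (cong (w i *_) (row-sum i)))) ⟩
    (∑ λ i → w i * d) ≡⟨ ∑-pullʳ d w ⟩
    ∑ w * d ∎
    where
    open ≡-Reasoning
    pt : ∀ i j → w i * u j * ad G i j + w i * v j * ad G i j ≡ w i * ad G i j
    pt i j = trans (sym (*-distribʳ-+ (ad G i j) (w i * u j) (w i * v j)))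
      (cong (_* ad G i j) (trans (sym (*-distribˡ-+ (w i) (u j) (v j))) (trans (cong (w i *_) (uv j)) (*-identityʳ (w i)))))

  inn+cut : ∀ S → inn S G + cut S G ≡ size S * d
  inn+cut S = weighted-split (β ∘ lookup S) _ _ (λ j → β-not (lookup S j))

  inn̄+cut : ∀ S → inn̄ S G + cut S G ≡ size̅ S * d
  inn̄+cut S = trans (cong (inn̄ S G +_) (sym (cut-sym {G = G} (proj₁ reg) S)))
    (weighted-split (β ∘ not ∘ lookup S) _ _ (λ j → trans (+-comm (β (not (lookup S j))) _) (β-not (lookup S j))))

-- Switching the edges ab, ce to ac, be

edge : ∀ {n} → Fin n → Fin n → Fin n → Fin n → Bool
edge u v i j = (⌊ u F.≟ i ⌋ ∧ ⌊ v F.≟ j ⌋) ∨ (⌊ v F.≟ i ⌋ ∧ ⌊ u F.≟ j ⌋)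

edge-sym : ∀ {n} (u v i j : Fin n) → edge u v i j ≡ edge u v j i
edge-sym u v i j = trans (∨-comm (⌊ u F.≟ i ⌋ ∧ ⌊ v F.≟ j ⌋) _)
  (cong₂ _∨_ (∧-comm ⌊ v F.≟ i ⌋ _) (∧-comm ⌊ u F.≟ i ⌋ _))

-- Toggling entries by xor makes `switch` injective on all graphs, admissible or not, so the
-- counting needs no inverse and no side conditions.
swap : ∀ {n} (a b c e i j : Fin n) → Bool
swap a b c e i j = (edge a b i j xor edge c e i j) xor (edge a c i j xor edge b e i j)

switch : ∀ {n} (a b c e : Fin n) → Graph n → Graph n
switch a b c e G = graph λ i j → lookup (lookup G i) j xor swap a b c e i j

swap-sym : ∀ {n} (a b c e i j : Fin n) → swap a b c e i j ≡ swap a b c e j i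
swap-sym a b c e i j = cong₂ _xor_ (cong₂ _xor_ (edge-sym a b i j) (edge-sym c e i j))
  (cong₂ _xor_ (edge-sym a c i j) (edge-sym b e i j))

lookup-switch : ∀ {n} (a b c e : Fin n) G i j →
  lookup (lookup (switch a b c e G) i) j ≡ lookup (lookup G i) j xor swap a b c e i j
lookup-switch a b c e G = lookup-graph λ i j → lookup (lookup G i) j xor swap a b c e i j

switch-inj : ∀ {n} (a b c e : Fin n) {G H} → switch a b c e G ≡ switch a b c e H → G ≡ H
switch-inj a b c e {G} {H} eq = graph-ext λ i j → xor-cancel (swap a b c e i j)
  (trans (sym (lookup-switch a b c e G i j)) (trans (cong (λ K → lookup (lookup K i) j) eq) (lookup-switch a b c e H i j)))
  where
  xor-cancel : ∀ {x y} z → x xor z ≡ y xor z → x ≡ y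
  xor-cancel {false} {false} z eq = refl
  xor-cancel {true}  {true}  z eq = refl
  xor-cancel {false} {true}  false ()
  xor-cancel {false} {true}  true ()
  xor-cancel {true}  {false} false ()
  xor-cancel {true}  {false} true ()

-- the entries that switch a b c e removes; those it adds are μ a c b e
μ : ∀ {n} (a b c e i j : Fin n) → ℕ
μ a b c e i j = (δ a i * δ b j + δ b i * δ a j) + (δ c i * δ e j + δ e i * δ c j)

∑-*δ : ∀ {n} (u v : Fin n) (w z : Fin n → ℕ) →
  (∑ λ i → ∑ λ j → w i * z j * (δ u i * δ v j)) ≡ w u * z v
∑-*δ u v w z = begin
  (∑ λ i → ∑ λ j → w i * z j * (δ u i * δ v j))
    ≡⟨ sum-cong-≗ (λ i → trans (sum-cong-≗ λ j → [m*n]*[o*p]≡[m*o]*[n*p] (w i) (z j) (δ u i) (δ v j))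
         (trans (∑-pull (w i * δ u i) (λ j → z j * δ v j)) (cong (w i * δ u i *_) (∑-δ′ v z)))) ⟩
  (∑ λ i → w i * δ u i * z v)   ≡⟨ ∑-pullʳ (z v) (λ i → w i * δ u i) ⟩
  (∑ λ i → w i * δ u i) * z v   ≡⟨ cong (_* z v) (∑-δ′ u w) ⟩
  w u * z v                     ∎
  where open ≡-Reasoning

∑-*μ : ∀ {n} (a b c e : Fin n) (w z : Fin n → ℕ) →
  (∑ λ i → ∑ λ j → w i * z j * μ a b c e i j) ≡ (w a * z b + w b * z a) + (w c * z e + w e * z c)
∑-*μ a b c e w z = begin
  (∑ λ i → ∑ λ j → w i * z j * μ a b c e i j)
    ≡⟨ sum-cong-≗ (λ i → sum-cong-≗ λ j → trans (*-distribˡ-+ (w i * z j) _ _)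
         (cong₂ _+_ (*-distribˡ-+ (w i * z j) _ _) (*-distribˡ-+ (w i * z j) _ _))) ⟩
  (∑ λ i → ∑ λ j → (t a b i j + t b a i j) + (t c e i j + t e c i j))
    ≡⟨ trans (∑∑-+ (λ i j → t a b i j + t b a i j) (λ i j → t c e i j + t e c i j))
         (cong₂ _+_ (∑∑-+ (t a b) (t b a)) (∑∑-+ (t c e) (t e c))) ⟩
  (∑∑ (t a b) + ∑∑ (t b a)) + (∑∑ (t c e) + ∑∑ (t e c))
    ≡⟨ cong₂ _+_ (cong₂ _+_ (∑-*δ a b w z) (∑-*δ b a w z)) (cong₂ _+_ (∑-*δ c e w z) (∑-*δ e c w z)) ⟩
  _ ∎
  where
  open ≡-Reasoning
  t : ∀ u v i j → ℕ
  t u v i j = w i * z j * (δ u i * δ v j)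
  ∑∑ : (_ → _ → ℕ) → ℕ
  ∑∑ f = ∑ λ i → ∑ (f i)

δδ-0 : ∀ {n} {u v : Fin n} i → u ≢ v → δ u i * δ v i ≡ 0
δδ-0 {u = u} {v} i u≢v with u F.≟ i | v F.≟ i
... | yes refl | yes refl = contradiction refl u≢v
... | yes _    | no _     = refl
... | no _     | _        = refl

-- Here `p` marks an entry to be deleted and `q` one to be added. Free of subtraction, the identity
-- can be summed.
toggle-row : ∀ x {p q} → (p ≡ true → x ≡ true) → (q ≡ true → x ≡ false) →
  β (x xor (p xor q)) + β p ≡ β x + β q
toggle-row false {false} {false} hp hq = refl
toggle-row false {false} {true}  hp hq = refl
toggle-row true  {false} {false} hp hq = refl
toggle-row true  {true}  {false} hp hq = refl
toggle-row false {true}  {q}     hp hq = contradiction (hp refl) λ ()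
toggle-row true  {p}     {true}  hp hq = contradiction (hq refl) λ ()

record Switchable {n} (a b c e : Fin n) (G : Graph n) : Set where
  field
    a≢b : a ≢ b
    a≢c : a ≢ c
    a≢e : a ≢ e
    b≢c : b ≢ c
    b≢e : b ≢ e
    c≢e : c ≢ e
    ab : lookup (lookup G a) b ≡ true
    ce : lookup (lookup G c) e ≡ true
    ac : lookup (lookup G a) c ≡ false
    be : lookup (lookup G b) e ≡ false

≟-true : ∀ {n} {u v : Fin n} → ⌊ u F.≟ v ⌋ ≡ true → u ≡ v
≟-true {u = u} {v} h with u F.≟ v
... | yes p = p

module _ {n} {a b c e : Fin n} {G : Graph n} (simple : IsSimple G) (sw : Switchable a b c e G) where

  open Switchable sw

  private
    G′ = switch a b c e G

    at : ∀ {u v w j} → Adj G u v → lookup (lookup G u) w ≡ false →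
      ∀ {x p q} → x ≡ ⌊ v F.≟ j ⌋ xor ⌊ w F.≟ j ⌋ → p ≡ δ v j → q ≡ δ w j →
      β (lookup (lookup G u) j xor x) + p ≡ ad G u j + q
    at {u} {v} {w} {j} uv uw refl refl refl = toggle-row (lookup (lookup G u) j)
      (λ p → trans (cong (lookup (lookup G u)) (sym (≟-true p))) uv)
      (λ p → trans (cong (lookup (lookup G u)) (sym (≟-true p))) uw)

    flip-ab : Adj G b a
    flip-ab = trans (sym (proj₂ simple a b)) ab
    flip-ce : Adj G e c
    flip-ce = trans (sym (proj₂ simple c e)) ce
    flip-ac : lookup (lookup G c) a ≡ false
    flip-ac = trans (sym (proj₂ simple a c)) ac
    flip-be : lookup (lookup G e) b ≡ false
    flip-be = trans (sym (proj₂ simple b e)) be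

    xor-a : ∀ p q → ((p ∨ false) xor false) xor ((q ∨ false) xor false) ≡ p xor q
    xor-a false false = refl
    xor-a false true  = refl
    xor-a true  false = refl
    xor-a true  true  = refl

    xor-b : ∀ p q → (p xor false) xor (false xor (q ∨ false)) ≡ p xor q
    xor-b false false = refl
    xor-b false true  = refl
    xor-b true  false = refl
    xor-b true  true  = refl

    xor-c : ∀ p q → (false xor (p ∨ false)) xor (q xor false) ≡ p xor q
    xor-c false false = refl
    xor-c false true  = refl
    xor-c true  false = refl
    xor-c true  true  = refl

    +0 : ∀ x → x + 0 ≡ x
    +0 = +-identityʳ

    +00 : ∀ x → x + 0 + 0 ≡ x
    +00 x = trans (+0 (x + 0)) (+0 x)

    +000 : ∀ x → x + 0 + 0 + 0 ≡ x
    +000 x = trans (+0 (x + 0 + 0)) (+00 x)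

  -- Degrees and internal degree sums are linear in the entries, so this one additive identity
  -- yields the effect of a switching on all of them. Only the rows a, b, c, e change, and each of
  -- them loses one entry and gains one.
  switch-entry : ∀ i j → ad G′ i j + μ a b c e i j ≡ ad G i j + μ a c b e i j
  switch-entry i j rewrite lookup-switch a b c e G i j with a F.≟ i | b F.≟ i | c F.≟ i | e F.≟ i
  ... | yes refl | yes refl | _        | _        = contradiction refl a≢b
  ... | yes refl | _        | yes refl | _        = contradiction refl a≢c
  ... | yes refl | _        | _        | yes refl = contradiction refl a≢e
  ... | _        | yes refl | yes refl | _        = contradiction refl b≢c
  ... | _        | yes refl | _        | yes refl = contradiction refl b≢e
  ... | _        | _        | yes refl | yes refl = contradiction refl c≢e
  ... | no _     | no _     | no _     | no _     = cong (λ b → β b + 0) (xor-identityʳ _)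
  ... | yes refl | no _     | no _     | no _     = at ab ac (xor-a ⌊ b F.≟ j ⌋ ⌊ c F.≟ j ⌋) (+000 (δ b j)) (+000 (δ c j))
  ... | no _     | yes refl | no _     | no _     = at flip-ab be (xor-b ⌊ a F.≟ j ⌋ ⌊ e F.≟ j ⌋) (+00 (δ a j)) (+00 (δ e j))
  ... | no _     | no _     | yes refl | no _     = at ce flip-ac (xor-c ⌊ e F.≟ j ⌋ ⌊ a F.≟ j ⌋) (+00 (δ e j)) (+00 (δ a j))
  ... | no _     | no _     | no _     | yes refl = at flip-ce flip-be refl (+0 (δ c j)) (+0 (δ b j))

β-false : ∀ {x} → β x ≡ 0 → x ≡ false
β-false {false} _ = refl

∑-μ : ∀ {n} (a b c e i : Fin n) → ∑ (μ a b c e i) ≡ (δ a i + δ b i) + (δ c i + δ e i)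
∑-μ a b c e i = begin
  ∑ (μ a b c e i)
    ≡⟨ ∑-+ (λ j → δ a i * δ b j + δ b i * δ a j) (λ j → δ c i * δ e j + δ e i * δ c j) ⟩
  _ ≡⟨ cong₂ _+_ (∑-+ (λ j → δ a i * δ b j) (λ j → δ b i * δ a j)) (∑-+ (λ j → δ c i * δ e j) (λ j → δ e i * δ c j)) ⟩
  _ ≡⟨ cong₂ _+_ (cong₂ _+_ (row a b) (row b a)) (cong₂ _+_ (row c e) (row e c)) ⟩
  _ ∎
  where
  open ≡-Reasoning
  row : ∀ u v → (∑ λ j → δ u i * δ v j) ≡ δ u i
  row u v = trans (∑-pull (δ u i) (δ v)) (trans (cong (δ u i *_) (∑-δ1 v)) (*-identityʳ _))

module _ {n d} {a b c e : Fin n} {G : Graph n} (reg : Regular d G) (sw : Switchable a b c e G) where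

  open Switchable sw

  private
    G′     = switch a b c e G
    simple = proj₁ reg
    entry  = switch-entry {G = G} simple sw

  switch-sym : ∀ i j → lookup (lookup G′ i) j ≡ lookup (lookup G′ j) i
  switch-sym i j = trans (lookup-switch a b c e G i j)
    (trans (cong₂ _xor_ (proj₂ simple i j) (swap-sym a b c e i j)) (sym (lookup-switch a b c e G j i)))

  switch-diag : ∀ i → lookup (lookup G′ i) i ≡ false
  switch-diag i = β-false (m+n≡0⇒m≡0 _ (trans (entry i i) (cong₂ _+_ (ad-diag {G = G} simple i)
    (cong₂ _+_ (cong₂ _+_ (δδ-0 i a≢c) (δδ-0 i (a≢c ∘ sym))) (cong₂ _+_ (δδ-0 i b≢e) (δδ-0 i (b≢e ∘ sym)))))))

  switch-regular : Regular d G′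
  switch-regular = (switch-diag , switch-sym) , λ i → +-cancelʳ-≡ (m i) _ _ (begin
    deg G′ i + m i                             ≡⟨ cong₂ _+_ (deg-∑ G′ i) (sym (∑-μ a b c e i)) ⟩
    ∑ (ad G′ i) + ∑ (μ a b c e i)              ≡⟨ ∑-+ (ad G′ i) (μ a b c e i) ⟨
    ∑ (λ j → ad G′ i j + μ a b c e i j)        ≡⟨ sum-cong-≗ (entry i) ⟩
    ∑ (λ j → ad G i j + μ a c b e i j)         ≡⟨ ∑-+ (ad G i) (μ a c b e i) ⟩
    ∑ (ad G i) + ∑ (μ a c b e i)               ≡⟨ cong₂ _+_ (row-sum {G = G} reg i) (∑-μ a c b e i) ⟩
    d + ((δ a i + δ c i) + (δ b i + δ e i))    ≡⟨ cong (d +_) (interchange +-commutativeSemigroup (δ a i) (δ c i) (δ b i) (δ e i)) ⟩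
    d + m i                                    ∎)
    where
    open ≡-Reasoning
    m : Fin n → ℕ
    m i = (δ a i + δ b i) + (δ c i + δ e i)

  -- Abstracting over the eight comparisons lets a case split evaluate the Boolean expression; the
  -- inequalities leave only combinations where it is true.
  switch-ac : Adj G′ a c
  switch-ac = trans (lookup-switch a b c e G a c) (cong₂ _xor_ ac (swap-ac (a F.≟ a) (b F.≟ a) (c F.≟ a) (e F.≟ a) (a F.≟ c) (b F.≟ c) (c F.≟ c) (e F.≟ c)))
    where
    swap-ac : (aa : Dec (a ≡ a)) (ba : Dec (b ≡ a)) (ca : Dec (c ≡ a)) (ea : Dec (e ≡ a))
              (ac : Dec (a ≡ c)) (bc : Dec (b ≡ c)) (cc : Dec (c ≡ c)) (ec : Dec (e ≡ c)) →
              (((⌊ aa ⌋ ∧ ⌊ bc ⌋) ∨ (⌊ ba ⌋ ∧ ⌊ ac ⌋)) xor ((⌊ ca ⌋ ∧ ⌊ ec ⌋) ∨ (⌊ ea ⌋ ∧ ⌊ cc ⌋))) xor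
              (((⌊ aa ⌋ ∧ ⌊ cc ⌋) ∨ (⌊ ca ⌋ ∧ ⌊ ac ⌋)) xor ((⌊ ba ⌋ ∧ ⌊ ec ⌋) ∨ (⌊ ea ⌋ ∧ ⌊ bc ⌋))) ≡ true
    swap-ac (no p)  _       _       _       _       _       _       _ = contradiction refl p
    swap-ac _       (yes p) _       _       _       _       _       _ = contradiction (sym p) a≢b
    swap-ac _       _       (yes p) _       _       _       _       _ = contradiction (sym p) a≢c
    swap-ac _       _       _       (yes p) _       _       _       _ = contradiction (sym p) a≢e
    swap-ac _       _       _       _       _       (yes p) _       _ = contradiction p b≢c
    swap-ac _       _       _       _       _       _       (no p)  _ = contradiction refl p
    swap-ac (yes _) (no _)  (no _)  (no _)  _       (no _)  (yes _) _ = refl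

  switch-be : Adj G′ b e
  switch-be = trans (lookup-switch a b c e G b e) (cong₂ _xor_ be (swap-be (a F.≟ b) (b F.≟ b) (c F.≟ b) (e F.≟ b) (a F.≟ e) (b F.≟ e) (c F.≟ e) (e F.≟ e)))
    where
    swap-be : (ab : Dec (a ≡ b)) (bb : Dec (b ≡ b)) (cb : Dec (c ≡ b)) (eb : Dec (e ≡ b))
              (ae : Dec (a ≡ e)) (be : Dec (b ≡ e)) (ce : Dec (c ≡ e)) (ee : Dec (e ≡ e)) →
              (((⌊ ab ⌋ ∧ ⌊ be ⌋) ∨ (⌊ bb ⌋ ∧ ⌊ ae ⌋)) xor ((⌊ cb ⌋ ∧ ⌊ ee ⌋) ∨ (⌊ eb ⌋ ∧ ⌊ ce ⌋))) xor
              (((⌊ ab ⌋ ∧ ⌊ ce ⌋) ∨ (⌊ cb ⌋ ∧ ⌊ ae ⌋)) xor ((⌊ bb ⌋ ∧ ⌊ ee ⌋) ∨ (⌊ eb ⌋ ∧ ⌊ be ⌋))) ≡ true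
    swap-be (yes p) _       _       _       _       _       _       _       = contradiction p a≢b
    swap-be _       (no p)  _       _       _       _       _       _       = contradiction refl p
    swap-be _       _       (yes p) _       _       _       _       _       = contradiction (sym p) b≢c
    swap-be _       _       _       (yes p) _       _       _       _       = contradiction (sym p) b≢e
    swap-be _       _       _       _       (yes p) _       _       _       = contradiction p a≢e
    swap-be _       _       _       _       _       _       _       (no p)  = contradiction refl p
    swap-be (no _)  (yes _) (no _)  (no _)  (no _)  _       _       (yes _) = refl

  -- The edge ab is counted in both directions, hence the 2; ce lies outside S, and ac and be cross
  -- its boundary.
  switch-inn : ∀ S → lookup S a ≡ true → lookup S b ≡ true → lookup S c ≡ false → lookup S e ≡ false →
               inn S G′ + 2 ≡ inn S G
  switch-inn S sa sb sc se = begin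
    inn S G′ + 2
      ≡⟨ cong (inn S G′ +_) (trans (∑-*μ a b c e s s) two) ⟨
    inn S G′ + (∑ λ i → ∑ λ j → s i * s j * μ a b c e i j)
      ≡⟨ ∑∑-+ (λ i j → s i * s j * ad G′ i j) (λ i j → s i * s j * μ a b c e i j) ⟨
    (∑ λ i → ∑ λ j → s i * s j * ad G′ i j + s i * s j * μ a b c e i j)
      ≡⟨ sum-cong-≗ (λ i → sum-cong-≗ λ j → trans (sym (*-distribˡ-+ (s i * s j) _ _))
           (trans (cong (s i * s j *_) (entry i j)) (*-distribˡ-+ (s i * s j) _ _))) ⟩
    (∑ λ i → ∑ λ j → s i * s j * ad G i j + s i * s j * μ a c b e i j)
      ≡⟨ ∑∑-+ (λ i j → s i * s j * ad G i j) (λ i j → s i * s j * μ a c b e i j) ⟩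
    inn S G + (∑ λ i → ∑ λ j → s i * s j * μ a c b e i j)
      ≡⟨ cong (inn S G +_) (trans (∑-*μ a c b e s s) none) ⟩
    inn S G + 0
      ≡⟨ +-identityʳ _ ⟩
    inn S G ∎
    where
    open ≡-Reasoning
    s : Fin n → ℕ
    s i = β (lookup S i)
    two : (s a * s b + s b * s a) + (s c * s e + s e * s c) ≡ 2
    two rewrite sa | sb | sc | se = refl
    none : (s a * s c + s c * s a) + (s b * s e + s e * s b) ≡ 0
    none rewrite sa | sb | sc | se = refl

-- Counting switchings between consecutive classes

fwd rev : ∀ {n} → Vec Bool n → (a b c e : Fin n) → Graph n → Bool
fwd S a b c e G = ((lookup S a ∧ lookup S b) ∧ lookup (lookup G a) b)
                ∧ (((not (lookup S c) ∧ not (lookup S e)) ∧ lookup (lookup G c) e)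
                ∧ (not (lookup (lookup G a) c) ∧ not (lookup (lookup G b) e)))
rev S a b c e G = ((lookup S a ∧ not (lookup S c)) ∧ lookup (lookup G a) c)
                ∧ ((lookup S b ∧ not (lookup S e)) ∧ lookup (lookup G b) e)

∑⁴ : ∀ {n} → (Fin n → Fin n → Fin n → Fin n → ℕ) → ℕ
∑⁴ f = ∑ λ a → ∑ λ b → ∑ λ c → ∑ λ e → f a b c e

∑⁴-mono : ∀ {n} {f g : Fin n → Fin n → Fin n → Fin n → ℕ} → (∀ a b c e → f a b c e ≤ g a b c e) → ∑⁴ f ≤ ∑⁴ g
∑⁴-mono h = ∑-mono λ a → ∑-mono λ b → ∑-mono λ c → ∑-mono λ e → h a b c e

∑⁴-cong : ∀ {n} {f g : Fin n → Fin n → Fin n → Fin n → ℕ} → (∀ a b c e → f a b c e ≡ g a b c e) → ∑⁴ f ≡ ∑⁴ g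
∑⁴-cong h = sum-cong-≗ λ a → sum-cong-≗ λ b → sum-cong-≗ λ c → sum-cong-≗ λ e → h a b c e

∑⁴-+ : ∀ {n} (f g : Fin n → Fin n → Fin n → Fin n → ℕ) → ∑⁴ (λ a b c e → f a b c e + g a b c e) ≡ ∑⁴ f + ∑⁴ g
∑⁴-+ f g = trans (sum-cong-≗ λ a → sum-cong-≗ λ b → ∑∑-+ (f a b) (g a b))
  (∑∑-+ (λ a b → ∑ λ c → ∑ (f a b c)) (λ a b → ∑ λ c → ∑ (g a b c)))

∑⁴-* : ∀ {n} (f g : Fin n → Fin n → ℕ) → ∑⁴ (λ a b c e → f a b * g c e) ≡ (∑ λ a → ∑ (f a)) * (∑ λ c → ∑ (g c))
∑⁴-* f g = trans (sum-cong-≗ λ a → sum-cong-≗ λ b → ∑∑-pull (f a b) g) (∑∑-pullʳ (∑ λ c → ∑ (g c)) f)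

≤-bits : ∀ w x y → w ≤ w * (β (not x) * β (not y)) + (w * β x + w * β y)
≤-bits w true  y     rewrite *-zeroʳ w | *-identityʳ w = m≤m+n w _
≤-bits w false true  rewrite *-zeroʳ w | *-identityʳ w = ≤-refl
≤-bits w false false rewrite *-identityʳ w = m≤m+n w _

β-fwd : ∀ x y z → β (x ∧ (y ∧ z)) ≡ β x * β y * β z
β-fwd x y z = trans (β-∧ x (y ∧ z)) (trans (cong (β x *_) (β-∧ y z)) (sym (*-assoc (β x) _ _)))

β-∧³ : ∀ x y z → β ((x ∧ y) ∧ z) ≡ β x * β y * β z
β-∧³ x y z = trans (β-∧ (x ∧ y) z) (cong (_* β z) (β-∧ x y))

module _ {n d} {G : Graph n} (reg : Regular d G) (S : Vec Bool n) where

  private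
    s s̄ : Fin n → ℕ
    s i = β (lookup S i)
    s̄ i = β (not (lookup S i))
    w : ∀ a b c e → ℕ
    w a b c e = (s a * s b * ad G a b) * (s̄ c * s̄ e * ad G c e)

    ∑w : ∑⁴ w ≡ inn S G * inn̄ S G
    ∑w = ∑⁴-* (λ a b → s a * s b * ad G a b) (λ c e → s̄ c * s̄ e * ad G c e)

    w≤ : ∀ a b c e → w a b c e ≤ (s a * s b * ad G a b) * ad G c e
    w≤ a b c e = *-monoʳ-≤ (s a * s b * ad G a b) (≤-trans (*-monoˡ-≤ (ad G c e)
      (*-mono-≤ (β≤1 (not (lookup S c))) (β≤1 (not (lookup S e))))) (≤-reflexive (+-identityʳ _)))

    paths : ∀ a → (∑ λ c → ∑ λ e → ad G a c * ad G c e) ≡ d * d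
    paths a = trans (sum-cong-≗ λ c → trans (∑-pull (ad G a c) (ad G c)) (cong (ad G a c *_) (row-sum {G = G} reg c)))
      (trans (∑-pullʳ d (ad G a)) (cong (_* d) (row-sum {G = G} reg a)))

    -- Once the condition that c and e lie outside S is dropped, d² walks a, c, e of length two
    -- remain for each edge ab.
    blocked-ac : ∑⁴ (λ a b c e → w a b c e * ad G a c) ≤ inn S G * (d * d)
    blocked-ac = begin
      ∑⁴ (λ a b c e → w a b c e * ad G a c)
        ≤⟨ ∑⁴-mono (λ a b c e → ≤-trans (*-monoˡ-≤ (ad G a c) (w≤ a b c e))
             (≤-reflexive (solve-lemma (s a * s b * ad G a b) (ad G c e) (ad G a c)))) ⟩
      ∑⁴ (λ a b c e → (s a * s b * ad G a b) * (ad G a c * ad G c e))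
        ≡⟨ sum-cong-≗ (λ a → sum-cong-≗ λ b → trans (∑∑-pull (s a * s b * ad G a b) (λ c e → ad G a c * ad G c e))
             (cong (s a * s b * ad G a b *_) (paths a))) ⟩
      (∑ λ a → ∑ λ b → (s a * s b * ad G a b) * (d * d)) ≡⟨ ∑∑-pullʳ (d * d) (λ a b → s a * s b * ad G a b) ⟩
      inn S G * (d * d) ∎
      where
      open ≤-Reasoning
      solve-lemma : ∀ x y z → x * y * z ≡ x * (z * y)
      solve-lemma = solve-∀

    blocked-be : ∑⁴ (λ a b c e → w a b c e * ad G b e) ≤ inn S G * (d * d)
    blocked-be = begin
      ∑⁴ (λ a b c e → w a b c e * ad G b e)
        ≤⟨ ∑⁴-mono (λ a b c e → ≤-trans (*-monoˡ-≤ (ad G b e) (w≤ a b c e))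
             (≤-reflexive (trans (solve-lemma (s a * s b * ad G a b) (ad G c e) (ad G b e))
               (cong (λ x → s a * s b * ad G a b * (ad G b e * x)) (ad-sym {G = G} (proj₁ reg) c e))))) ⟩
      ∑⁴ (λ a b c e → (s a * s b * ad G a b) * (ad G b e * ad G e c))
        ≡⟨ sum-cong-≗ (λ a → sum-cong-≗ λ b → trans (∑∑-pull (s a * s b * ad G a b) (λ c e → ad G b e * ad G e c))
             (cong (s a * s b * ad G a b *_) (trans (∑-comm (λ c e → ad G b e * ad G e c)) (paths b)))) ⟩
      (∑ λ a → ∑ λ b → (s a * s b * ad G a b) * (d * d)) ≡⟨ ∑∑-pullʳ (d * d) (λ a b → s a * s b * ad G a b) ⟩
      inn S G * (d * d) ∎
      where
      open ≤-Reasoning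
      solve-lemma : ∀ x y z → x * y * z ≡ x * (z * y)
      solve-lemma = solve-∀

  -- Among the pairs of an oriented edge ab inside and ce outside S, a switching is blocked only if
  -- ac or be is already an edge; each of the two happens for at most d² choices of ce per ab.
  fwd-lower : inn S G * (inn̄ S G ∸ 2 * (d * d)) ≤ ∑⁴ (λ a b c e → β (fwd S a b c e G))
  fwd-lower = ≤-trans (≤-reflexive (*-distribˡ-∸ (inn S G) _ _)) (m≤n+o⇒m∸n≤o _ (inn S G * (2 * (d * d))) (begin
    inn S G * inn̄ S G ≡⟨ ∑w ⟨
    ∑⁴ w
      ≤⟨ ∑⁴-mono (λ a b c e → ≤-bits (w a b c e) (lookup (lookup G a) c) (lookup (lookup G b) e)) ⟩
    ∑⁴ (λ a b c e → w a b c e * (β (not (lookup (lookup G a) c)) * β (not (lookup (lookup G b) e)))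
                    + (w a b c e * ad G a c + w a b c e * ad G b e))
      ≡⟨ trans (∑⁴-+ (λ a b c e → w a b c e * (β (not (lookup (lookup G a) c)) * β (not (lookup (lookup G b) e))))
                       (λ a b c e → w a b c e * ad G a c + w a b c e * ad G b e)) (cong₂ _+_ (∑⁴-cong λ a b c e → sym (β-bits a b c e))
           (∑⁴-+ (λ a b c e → w a b c e * ad G a c) (λ a b c e → w a b c e * ad G b e))) ⟩
    _ ≤⟨ +-monoʳ-≤ (∑⁴ (λ a b c e → β (fwd S a b c e G))) (+-mono-≤ blocked-ac blocked-be) ⟩
    ∑⁴ (λ a b c e → β (fwd S a b c e G)) + (inn S G * (d * d) + inn S G * (d * d))
      ≡⟨ cong (∑⁴ (λ a b c e → β (fwd S a b c e G)) +_) (solve-lemma (inn S G) (d * d)) ⟩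
    ∑⁴ (λ a b c e → β (fwd S a b c e G)) + inn S G * (2 * (d * d)) ≡⟨ +-comm _ (inn S G * (2 * (d * d))) ⟩
    _ ∎))
    where
    open ≤-Reasoning
    solve-lemma : ∀ x y → x * y + x * y ≡ x * (2 * y)
    solve-lemma = solve-∀
    β-bits : ∀ a b c e → β (fwd S a b c e G) ≡
      w a b c e * (β (not (lookup (lookup G a) c)) * β (not (lookup (lookup G b) e)))
    β-bits a b c e = trans (β-fwd ((lookup S a ∧ lookup S b) ∧ lookup (lookup G a) b) _ _)
      (cong₂ _*_ (cong₂ _*_ (β-∧³ (lookup S a) (lookup S b) (lookup (lookup G a) b))
        (β-∧³ (not (lookup S c)) (not (lookup S e)) (lookup (lookup G c) e)))
        (β-∧ (not (lookup (lookup G a) c)) (not (lookup (lookup G b) e))))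

  -- Exchanging the sums over b and c separates the pairs (a, c) and (b, e). `rev` remembers nothing
  -- but the two crossing edges, which suffices because reverse switchings are needed from above
  -- only.
  rev-count : ∑⁴ (λ a b c e → β (rev S a b c e G)) ≡ cut S G ^ 2
  rev-count = begin
    ∑⁴ (λ a b c e → β (rev S a b c e G))
      ≡⟨ ∑⁴-cong (λ a b c e → trans (β-∧ ((lookup S a ∧ not (lookup S c)) ∧ lookup (lookup G a) c) _)
           (cong₂ _*_ (β-∧³ (lookup S a) _ _) (β-∧³ (lookup S b) _ _))) ⟩
    ∑⁴ (λ a b c e → x a c * x b e)
      ≡⟨ sum-cong-≗ (λ a → ∑-comm (λ b c → ∑ λ e → x a c * x b e)) ⟩
    ∑⁴ (λ a c b e → x a c * x b e) ≡⟨ ∑⁴-* x x ⟩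
    cut S G * cut S G ≡⟨ cong (cut S G *_) (*-identityʳ _) ⟨
    cut S G ^ 2 ∎
    where
    open ≡-Reasoning
    x : Fin n → Fin n → ℕ
    x a c = s a * s̄ c * ad G a c

∧-true : ∀ {x y} → x ∧ y ≡ true → x ≡ true × y ≡ true
∧-true {true} {true} _ = refl , refl

∧-intro : ∀ {x y} → x ≡ true → y ≡ true → x ∧ y ≡ true
∧-intro refl refl = refl

not-true : ∀ {x} → not x ≡ true → x ≡ false
not-true {false} _ = refl

not-false : ∀ {x} → x ≡ false → not x ≡ true
not-false refl = refl

⌊⌋-true : {P : Set} (P? : Dec P) → P → ⌊ P? ⌋ ≡ true
⌊⌋-true (yes _) p = refl
⌊⌋-true (no ¬p) p = contradiction p ¬p

⌊⌋-false : {P : Set} (P? : Dec P) → ¬ P → ⌊ P? ⌋ ≡ false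
⌊⌋-false (yes p) ¬p = contradiction p ¬p
⌊⌋-false (no _)  _  = refl

true-⌊⌋ : {P : Set} (P? : Dec P) → ⌊ P? ⌋ ≡ true → P
true-⌊⌋ (yes p) _ = p

module Switching {n d} (Lall : List (Graph n)) (uniq : Unique Lall) (allReg : All (Regular d) Lall)
                 (complete : ∀ G → Regular d G → G ∈ Lall) (S : Vec Bool n) where

  private
    reg : ∀ {G} → G ∈ Lall → Regular d G
    reg G∈ = All.lookup allReg G∈

    cl : ℕ → Graph n → Bool
    cl E G = ⌊ inn S G ≟ E ⌋

  N : ℕ → ℕ
  N E = count (cl E) Lall

  -- For a fixed quadruple the switching is an injection between graphs; multiplicities enter only
  -- when quadruples are summed.
  switch-count : ∀ E a b c e →
    count (λ G → cl (2 + E) G ∧ fwd S a b c e G) Lall ≤ count (λ G → cl E G ∧ rev S a b c e G) Lall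
  switch-count E a b c e = count-inj _ _ (switch a b c e) (switch-inj a b c e) Lall Lall uniq image
    where
    image : ∀ G → G ∈ Lall → cl (2 + E) G ∧ fwd S a b c e G ≡ true →
           switch a b c e G ∈ Lall × cl E (switch a b c e G) ∧ rev S a b c e (switch a b c e G) ≡ true
    image G G∈ h with ∧-true {cl (2 + E) G} h
    ... | E≡ , f with ∧-true {(lookup S a ∧ lookup S b) ∧ lookup (lookup G a) b} f
    ...   | f₁ , f₂ with ∧-true {lookup S a ∧ lookup S b} f₁ | ∧-true {(not (lookup S c) ∧ not (lookup S e)) ∧ lookup (lookup G c) e} f₂
    ...     | sab , ab | f₃ , f₄ with ∧-true {lookup S a} sab | ∧-true {not (lookup S c) ∧ not (lookup S e)} f₃ | ∧-true {not (lookup (lookup G a) c)} f₄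
    ...       | sa , sb | sce , ce | ac , be with ∧-true {not (lookup S c)} sce
    ...         | sc , se = complete _ (switch-regular {G = G} (reg G∈) sw) ,
      ∧-intro (⌊⌋-true (inn S (switch a b c e G) ≟ E) (+-cancelʳ-≡ 2 _ E (trans (switch-inn {G = G} (reg G∈) sw S sa sb (not-true sc) (not-true se))
                 (trans (true-⌊⌋ (inn S G ≟ 2 + E) E≡) (+-comm 2 E)))))
              (∧-intro (∧-intro (∧-intro sa sc) (switch-ac {G = G} (reg G∈) sw))
                       (∧-intro (∧-intro sb se) (switch-be {G = G} (reg G∈) sw)))
      where
      loop : ∀ {i j} → Adj G i j → i ≢ j
      loop {i} p refl = contradiction (trans (sym p) (proj₁ (proj₁ (reg G∈)) i)) λ ()
      out : ∀ {i j} → lookup S i ≡ true → not (lookup S j) ≡ true → i ≢ j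
      out p q refl = contradiction (trans (sym p) (not-true q)) λ ()
      sw : Switchable a b c e G
      sw = record { a≢b = loop ab ; a≢c = out sa sc ; a≢e = out sa se ; b≢c = out sb sc ; b≢e = out sb se
                  ; c≢e = loop ce ; ab = ab ; ce = ce ; ac = not-true ac ; be = not-true be }

  private
    Σl-∑⁴ : (f : Fin n → Fin n → Fin n → Fin n → Graph n → ℕ) →
            Σl (λ G → ∑⁴ (λ a b c e → f a b c e G)) Lall ≡ ∑⁴ (λ a b c e → Σl (f a b c e) Lall)
    Σl-∑⁴ f = trans (Σl-∑ (λ a G → ∑ λ b → ∑ λ c → ∑ λ e → f a b c e G) Lall) (sum-cong-≗ λ a →
      trans (Σl-∑ (λ b G → ∑ λ c → ∑ λ e → f a b c e G) Lall) (sum-cong-≗ λ b →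
      trans (Σl-∑ (λ c G → ∑ λ e → f a b c e G) Lall) (sum-cong-≗ λ c → Σl-∑ (f a b c) Lall)))

    ∑⁴-class : ∀ x (p : Fin n → Fin n → Fin n → Fin n → Bool) →
               ∑⁴ (λ a b c e → β (x ∧ p a b c e)) ≡ β x * ∑⁴ (λ a b c e → β (p a b c e))
    ∑⁴-class x p = trans (∑⁴-cong λ a b c e → β-∧ x (p a b c e))
      (trans (sum-cong-≗ λ a → sum-cong-≗ λ b → ∑∑-pull (β x) (λ c e → β (p a b c e)))
             (∑∑-pull (β x) (λ a b → ∑ λ c → ∑ λ e → β (p a b c e))))

  -- Double counting of pairs of a graph and a quadruple. By regularity the degree sum inside the
  -- complement exceeds the one inside S by d(n - 2σ), and in class E the cut has σd - E edges.
  switching : ∀ E → 2 * size S ≤ n →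
    N (2 + E) * ((2 + E) * ((2 + E) + d * (n ∸ 2 * size S) ∸ 2 * (d * d))) ≤ N E * (size S * d ∸ E) ^ 2
  switching E 2σ≤n = begin
    N (2 + E) * ((2 + E) * ((2 + E) + d * (n ∸ 2 * size S) ∸ 2 * (d * d)))
      ≡⟨ Σl-*ʳ (β ∘ cl (2 + E)) _ Lall ⟩
    Σl (λ G → β (cl (2 + E) G) * ((2 + E) * ((2 + E) + d * (n ∸ 2 * size S) ∸ 2 * (d * d)))) Lall
      ≤⟨ Σl-mono Lall (λ G G∈ → ≤-trans (lower G (reg G∈)) (≤-reflexive (sym (∑⁴-class (cl (2 + E) G) (λ a b c e → fwd S a b c e G))))) ⟩
    Σl (λ G → ∑⁴ (λ a b c e → β (cl (2 + E) G ∧ fwd S a b c e G))) Lall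
      ≡⟨ Σl-∑⁴ (λ a b c e G → β (cl (2 + E) G ∧ fwd S a b c e G)) ⟩
    ∑⁴ (λ a b c e → count (λ G → cl (2 + E) G ∧ fwd S a b c e G) Lall)
      ≤⟨ ∑⁴-mono (switch-count E) ⟩
    ∑⁴ (λ a b c e → count (λ G → cl E G ∧ rev S a b c e G) Lall)
      ≡⟨ Σl-∑⁴ (λ a b c e G → β (cl E G ∧ rev S a b c e G)) ⟨
    Σl (λ G → ∑⁴ (λ a b c e → β (cl E G ∧ rev S a b c e G))) Lall
      ≤⟨ Σl-mono Lall (λ G G∈ → ≤-trans (≤-reflexive (∑⁴-class (cl E G) (λ a b c e → rev S a b c e G))) (upper G (reg G∈))) ⟩
    Σl (λ G → β (cl E G) * (size S * d ∸ E) ^ 2) Lall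
      ≡⟨ Σl-*ʳ (β ∘ cl E) _ Lall ⟨
    N E * (size S * d ∸ E) ^ 2 ∎
    where
    open ≤-Reasoning
    σ = size S

    inn̄-val : ∀ G → Regular d G → inn̄ S G ≡ inn S G + d * (n ∸ 2 * σ)
    inn̄-val G rG = +-cancelʳ-≡ (cut S G) _ _ (begin-equality
      inn̄ S G + cut S G                    ≡⟨ inn̄+cut {G = G} rG S ⟩
      size̅ S * d                           ≡⟨ cong (_* d) size̅-val ⟩
      (σ + (n ∸ 2 * σ)) * d                 ≡⟨ *-distribʳ-+ d σ _ ⟩
      σ * d + (n ∸ 2 * σ) * d               ≡⟨ cong₂ _+_ (inn+cut {G = G} rG S) (*-comm d (n ∸ 2 * σ)) ⟨
      inn S G + cut S G + d * (n ∸ 2 * σ)   ≡⟨ +-assoc (inn S G) _ _ ⟩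
      inn S G + (cut S G + d * (n ∸ 2 * σ)) ≡⟨ cong (inn S G +_) (+-comm (cut S G) _) ⟩
      inn S G + (d * (n ∸ 2 * σ) + cut S G) ≡⟨ +-assoc (inn S G) _ _ ⟨
      inn S G + d * (n ∸ 2 * σ) + cut S G   ∎)
      where
      size̅-val : size̅ S ≡ σ + (n ∸ 2 * σ)
      size̅-val = +-cancelˡ-≡ σ _ _ (begin-equality
        σ + size̅ S              ≡⟨ size+size̅ S ⟩
        n                        ≡⟨ m+[n∸m]≡n 2σ≤n ⟨
        2 * σ + (n ∸ 2 * σ)      ≡⟨ cong (_+ (n ∸ 2 * σ)) (cong (σ +_) (+-identityʳ σ)) ⟩
        σ + σ + (n ∸ 2 * σ)      ≡⟨ +-assoc σ σ _ ⟩
        σ + (σ + (n ∸ 2 * σ))    ∎)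

    lower : ∀ G → Regular d G → β (cl (2 + E) G) * ((2 + E) * ((2 + E) + d * (n ∸ 2 * σ) ∸ 2 * (d * d))) ≤
            β (cl (2 + E) G) * ∑⁴ (λ a b c e → β (fwd S a b c e G))
    lower G rG with inn S G ≟ 2 + E
    ... | no _   = z≤n
    ... | yes eq = *-monoʳ-≤ 1 (subst (λ x → x * (x + d * (n ∸ 2 * σ) ∸ 2 * (d * d)) ≤ ∑⁴ (λ a b c e → β (fwd S a b c e G))) eq
      (subst (λ y → inn S G * (y ∸ 2 * (d * d)) ≤ ∑⁴ (λ a b c e → β (fwd S a b c e G))) (inn̄-val G rG) (fwd-lower {G = G} rG S)))

    upper : ∀ G → Regular d G → β (cl E G) * ∑⁴ (λ a b c e → β (rev S a b c e G)) ≤ β (cl E G) * (σ * d ∸ E) ^ 2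
    upper G rG with inn S G ≟ E
    ... | no _     = z≤n
    ... | yes refl = *-monoʳ-≤ 1 (≤-reflexive (trans (rev-count {G = G} rG S)
      (cong (_^ 2) (sym (trans (cong (_∸ inn S G) (sym (inn+cut {G = G} rG S))) (m+n∸m≡n (inn S G) _))))))

-- Elementary inequalities

-- Bernoulli's inequality with denominators cleared: the first two terms of the binomial expansion.
bernoulli : ∀ x z k → x ^ k * (x + suc k * z) ≤ (x + z) ^ suc k
bernoulli x z zero    = ≤-reflexive (eq x z)
  where
  eq : ∀ x z → 1 * (x + 1 * z) ≡ (x + z) * 1
  eq = solve-∀
bernoulli x z (suc k) = begin
  x ^ suc k * (x + suc (suc k) * z)                   ≤⟨ ≤-by (x ^ k * (z * (suc k * z))) (eq x z (x ^ k) (suc k)) ⟩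
  (x + z) * (x ^ k * (x + suc k * z))                 ≤⟨ *-monoʳ-≤ (x + z) (bernoulli x z k) ⟩
  (x + z) ^ suc (suc k)                               ∎
  where
  open ≤-Reasoning
  eq : ∀ x z y k → (x + z) * (y * (x + k * z)) ≡ x * y * (x + suc k * z) + y * (z * (k * z))
  eq = solve-∀

-- The first three terms of the binomial expansion, doubled to clear the binomial coefficient.
bernoulli₂ : ∀ x z k → x ^ k * (2 * (x * x) + 2 * (2 + k) * x * z + (2 + k) * (1 + k) * (z * z)) ≤ 2 * (x + z) ^ (2 + k)
bernoulli₂ x z zero    = ≤-reflexive (eq x z)
  where
  eq : ∀ x z → 1 * (2 * (x * x) + 4 * x * z + 2 * (z * z)) ≡ 2 * ((x + z) * ((x + z) * 1))
  eq = solve-∀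
bernoulli₂ x z (suc k) = begin
  x ^ suc k * (2 * (x * x) + 2 * (3 + k) * x * z + (3 + k) * (2 + k) * (z * z))
    ≤⟨ ≤-by (x ^ k * ((2 + k) * (1 + k) * (z * z * z))) (eq x z (x ^ k) k) ⟩
  (x + z) * (x ^ k * (2 * (x * x) + 2 * (2 + k) * x * z + (2 + k) * (1 + k) * (z * z)))
    ≤⟨ *-monoʳ-≤ (x + z) (bernoulli₂ x z k) ⟩
  (x + z) * (2 * (x + z) ^ (2 + k))
    ≡⟨ eq′ (x + z) ((x + z) ^ (2 + k)) ⟩
  2 * (x + z) ^ (3 + k) ∎
  where
  open ≤-Reasoning
  eq : ∀ x z y k → (x + z) * (y * (2 * (x * x) + 2 * (2 + k) * x * z + (2 + k) * (1 + k) * (z * z)))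
     ≡ x * y * (2 * (x * x) + 2 * (3 + k) * x * z + (3 + k) * (2 + k) * (z * z)) + y * ((2 + k) * (1 + k) * (z * z * z))
  eq = solve-∀
  eq′ : ∀ u v → u * (2 * v) ≡ 2 * (u * v)
  eq′ = solve-∀

-- For B = 2 + h this reads (1 + 2/(B - 1))^B ≥ 5: the first three terms of the expansion add up to
-- 1 + 4B/(B - 1). Any constant above the 4 of `ofSize-bound` would serve.
five : ∀ h → 5 * suc h ^ (2 + h) ≤ (3 + h) ^ (2 + h)
five h = *-cancelˡ-≤ 2 (begin
  2 * (5 * suc h ^ (2 + h))
    ≤⟨ ≤-by (suc h ^ h * (8 * suc h)) (eq h (suc h ^ h)) ⟩
  suc h ^ h * (2 * (suc h * suc h) + 2 * (2 + h) * suc h * 2 + (2 + h) * (1 + h) * (2 * 2))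
    ≤⟨ bernoulli₂ (suc h) 2 h ⟩
  2 * (suc h + 2) ^ (2 + h)
    ≡⟨ cong (λ x → 2 * x ^ (2 + h)) (+-comm (suc h) 2) ⟩
  2 * (3 + h) ^ (2 + h) ∎)
  where
  open ≤-Reasoning
  eq : ∀ h y → y * (2 * (suc h * suc h) + 2 * (2 + h) * suc h * 2 + (2 + h) * (1 + h) * (2 * 2))
     ≡ 2 * (5 * (suc h * (suc h * y))) + y * (8 * suc h)
  eq = solve-∀

^-distribʳ-* : ∀ k x y → (x * y) ^ k ≡ x ^ k * y ^ k
^-distribʳ-* zero    x y = refl
^-distribʳ-* (suc k) x y = trans (cong (x * y *_) (^-distribʳ-* k x y)) ([m*n]*[o*p]≡[m*o]*[n*p] x y (x ^ k) (y ^ k))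

^-pos : ∀ x n → 0 < x → 0 < x ^ n
^-pos x n h = m^n>0 x {{>-nonZero h}} n

*-cancelʳ-≤′ : ∀ {m n} o → 0 < o → m * o ≤ n * o → m ≤ n
*-cancelʳ-≤′ {m} {n} o h = *-cancelʳ-≤ m n o {{>-nonZero h}}

-- (n / r)^n ≤ 4^σ for n = r + σ and σ ≤ r: equality at r = σ, and (r / n)^n increases with r.
power-ratio : ∀ σ t → let r = t + σ ; n = r + σ in n ^ n ≤ 4 ^ σ * r ^ n
power-ratio σ zero = ≤-reflexive (begin
  (σ + σ) ^ (σ + σ)                   ≡⟨ cong (_^ (σ + σ)) (cong (σ +_) (sym (+-identityʳ σ))) ⟩
  (2 * σ) ^ (σ + σ)                   ≡⟨ ^-distribʳ-* (σ + σ) 2 σ ⟩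
  2 ^ (σ + σ) * σ ^ (σ + σ)           ≡⟨ cong (_* σ ^ (σ + σ)) (cong (λ x → 2 ^ (σ + x)) (sym (+-identityʳ σ))) ⟩
  2 ^ (2 * σ) * σ ^ (σ + σ)           ≡⟨ cong (_* σ ^ (σ + σ)) (sym (^-*-assoc 2 2 σ)) ⟩
  4 ^ σ * σ ^ (σ + σ)                 ∎)
  where open ≡-Reasoning
power-ratio zero    (suc t) rewrite +-identityʳ t | +-identityʳ t = ≤-reflexive (sym (+-identityʳ _))
power-ratio σ@(suc _) (suc t) = *-cancelʳ-≤′ (n ^ n) (^-pos n n n>0) (begin
  suc n ^ suc n * n ^ n                 ≤⟨ *-monoʳ-≤ (suc n ^ suc n) (power-ratio σ t) ⟩
  suc n ^ suc n * (4 ^ σ * r ^ n)       ≡⟨ eq₁ (suc n ^ suc n) (4 ^ σ) (r ^ n) ⟩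
  4 ^ σ * (suc n ^ suc n * r ^ n)       ≤⟨ *-monoʳ-≤ (4 ^ σ) raise ⟩
  4 ^ σ * (suc r ^ suc n * n ^ n)       ≡⟨ *-assoc (4 ^ σ) _ _ ⟨
  4 ^ σ * suc r ^ suc n * n ^ n         ∎)
  where
  open ≤-Reasoning
  r = t + σ
  n = r + σ
  n>0 : 0 < n
  n>0 = ≤-trans z<s (m≤n+m σ r)
  eq₁ : ∀ x y z → x * (y * z) ≡ y * (x * z)
  eq₁ = solve-∀
  -- Bernoulli's inequality applies because n = r + σ gives (r + 1)n = (n + 1)r + σ.
  raise : suc n ^ suc n * r ^ n ≤ suc r ^ suc n * n ^ n
  raise = *-cancelʳ-≤′ n n>0 (begin
    suc n ^ suc n * r ^ n * n                          ≡⟨ eq₂ (suc n) (suc n ^ n) (r ^ n) r σ ⟩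
    suc n ^ n * r ^ n * (suc n * r + suc n * σ)        ≡⟨ cong (_* (suc n * r + suc n * σ)) (^-distribʳ-* n (suc n) r) ⟨
    (suc n * r) ^ n * (suc n * r + suc n * σ)          ≤⟨ bernoulli (suc n * r) σ n ⟩
    (suc n * r + σ) ^ suc n                            ≡⟨ cong (_^ suc n) (eq₃ r σ) ⟩
    (suc r * n) ^ suc n                                ≡⟨ ^-distribʳ-* (suc n) (suc r) n ⟩
    suc r ^ suc n * (n * n ^ n)                        ≡⟨ eq₄ (suc r ^ suc n) n (n ^ n) ⟩
    suc r ^ suc n * n ^ n * n                          ∎)
    where
    eq₂ : ∀ m x y r σ → m * x * y * (r + σ) ≡ x * y * (m * r + m * σ)
    eq₂ = solve-∀
    eq₃ : ∀ r σ → suc (r + σ) * r + σ ≡ suc r * (r + σ)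
    eq₃ = solve-∀
    eq₄ : ∀ x y z → x * (y * z) ≡ x * z * y
    eq₄ = solve-∀

-- A weak Stirling bound by induction; the step T^T ≤ 4(T - 1)^T is `power-ratio` with σ = 1.
factorial-lower : ∀ T → T ^ T ≤ 4 ^ T * T !
factorial-lower zero          = ≤-refl
factorial-lower (suc zero)    = s≤s z≤n
factorial-lower T@(suc t@(suc u)) = begin
  T ^ T                           ≡⟨ cong₂ _^_ n≡ n≡ ⟨
  (u + 1 + 1) ^ (u + 1 + 1)       ≤⟨ power-ratio 1 u ⟩
  4 * (u + 1) ^ (u + 1 + 1)       ≡⟨ cong₂ (λ x y → 4 * x ^ y) (+-comm u 1) n≡ ⟩
  4 * (t * t ^ t)                 ≤⟨ *-monoʳ-≤ 4 (*-mono-≤ (n≤1+n t) (factorial-lower t)) ⟩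
  4 * (T * (4 ^ t * t !))         ≡⟨ eq T (4 ^ t) (t !) ⟩
  4 * 4 ^ t * (T * t !)           ∎
  where
  open ≤-Reasoning
  n≡ : u + 1 + 1 ≡ 2 + u
  n≡ = trans (+-comm (u + 1) 1) (cong suc (+-comm u 1))
  eq : ∀ x y z → 4 * (x * (y * z)) ≡ 4 * y * (x * z)
  eq = solve-∀

-- Products of ratios

∏ : (ℕ → ℕ) → ℕ → ℕ
∏ f zero    = 1
∏ f (suc T) = ∏ f T * f T

∏-* : ∀ f g T → ∏ (λ i → f i * g i) T ≡ ∏ f T * ∏ g T
∏-* f g zero    = refl
∏-* f g (suc T) = trans (cong (_* (f T * g T)) (∏-* f g T)) (eq (∏ f T) (∏ g T) (f T) (g T))
  where
  eq : ∀ a b c d → a * b * (c * d) ≡ a * c * (b * d)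
  eq = solve-∀

∏-const : ∀ c T → ∏ (λ _ → c) T ≡ c ^ T
∏-const c zero    = refl
∏-const c (suc T) = trans (cong (_* c) (∏-const c T)) (*-comm _ c)

∏-pos : ∀ f T → (∀ i → 0 < f i) → 0 < ∏ f T
∏-pos f zero    h = z<s
∏-pos f (suc T) h = *-mono-≤ (∏-pos f T h) (h T)

∏-suc : ∀ T → ∏ suc T ≡ T !
∏-suc zero    = refl
∏-suc (suc T) = trans (cong (_* suc T) (∏-suc T)) (*-comm (T !) (suc T))

-- Telescoping of f(i + 1)/f(i) ≤ q(i)/p(i), cross-multiplied so that vanishing values need no
-- attention.
chain : ∀ (f p q : ℕ → ℕ) → (∀ i → f (suc i) * p i ≤ f i * q i) → ∀ T → f T * ∏ p T ≤ f 0 * ∏ q T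
chain f p q h zero    = ≤-refl
chain f p q h (suc T) = begin
  f (suc T) * (∏ p T * p T)   ≡⟨ eq (f (suc T)) (∏ p T) (p T) ⟩
  f (suc T) * p T * ∏ p T     ≤⟨ *-monoˡ-≤ (∏ p T) (h T) ⟩
  f T * q T * ∏ p T           ≡⟨ eq′ (f T) (q T) (∏ p T) ⟩
  f T * ∏ p T * q T           ≤⟨ *-monoˡ-≤ (q T) (chain f p q h T) ⟩
  f 0 * ∏ q T * q T           ≡⟨ *-assoc (f 0) _ _ ⟩
  f 0 * (∏ q T * q T)         ∎
  where
  open ≤-Reasoning
  eq : ∀ x y z → x * (y * z) ≡ x * z * y
  eq = solve-∀
  eq′ : ∀ x y z → x * y * z ≡ x * z * y
  eq′ = solve-∀

-- superadditivity of artanh: (B - i) / (B + i) ≤ ((B - 1) / (B + 1))^i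
ratio-power : ∀ h i → let B = suc h in (B ∸ i) * suc B ^ i ≤ (B + i) * h ^ i
ratio-power h zero    = ≤-reflexive (cong (_* 1) (sym (+-identityʳ (suc h))))
ratio-power h (suc i) with ≤-total h i
... | inj₁ h≤i rewrite m≤n⇒m∸n≡0 h≤i = z≤n
... | inj₂ i≤h = *-cancelʳ-≤′ (B + i) z<s (begin
  (h ∸ i) * (suc B * suc B ^ i) * (B + i)           ≡⟨ eq₁ (h ∸ i) (suc B) (suc B ^ i) (B + i) ⟩
  (h ∸ i) * (B + i) * suc B * suc B ^ i             ≤⟨ *-monoˡ-≤ (suc B ^ i) key ⟩
  (B ∸ i) * (suc B + i) * h * suc B ^ i             ≡⟨ eq₂ (B ∸ i) (suc B + i) h (suc B ^ i) ⟩
  (suc B + i) * h * ((B ∸ i) * suc B ^ i)           ≤⟨ *-monoʳ-≤ ((suc B + i) * h) (ratio-power h i) ⟩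
  (suc B + i) * h * ((B + i) * h ^ i)               ≡⟨ eq₃ (suc B + i) h (B + i) (h ^ i) ⟩
  (suc B + i) * (h * h ^ i) * (B + i)               ≡⟨ cong (λ x → x * (h * h ^ i) * (B + i)) (sym (+-suc B i)) ⟩
  (B + suc i) * (h * h ^ i) * (B + i)               ∎)
  where
  open ≤-Reasoning
  B = suc h
  eq₁ : ∀ a b c d → a * (b * c) * d ≡ a * d * b * c
  eq₁ = solve-∀
  eq₂ : ∀ a b c d → a * b * c * d ≡ b * c * (a * d)
  eq₂ = solve-∀
  eq₃ : ∀ a b c d → a * b * (c * d) ≡ a * (b * d) * c
  eq₃ = solve-∀
  poly : ∀ t i → suc t * (suc (suc (t + i)) + i) * (t + i) ≡ t * (suc (t + i) + i) * suc (suc (t + i)) + (2 * (i * i) + 2 * i)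
  poly = solve-∀
  key : (h ∸ i) * (B + i) * suc B ≤ (B ∸ i) * (suc B + i) * h
  key = subst₂ (λ y x → (h ∸ i) * (suc x + i) * suc (suc x) ≤ y * (suc (suc x) + i) * x)
    (sym (+-∸-assoc 1 i≤h)) (m∸n+n≡m i≤h) (≤-by (2 * (i * i) + 2 * i) (poly (h ∸ i) i))

triangle : ℕ → ℕ
triangle zero    = 0
triangle (suc T) = triangle T + suc T

triangle-lower : ∀ T → T * T ≤ 2 * triangle T
triangle-lower zero    = z≤n
triangle-lower (suc T) = begin
  suc T * suc T                  ≤⟨ ≤-by 1 (eq T) ⟩
  T * T + 2 * suc T              ≤⟨ +-monoˡ-≤ (2 * suc T) (triangle-lower T) ⟩
  2 * triangle T + 2 * suc T     ≡⟨ *-distribˡ-+ 2 (triangle T) (suc T) ⟨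
  2 * (triangle T + suc T)       ∎
  where
  open ≤-Reasoning
  eq : ∀ T → T * T + 2 * suc T ≡ suc T * suc T + 1
  eq = solve-∀

-- The exponents supplied by `ratio-power` add up to a triangular number; this quadratic growth is
-- the Gaussian decay.
∏-ratio : ∀ h T → let B = suc h in
  ∏ (λ i → B ∸ suc i) T * suc B ^ triangle T ≤ ∏ (λ i → B + suc i) T * h ^ triangle T
∏-ratio h zero    = ≤-refl
∏-ratio h (suc T) = begin
  p * (B ∸ suc T) * suc B ^ (triangle T + suc T)              ≡⟨ cong (p * (B ∸ suc T) *_) (^-distribˡ-+-* (suc B) (triangle T) (suc T)) ⟩
  p * (B ∸ suc T) * (suc B ^ triangle T * suc B ^ suc T)      ≡⟨ eq p (B ∸ suc T) _ _ ⟩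
  p * suc B ^ triangle T * ((B ∸ suc T) * suc B ^ suc T)      ≤⟨ *-mono-≤ (∏-ratio h T) (ratio-power h (suc T)) ⟩
  q * h ^ triangle T * ((B + suc T) * h ^ suc T)              ≡⟨ eq q (B + suc T) _ _ ⟨
  q * (B + suc T) * (h ^ triangle T * h ^ suc T)              ≡⟨ cong (q * (B + suc T) *_) (^-distribˡ-+-* h (triangle T) (suc T)) ⟨
  q * (B + suc T) * h ^ (triangle T + suc T)                  ∎
  where
  open ≤-Reasoning
  B = suc h
  p = ∏ (λ i → B ∸ suc i) T
  q = ∏ (λ i → B + suc i) T
  eq : ∀ a b c d → a * b * (c * d) ≡ a * c * (b * d)
  eq = solve-∀

-- Since q ≤ p, the bound (q/p)^T is at most (q/p)^ρ. Exponents known only through inequalities are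
-- thus traded for convenient ones.
lower-exponent : ∀ N M p q {ρ T} → 0 < p → q ≤ p → ρ ≤ T → N * p ^ T ≤ M * q ^ T → N * p ^ ρ ≤ M * q ^ ρ
lower-exponent N M p q {ρ} {T} p>0 q≤p ρ≤T h = *-cancelʳ-≤′ (p ^ t) (^-pos p t p>0) (begin
  N * p ^ ρ * p ^ t      ≡⟨ *-assoc N _ _ ⟩
  N * (p ^ ρ * p ^ t)    ≡⟨ cong (N *_) (split p) ⟩
  N * p ^ T              ≤⟨ h ⟩
  M * q ^ T              ≡⟨ cong (M *_) (split q) ⟨
  M * (q ^ ρ * q ^ t)    ≤⟨ *-monoʳ-≤ M (*-monoʳ-≤ (q ^ ρ) (^-monoˡ-≤ t q≤p)) ⟩
  M * (q ^ ρ * p ^ t)    ≡⟨ *-assoc M _ _ ⟨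
  M * q ^ ρ * p ^ t      ∎)
  where
  open ≤-Reasoning
  t = T ∸ ρ
  split : ∀ x → x ^ ρ * x ^ t ≡ x ^ T
  split x = trans (sym (^-distribˡ-+-* x ρ t)) (cong (x ^_) (m+[n∸m]≡n ρ≤T))

-- By ratio-power the i-th ratio is at most (σ / r) ((B - 1) / (B + 1))^2i, so the exponents add up to T (T + 1).
gaussian-chain : ∀ (f : ℕ → ℕ) r σ b T ρ → 0 < r → σ ≤ r → ρ ≤ T → (2 + b) * ρ ≤ T * T →
  (∀ i → f (suc i) * (r * ((2 + b) + suc i) ^ 2) ≤ f i * (σ * ((2 + b) ∸ suc i) ^ 2)) →
  f T * r ^ ρ * 5 ^ ρ ≤ f 0 * σ ^ ρ
gaussian-chain f r σ b T ρ r>0 σ≤r ρ≤T Bρ≤TT decay = *-cancelʳ-≤′ (h ^ (B * ρ)) (^-pos h (B * ρ) z<s) (begin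
  f T * r ^ ρ * 5 ^ ρ * h ^ (B * ρ)         ≡⟨ *-assoc (f T * r ^ ρ) _ _ ⟩
  f T * r ^ ρ * (5 ^ ρ * h ^ (B * ρ))       ≡⟨ cong (λ x → f T * r ^ ρ * (5 ^ ρ * x)) (^-*-assoc h B ρ) ⟨
  f T * r ^ ρ * (5 ^ ρ * (h ^ B) ^ ρ)       ≡⟨ cong (f T * r ^ ρ *_) (^-distribʳ-* ρ 5 (h ^ B)) ⟨
  f T * r ^ ρ * (5 * h ^ B) ^ ρ             ≤⟨ *-monoʳ-≤ (f T * r ^ ρ) (^-monoˡ-≤ ρ (five b)) ⟩
  f T * r ^ ρ * (suc B ^ B) ^ ρ             ≡⟨ cong (f T * r ^ ρ *_) (^-*-assoc (suc B) B ρ) ⟩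
  f T * r ^ ρ * suc B ^ (B * ρ)             ≤⟨ both ⟩
  f 0 * σ ^ ρ * h ^ (B * ρ)                 ∎)
  where
  open ≤-Reasoning
  h = suc b
  B = suc h
  U = triangle T
  p = ∏ (λ i → B + suc i) T
  q = ∏ (λ i → B ∸ suc i) T
  ∏-sq : ∀ c (g : ℕ → ℕ) → ∏ (λ i → c * g i ^ 2) T ≡ c ^ T * (∏ g T * ∏ g T)
  ∏-sq c g = trans (∏-* (λ _ → c) (λ i → g i ^ 2) T) (cong₂ _*_ (∏-const c T)
    (trans (∏-* g (λ i → g i * 1) T) (cong (∏ g T *_) (trans (∏-* g (λ _ → 1) T)
      (trans (cong (∏ g T *_) (trans (∏-const 1 T) (^-zeroˡ T))) (*-identityʳ _))))))
  telescoped : f T * (r ^ T * (p * p)) ≤ f 0 * (σ ^ T * (q * q))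
  telescoped = subst₂ (λ x y → f T * x ≤ f 0 * y) (∏-sq r (λ i → B + suc i)) (∏-sq σ (λ i → B ∸ suc i))
    (chain f (λ i → r * (B + suc i) ^ 2) (λ i → σ * (B ∸ suc i) ^ 2) decay T)
  2U : ∀ x → x ^ U * x ^ U ≡ x ^ (2 * U)
  2U x = trans (sym (^-distribˡ-+-* x U U)) (cong (x ^_) (cong (U +_) (sym (+-identityʳ U))))
  eq₁ : ∀ a b c d → a * b * (d * d) * (c * c) ≡ a * (b * (c * c)) * (d * d)
  eq₁ = solve-∀
  eq₂ : ∀ a b c d → a * (b * (c * c)) * (d * d) ≡ a * b * ((c * d) * (c * d))
  eq₂ = solve-∀
  eq₃ : ∀ a b c d → a * b * ((c * d) * (c * d)) ≡ a * b * (d * d) * (c * c)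
  eq₃ = solve-∀
  full : f T * r ^ T * suc B ^ (2 * U) ≤ f 0 * σ ^ T * h ^ (2 * U)
  full = *-cancelʳ-≤′ (p * p) (*-mono-≤ p>0 p>0) (begin
    f T * r ^ T * suc B ^ (2 * U) * (p * p)                  ≡⟨ cong (λ x → f T * r ^ T * x * (p * p)) (2U (suc B)) ⟨
    f T * r ^ T * (suc B ^ U * suc B ^ U) * (p * p)          ≡⟨ eq₁ (f T) (r ^ T) p (suc B ^ U) ⟩
    f T * (r ^ T * (p * p)) * (suc B ^ U * suc B ^ U)        ≤⟨ *-monoˡ-≤ _ telescoped ⟩
    f 0 * (σ ^ T * (q * q)) * (suc B ^ U * suc B ^ U)        ≡⟨ eq₂ (f 0) (σ ^ T) q (suc B ^ U) ⟩
    f 0 * σ ^ T * ((q * suc B ^ U) * (q * suc B ^ U))        ≤⟨ *-monoʳ-≤ (f 0 * σ ^ T) (*-mono-≤ (∏-ratio h T) (∏-ratio h T)) ⟩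
    f 0 * σ ^ T * ((p * h ^ U) * (p * h ^ U))                ≡⟨ eq₃ (f 0) (σ ^ T) p (h ^ U) ⟩
    f 0 * σ ^ T * (h ^ U * h ^ U) * (p * p)                  ≡⟨ cong (λ x → f 0 * σ ^ T * x * (p * p)) (2U h) ⟩
    f 0 * σ ^ T * h ^ (2 * U) * (p * p)                      ∎)
    where
    p>0 : 0 < p
    p>0 = ∏-pos (λ i → B + suc i) T (λ _ → z<s)
  swapʳ : ∀ a b c → a * b * c ≡ a * c * b
  swapʳ = solve-∀
  -- Both exponents come down: T to ρ for r and σ, and 2U = T(T + 1) ≥ T² to Bρ for the Gaussian
  -- factor.
  both : f T * r ^ ρ * suc B ^ (B * ρ) ≤ f 0 * σ ^ ρ * h ^ (B * ρ)
  both = lower-exponent (f T * r ^ ρ) (f 0 * σ ^ ρ) (suc B) h z<s (≤-trans (n≤1+n h) (n≤1+n B))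
    (≤-trans Bρ≤TT (triangle-lower T))
    (subst₂ _≤_ (swapʳ (f T) (suc B ^ (2 * U)) (r ^ ρ)) (swapʳ (f 0) (h ^ (2 * U)) (σ ^ ρ))
      (lower-exponent (f T * suc B ^ (2 * U)) (f 0 * h ^ (2 * U)) r σ r>0 σ≤r ρ≤T
        (subst₂ _≤_ (swapʳ (f T) (r ^ T) (suc B ^ (2 * U))) (swapʳ (f 0) (σ ^ T) (h ^ (2 * U))) full)))

-- With s = j + 3k, Bernoulli's inequality gives (4 + k)(4/5)^k ≤ 4, and its cube handles (4 + k)³.
-- As s + 1 ≤ 3(4 + k), two of these three factors absorb (s + 1)² and the third absorbs the
-- constant: 1728 = 3 · 9 · 64.
exponential-wins : ∀ C s → 1728 * C ≤ s → C * (suc s * suc s) * 4 ^ s ≤ 5 ^ s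
exponential-wins C s big = *-cancelˡ-≤ 64 (begin
  64 * (C * (suc s * suc s) * 4 ^ s)          ≤⟨ *-monoʳ-≤ 64 (*-monoˡ-≤ (4 ^ s) (*-monoʳ-≤ C (*-mono-≤ s< s<))) ⟩
  64 * (C * ((3 * (4 + k)) * (3 * (4 + k))) * 4 ^ s)  ≡⟨ eq C (4 + k) (4 ^ s) ⟩
  576 * C * ((4 + k) * (4 + k)) * 4 ^ s       ≤⟨ *-monoˡ-≤ (4 ^ s) (*-monoˡ-≤ ((4 + k) * (4 + k)) C≤k) ⟩
  (4 + k) * ((4 + k) * (4 + k)) * 4 ^ s       ≡⟨ cong (λ x → (4 + k) * ((4 + k) * (4 + k)) * x) (decompose 4) ⟩
  (4 + k) * ((4 + k) * (4 + k)) * (4 ^ j * (4 ^ k * (4 ^ k * 4 ^ k)))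
    ≡⟨ eq₂ (4 + k) (4 ^ j) (4 ^ k) ⟩
  4 ^ j * (((4 + k) * 4 ^ k) * (((4 + k) * 4 ^ k) * ((4 + k) * 4 ^ k)))
    ≤⟨ *-mono-≤ (^-monoˡ-≤ j (n≤1+n 4)) (*-mono-≤ (b k) (*-mono-≤ (b k) (b k))) ⟩
  5 ^ j * ((4 * 5 ^ k) * ((4 * 5 ^ k) * (4 * 5 ^ k)))  ≡⟨ eq₃ (5 ^ j) (5 ^ k) ⟩
  64 * (5 ^ j * (5 ^ k * (5 ^ k * 5 ^ k)))    ≡⟨ cong (64 *_) (decompose 5) ⟨
  64 * 5 ^ s                                  ∎)
  where
  open ≤-Reasoning
  k = s / 3
  j = s % 3
  s≡ : s ≡ j + k * 3
  s≡ = m≡m%n+[m/n]*n s 3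
  eq : ∀ c x y → 64 * (c * ((3 * x) * (3 * x)) * y) ≡ 576 * c * (x * x) * y
  eq = solve-∀
  eq₂ : ∀ x y z → x * (x * x) * (y * (z * (z * z))) ≡ y * ((x * z) * ((x * z) * (x * z)))
  eq₂ = solve-∀
  eq₃ : ∀ y z → y * ((4 * z) * ((4 * z) * (4 * z))) ≡ 64 * (y * (z * (z * z)))
  eq₃ = solve-∀
  decompose : ∀ x → x ^ s ≡ x ^ j * (x ^ k * (x ^ k * x ^ k))
  decompose x = trans (cong (x ^_) s≡) (trans (^-distribˡ-+-* x j (k * 3)) (cong (x ^ j *_)
    (trans (cong (x ^_) (three k)) (trans (^-distribˡ-+-* x k (k + k)) (cong (x ^ k *_) (^-distribˡ-+-* x k k))))))
    where
    three : ∀ k → k * 3 ≡ k + (k + k)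
    three = solve-∀
  s< : suc s ≤ 3 * (4 + k)
  s< = begin
    suc s             ≡⟨ cong suc s≡ ⟩
    suc (j + k * 3)   ≤⟨ +-monoˡ-≤ (k * 3) (m%n<n s 3) ⟩
    3 + k * 3         ≤⟨ ≤-by 9 (e k) ⟩
    3 * (4 + k)       ∎
    where
    e : ∀ k → 3 * (4 + k) ≡ 3 + k * 3 + 9
    e = solve-∀
  C≤k : 576 * C ≤ 4 + k
  C≤k = *-cancelˡ-≤ 3 (begin
    3 * (576 * C)    ≡⟨ *-assoc 3 576 C ⟨
    1728 * C         ≤⟨ big ⟩
    s                ≤⟨ n≤1+n s ⟩
    suc s            ≤⟨ s< ⟩
    3 * (4 + k)      ∎)
  b : ∀ k → (4 + k) * 4 ^ k ≤ 4 * 5 ^ k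
  b zero    = ≤-refl
  b (suc k) = begin
    (4 + suc k) * (4 * 4 ^ k)       ≡⟨ e (4 ^ k) k ⟩
    4 * (4 ^ k * (4 + suc k * 1))   ≤⟨ *-monoʳ-≤ 4 (bernoulli 4 1 k) ⟩
    4 * 5 ^ suc k                   ∎
    where
    e : ∀ y k → (4 + suc k) * (4 * y) ≡ 4 * (y * (4 + suc k * 1))
    e = solve-∀

-- Tail bounds from the switching ratios

-- Class sizes in the abstract: `M` will be the number of all d-regular graphs and `u` is n - 2σ.
module _ (N : ℕ → ℕ) (M d σ u : ℕ) (N≤M : ∀ E → N E ≤ M)
         (sw : ∀ E → N (2 + E) * ((2 + E) * ((2 + E) + d * u ∸ 2 * (d * d))) ≤ N E * (σ * d ∸ E) ^ 2) where

  private
    n = u + 2 * σ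

    from : ℕ → ℕ → ℕ
    from b i = N (i * 2 + b)

    from-top : ∀ T {E} → 2 * T ≤ E → from (E ∸ 2 * T) T ≡ N E
    from-top T {E} h = cong N (trans (cong (_+ (E ∸ 2 * T)) (*-comm T 2)) (m+[n∸m]≡n h))

  -- In a chain of k switchings ending at E, the i-th ratio, counted from 1, is at most dσ²/(in),
  -- because the degree sum outside S stays above dn/2. The product is (dσ²/n)^k / k!, and k! ≥
  -- (k/4)^k ≥ (σ/4)^k cancels one power of σ.
  small-bound : ∀ k → 0 < d → 0 < σ → σ ≤ k → 4 * σ + 4 * d ≤ n → ∀ {E} → 2 * k ≤ E →
                N E * n ^ k ≤ M * (4 * d * σ) ^ k
  small-bound k d>0 σ>0 σ≤k n-big {E} 2k≤E = *-cancelʳ-≤′ (σ ^ k) (^-pos σ k σ>0) (begin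
    N E * n ^ k * σ ^ k                   ≤⟨ *-monoʳ-≤ (N E * n ^ k) (≤-trans (^-monoˡ-≤ k σ≤k) (factorial-lower k)) ⟩
    N E * n ^ k * (4 ^ k * k !)           ≡⟨ eq₁ (N E) (n ^ k) (4 ^ k) (k !) ⟩
    N E * (k ! * n ^ k) * 4 ^ k           ≤⟨ *-monoˡ-≤ (4 ^ k) telescoped ⟩
    M * (d * (σ * σ)) ^ k * 4 ^ k         ≡⟨ *-assoc M _ _ ⟩
    M * ((d * (σ * σ)) ^ k * 4 ^ k)       ≡⟨ cong (M *_) (^-distribʳ-* k (d * (σ * σ)) 4) ⟨
    M * (d * (σ * σ) * 4) ^ k             ≡⟨ cong (λ x → M * x ^ k) (eq₂ d σ) ⟩
    M * (4 * d * σ * σ) ^ k               ≡⟨ cong (M *_) (^-distribʳ-* k (4 * d * σ) σ) ⟩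
    M * ((4 * d * σ) ^ k * σ ^ k)         ≡⟨ *-assoc M _ _ ⟨
    M * (4 * d * σ) ^ k * σ ^ k           ∎)
    where
    open ≤-Reasoning
    eq₁ : ∀ a b c d → a * b * (c * d) ≡ a * (d * b) * c
    eq₁ = solve-∀
    eq₂ : ∀ d s → d * (s * s) * 4 ≡ 4 * d * s * s
    eq₂ = solve-∀
    b = E ∸ 2 * k
    decay : ∀ i → from b (suc i) * (suc i * n) ≤ from b i * (d * (σ * σ))
    decay i = *-cancelʳ-≤′ d d>0 (begin
      N (2 + E′) * (suc i * n) * d           ≡⟨ e₁ (N (2 + E′)) (suc i) n d ⟩
      N (2 + E′) * (suc i * (d * n))         ≤⟨ *-monoʳ-≤ (N (2 + E′)) (begin
          suc i * (d * n)       ≤⟨ *-monoʳ-≤ (suc i) dn≤2Z ⟩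
          suc i * (2 * Z)       ≡⟨ *-assoc (suc i) 2 Z ⟨
          suc i * 2 * Z         ≤⟨ *-monoˡ-≤ Z (m≤m+n (suc i * 2) b) ⟩
          (2 + E′) * Z          ∎) ⟩
      N (2 + E′) * ((2 + E′) * Z)            ≤⟨ sw E′ ⟩
      N E′ * (σ * d ∸ E′) ^ 2                ≤⟨ *-monoʳ-≤ (N E′) (^-monoˡ-≤ 2 (m∸n≤m (σ * d) E′)) ⟩
      N E′ * (σ * d) ^ 2                     ≡⟨ e₂ (N E′) σ d ⟩
      N E′ * (d * (σ * σ)) * d               ∎)
      where
      E′ = i * 2 + b
      Z  = (2 + E′) + d * u ∸ 2 * (d * d)
      e₁ : ∀ a i n d → a * (i * n) * d ≡ a * (i * (d * n))
      e₁ = solve-∀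
      e₂ : ∀ a s d → a * ((s * d) * ((s * d) * 1)) ≡ a * (d * (s * s)) * d
      e₂ = solve-∀
      dn≤2Z : d * n ≤ 2 * Z
      dn≤2Z = +-cancelʳ-≤ (2 * (2 * (d * d))) (d * n) (2 * Z) (begin
        d * n + 2 * (2 * (d * d))                 ≡⟨ e₃ d u σ ⟩
        d * u + d * (2 * σ + 4 * d)               ≤⟨ +-monoʳ-≤ (d * u) (*-monoʳ-≤ d (+-cancelʳ-≤ (2 * σ) _ _ (begin
            2 * σ + 4 * d + 2 * σ  ≡⟨ e₄ σ d ⟩
            4 * σ + 4 * d          ≤⟨ n-big ⟩
            u + 2 * σ              ∎))) ⟩
        d * u + d * u                             ≤⟨ ≤-by (2 * (2 + E′)) (e₅ (d * u) (2 + E′)) ⟩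
        2 * ((2 + E′) + d * u)                    ≤⟨ *-monoʳ-≤ 2 (m≤n+m∸n _ (2 * (d * d))) ⟩
        2 * (2 * (d * d) + Z)                     ≡⟨ trans (*-distribˡ-+ 2 (2 * (d * d)) Z) (+-comm _ (2 * Z)) ⟩
        2 * Z + 2 * (2 * (d * d))                 ∎)
        where
        e₃ : ∀ d u σ → d * (u + 2 * σ) + 2 * (2 * (d * d)) ≡ d * u + d * (2 * σ + 4 * d)
        e₃ = solve-∀
        e₄ : ∀ σ d → 2 * σ + 4 * d + 2 * σ ≡ 4 * σ + 4 * d
        e₄ = solve-∀
        e₅ : ∀ x y → 2 * (y + x) ≡ x + x + 2 * y
        e₅ = solve-∀
    telescoped : N E * (k ! * n ^ k) ≤ M * (d * (σ * σ)) ^ k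
    telescoped = begin
      N E * (k ! * n ^ k)
        ≡⟨ cong₂ _*_ (sym (from-top k 2k≤E)) (sym (trans (∏-* suc (λ _ → n) k) (cong₂ _*_ (∏-suc k) (∏-const n k)))) ⟩
      from b k * ∏ (λ i → suc i * n) k
        ≤⟨ chain (from b) _ (λ _ → d * (σ * σ)) decay k ⟩
      from b 0 * ∏ (λ _ → d * (σ * σ)) k
        ≤⟨ *-mono-≤ (N≤M b) (≤-reflexive (∏-const (d * (σ * σ)) k)) ⟩
      M * (d * (σ * σ)) ^ k ∎

  -- The chain starts slightly above 2B, about σd/2, and climbs in T steps of 2 to E ≥ (d + g)(σ -
  -- 1)/2, so T is about gσ/4. `gaussian-chain` asks for T² ≥ Bρ, which follows from g² ≥ 4d and (ρ
  -- + c)² ≥ ρ(ρ + 2c) = ρσ.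
  large-bound : (∀ E → σ * d < E → N E ≡ 0) →
    ∀ K g b ρ c → 2 * K ≡ d + g → 4 * d ≤ g * g → 4 ≤ g → 2 ≤ d → d * d + d + 2 ≤ c → σ ≡ ρ + 2 * c →
    4 * (2 + b) ≤ σ * d → σ * d ≤ 4 * (2 + b) + 3 →
    ∀ {E} → K * (σ ∸ 1) ≤ E → N E * (u + σ) ^ ρ * 5 ^ ρ ≤ M * σ ^ ρ
  large-bound top K g b ρ c 2K≡ 4d≤gg 4≤g 2≤d c-big σ≡ 4B≤ ≤4B+3 {E} E-big = begin
    N E * r ^ ρ * 5 ^ ρ          ≡⟨ cong (λ x → x * r ^ ρ * 5 ^ ρ) (from-top T 2T≤E) ⟨
    from e T * r ^ ρ * 5 ^ ρ     ≤⟨ gaussian-chain (from e) r σ b T ρ (≤-trans σ>0 (m≤n+m σ u)) (m≤n+m σ u) ρ≤T Bρ≤TT decay ⟩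
    from e 0 * σ ^ ρ             ≤⟨ *-monoˡ-≤ (σ ^ ρ) (N≤M e) ⟩
    M * σ ^ ρ                    ∎
    where
    open ≤-Reasoning
    B = 2 + b
    r = u + σ
    -- Half of the 2c taken from σ is spent here: τ = σ - c makes the chain short enough for `room`,
    -- while τ² ≥ ρσ still holds.
    τ = ρ + c
    T = suc (g * τ / 4)
    e = E ∸ 2 * T

    c>0 : 0 < c
    c>0 = ≤-trans (≤-trans (s≤s z≤n) (m≤n+m 2 (d * d + d))) c-big
    σ>0 : 0 < σ
    σ>0 = subst (0 <_) (sym σ≡) (≤-trans c>0 (≤-trans (m≤m+n c (c + 0)) (m≤n+m (2 * c) ρ)))

    4T≥ : g * τ ≤ 4 * T
    4T≥ = begin
      g * τ                            ≡⟨ m≡m%n+[m/n]*n (g * τ) 4 ⟩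
      (g * τ) % 4 + (g * τ / 4) * 4    ≤⟨ +-monoˡ-≤ ((g * τ / 4) * 4) (<⇒≤ (m%n<n (g * τ) 4)) ⟩
      T * 4                            ≡⟨ *-comm T 4 ⟩
      4 * T                            ∎

    4T≤ : 4 * T ≤ 4 + g * τ
    4T≤ = begin
      4 * T                                ≡⟨ *-comm 4 T ⟩
      4 + (g * τ / 4) * 4                  ≤⟨ +-monoʳ-≤ 4 (m≤n+m _ ((g * τ) % 4)) ⟩
      4 + ((g * τ) % 4 + (g * τ / 4) * 4)  ≡⟨ cong (4 +_) (m≡m%n+[m/n]*n (g * τ) 4) ⟨
      4 + g * τ                            ∎

    ρ≤T : ρ ≤ T
    ρ≤T = *-cancelˡ-≤ 4 (≤-trans (*-mono-≤ 4≤g (m≤m+n ρ c)) 4T≥)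

    Bρ≤TT : B * ρ ≤ T * T
    Bρ≤TT = *-cancelˡ-≤ 16 (begin
      16 * (B * ρ)                   ≡⟨ e₁ B ρ ⟩
      4 * B * (4 * ρ)                ≤⟨ *-monoˡ-≤ (4 * ρ) 4B≤ ⟩
      σ * d * (4 * ρ)                ≡⟨ cong (λ x → x * d * (4 * ρ)) σ≡ ⟩
      (ρ + 2 * c) * d * (4 * ρ)      ≤⟨ ≤-by (4 * d * (c * c)) (e₂ ρ c d) ⟩
      4 * d * (τ * τ)                ≤⟨ *-monoˡ-≤ (τ * τ) 4d≤gg ⟩
      g * g * (τ * τ)                ≡⟨ [m*n]*[o*p]≡[m*o]*[n*p] g g τ τ ⟩
      g * τ * (g * τ)                ≤⟨ *-mono-≤ 4T≥ 4T≥ ⟩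
      4 * T * (4 * T)                ≡⟨ e₃ T ⟩
      16 * (T * T)                   ∎)
      where
      e₁ : ∀ B ρ → 16 * (B * ρ) ≡ 4 * B * (4 * ρ)
      e₁ = solve-∀
      e₂ : ∀ ρ c d → 4 * d * ((ρ + c) * (ρ + c)) ≡ (ρ + 2 * c) * d * (4 * ρ) + 4 * d * (c * c)
      e₂ = solve-∀
      e₃ : ∀ T → 4 * T * (4 * T) ≡ 16 * (T * T)
      e₃ = solve-∀

    -- The start must lie 2d² above 2B: this offsets the blocked switchings and covers the remainder
    -- of σd modulo 4.
    room : 2 * B + 2 * (d * d) + 2 * T ≤ E
    room = *-cancelˡ-≤ 2 (+-cancelʳ-≤ (d + g) _ _ (begin
      2 * (2 * B + 2 * (d * d) + 2 * T) + (d + g)          ≡⟨ e₁ B d T g ⟩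
      4 * B + 4 * T + (4 * (d * d) + d + g)                ≤⟨ +-monoˡ-≤ (4 * (d * d) + d + g) (+-mono-≤ 4B≤ 4T≤) ⟩
      σ * d + (4 + g * τ) + (4 * (d * d) + d + g)          ≡⟨ e₂ (σ * d) (g * τ) d g ⟩
      σ * d + g * τ + (4 * (d * d) + d + 4 + g)            ≤⟨ +-monoʳ-≤ (σ * d + g * τ) slack ⟩
      σ * d + g * τ + g * c                                ≡⟨ e₃ (σ * d) g ρ c ⟩
      σ * d + g * (ρ + 2 * c)                              ≡⟨ cong₂ (λ x y → x + g * y) (*-comm σ d) (sym σ≡) ⟩
      d * σ + g * σ                                        ≡⟨ *-distribʳ-+ σ d g ⟨
      (d + g) * σ                                          ≡⟨ cong ((d + g) *_) (m∸n+n≡m σ>0) ⟨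
      (d + g) * (σ ∸ 1 + 1)                                ≡⟨ *-distribˡ-+ (d + g) (σ ∸ 1) 1 ⟩
      (d + g) * (σ ∸ 1) + (d + g) * 1                      ≡⟨ cong₂ _+_ (cong (_* (σ ∸ 1)) (sym 2K≡)) (*-identityʳ (d + g)) ⟩
      2 * K * (σ ∸ 1) + (d + g)                            ≡⟨ cong (_+ (d + g)) (*-assoc 2 K (σ ∸ 1)) ⟩
      2 * (K * (σ ∸ 1)) + (d + g)                          ≤⟨ +-monoˡ-≤ (d + g) (*-monoʳ-≤ 2 E-big) ⟩
      2 * E + (d + g)                                      ∎))
      where
      e₁ : ∀ B d T g → 2 * (2 * B + 2 * (d * d) + 2 * T) + (d + g) ≡ 4 * B + 4 * T + (4 * (d * d) + d + g)
      e₁ = solve-∀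
      e₂ : ∀ x y d g → x + (4 + y) + (4 * (d * d) + d + g) ≡ x + y + (4 * (d * d) + d + 4 + g)
      e₂ = solve-∀
      e₃ : ∀ x g ρ c → x + g * (ρ + c) + g * c ≡ x + g * (ρ + 2 * c)
      e₃ = solve-∀
      -- The choice c = d² + d + 2 comes from this inequality: gc has to pay for the rounding of T,
      -- for 2d², and for the -1 in σ - 1.
      slack : 4 * (d * d) + d + 4 + g ≤ g * c
      slack = begin
        4 * (d * d) + d + 4 + g          ≤⟨ ≤-by (3 * d) (e₄ d g) ⟩
        4 * (d * d + d + 1) + g          ≤⟨ +-monoˡ-≤ g (*-monoˡ-≤ (d * d + d + 1) 4≤g) ⟩
        g * (d * d + d + 1) + g          ≡⟨ e₅ g (d * d + d) ⟩
        g * (d * d + d + 2)              ≤⟨ *-monoʳ-≤ g c-big ⟩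
        g * c                            ∎
        where
        e₄ : ∀ d g → 4 * (d * d + d + 1) + g ≡ 4 * (d * d) + d + 4 + g + 3 * d
        e₄ = solve-∀
        e₅ : ∀ g x → g * (x + 1) + g ≡ g * (x + 2)
        e₅ = solve-∀

    2T≤E : 2 * T ≤ E
    2T≤E = ≤-trans (m≤n+m (2 * T) (2 * B + 2 * (d * d))) room

    e≥ : 2 * B + 2 * (d * d) ≤ e
    e≥ = m+n≤o⇒m≤o∸n (2 * B + 2 * (d * d)) room

    decay : ∀ i → from e (suc i) * (r * (B + suc i) ^ 2) ≤ from e i * (σ * (B ∸ suc i) ^ 2)
    decay i with 2 + (i * 2 + e) ≤? σ * d
    -- Classes beyond σd are empty, so the ratio has to be bounded only where x ≤ σd.
    ... | no x≰ rewrite top (2 + (i * 2 + e)) (≰⇒> x≰) = z≤n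
    ... | yes x≤ = *-cancelˡ-≤ 4 (begin
      4 * (N x * (r * (B + suc i) ^ 2))                    ≡⟨ e₁ (N x) r (B + suc i) ⟩
      N x * ((2 * (B + suc i)) * (r * (2 * (B + suc i))))  ≤⟨ *-monoʳ-≤ (N x) (*-mono-≤ (≤-trans lower (m∸n≤m x (2 * (d * d)))) (≤-trans (*-monoʳ-≤ r lower) rx≤σZ)) ⟩
      N x * (x * (σ * Z))                                  ≡⟨ e₂ (N x) x σ Z ⟩
      N x * (x * Z) * σ                                    ≤⟨ *-monoˡ-≤ σ (sw E′) ⟩
      N E′ * (σ * d ∸ E′) ^ 2 * σ                          ≤⟨ *-monoˡ-≤ σ (*-monoʳ-≤ (N E′) (^-monoˡ-≤ 2 upper)) ⟩
      N E′ * (2 * (B ∸ suc i)) ^ 2 * σ                     ≡⟨ e₃ (N E′) (B ∸ suc i) σ ⟩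
      4 * (N E′ * (σ * (B ∸ suc i) ^ 2))                   ∎)
      where
      E′ = i * 2 + e
      x  = 2 + E′
      Z  = x + d * u ∸ 2 * (d * d)
      e₁ : ∀ a r b → 4 * (a * (r * (b * (b * 1)))) ≡ a * ((2 * b) * (r * (2 * b)))
      e₁ = solve-∀
      e₂ : ∀ a x s z → a * (x * (s * z)) ≡ a * (x * z) * s
      e₂ = solve-∀
      e₃ : ∀ a b s → a * ((2 * b) * ((2 * b) * 1)) * s ≡ 4 * (a * (s * (b * (b * 1))))
      e₃ = solve-∀
      lower : 2 * (B + suc i) ≤ x ∸ 2 * (d * d)
      lower = m+n≤o⇒m≤o∸n (2 * (B + suc i)) (begin
        2 * (B + suc i) + 2 * (d * d)     ≡⟨ e₄ B i (d * d) ⟩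
        suc i * 2 + (2 * B + 2 * (d * d)) ≤⟨ +-monoʳ-≤ (suc i * 2) e≥ ⟩
        x                                 ∎)
        where
        e₄ : ∀ B i y → 2 * (B + suc i) + 2 * y ≡ suc i * 2 + (2 * B + 2 * y)
        e₄ = solve-∀
      -- From x ≤ σd follows x + du ≥ x + xu/σ = xr/σ. This is the source of the factor σ/r that
      -- competes with the number of sets.
      rx≤σZ : r * (x ∸ 2 * (d * d)) ≤ σ * Z
      rx≤σZ = begin
        r * (x ∸ 2 * (d * d))                     ≡⟨ *-distribˡ-∸ r x _ ⟩
        r * x ∸ r * (2 * (d * d))                 ≤⟨ ∸-mono (begin
             r * x                       ≡⟨ e₅ u σ x ⟩
             σ * x + u * x               ≤⟨ +-monoʳ-≤ (σ * x) (*-monoʳ-≤ u x≤) ⟩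
             σ * x + u * (σ * d)         ≡⟨ e₆ σ x u d ⟩
             σ * (x + d * u)             ∎) (*-monoˡ-≤ (2 * (d * d)) (m≤n+m σ u)) ⟩
        σ * (x + d * u) ∸ σ * (2 * (d * d))       ≡⟨ *-distribˡ-∸ σ _ _ ⟨
        σ * Z                                     ∎
        where
        e₅ : ∀ u σ x → (u + σ) * x ≡ σ * x + u * x
        e₅ = solve-∀
        e₆ : ∀ σ x u d → σ * x + u * (σ * d) ≡ σ * (x + d * u)
        e₆ = solve-∀
      -- The 2d² ≥ 8 contained in `e` absorbs the remainder 3 of σd and the shift between i and i +
      -- 1.
      upper : σ * d ∸ E′ ≤ 2 * (B ∸ suc i)
      upper = m≤n+o⇒m∸n≤o (σ * d) E′ (+-cancelʳ-≤ 5 _ _ (begin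
        σ * d + 5                                        ≤⟨ +-monoˡ-≤ 5 ≤4B+3 ⟩
        4 * B + 3 + 5                                    ≤⟨ ≤-trans (≤-reflexive (+-assoc (4 * B) 3 5)) (+-monoʳ-≤ (4 * B) (*-monoʳ-≤ 2 (*-mono-≤ 2≤d 2≤d))) ⟩
        4 * B + 2 * (d * d)                              ≡⟨ e₄ B (d * d) ⟩
        2 * B + (2 * B + 2 * (d * d))                    ≤⟨ +-mono-≤ (*-monoʳ-≤ 2 (m≤n+m∸n B (suc i))) e≥ ⟩
        2 * (suc i + (B ∸ suc i)) + e                    ≡⟨ e₅ i (B ∸ suc i) e ⟩
        E′ + 2 * (B ∸ suc i) + 2                         ≤⟨ +-monoʳ-≤ (E′ + 2 * (B ∸ suc i)) (s≤s (s≤s z≤n)) ⟩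
        E′ + 2 * (B ∸ suc i) + 5                         ∎))
        where
        e₄ : ∀ B y → 4 * B + 2 * y ≡ 2 * B + (2 * B + 2 * y)
        e₄ = solve-∀
        e₅ : ∀ i y e → 2 * (suc i + y) + e ≡ i * 2 + e + 2 * y + 2
        e₅ = solve-∀

-- Union bound over vertex sets

sets : ∀ n → List (Vec Bool n)
sets zero    = [] ∷ []
sets (suc n) = L.map (true ∷_) (sets n) ++ L.map (false ∷_) (sets n)

∈-sets : ∀ {n} (S : Vec Bool n) → S ∈ sets n
∈-sets []          = here refl
∈-sets (true ∷ S)  = ∈-++⁺ˡ (∈-map⁺ (true ∷_) (∈-sets S))
∈-sets (false ∷ S) = ∈-++⁺ʳ (L.map (true ∷_) (sets _)) (∈-map⁺ (false ∷_) (∈-sets S))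

Σl-map : ∀ {X Y : Set} (f : Y → ℕ) (g : X → Y) xs → Σl f (L.map g xs) ≡ Σl (f ∘ g) xs
Σl-map f g []       = refl
Σl-map f g (x ∷ xs) = cong (f (g x) +_) (Σl-map f g xs)

-- The binomial theorem, kept as a sum over sets instead of binomial coefficients.
sets-weight : ∀ n p q → Σl (λ S → p ^ size S * q ^ size̅ S) (sets n) ≡ (p + q) ^ n
sets-weight zero    p q = refl
sets-weight (suc n) p q = begin
  Σl w (L.map (true ∷_) (sets n) ++ L.map (false ∷_) (sets n))
    ≡⟨ trans (Σl-++ w (L.map (true ∷_) (sets n)) _) (cong₂ _+_ (Σl-map w (true ∷_) (sets n)) (Σl-map w (false ∷_) (sets n))) ⟩
  Σl (λ S → p * p ^ size S * q ^ size̅ S) (sets n) + Σl (λ S → p ^ size S * (q * q ^ size̅ S)) (sets n)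
    ≡⟨ cong₂ _+_ (Σl-cong (sets n) (λ S → e₁ p (p ^ size S) (q ^ size̅ S))) (Σl-cong (sets n) (λ S → e₂ q (p ^ size S) (q ^ size̅ S))) ⟩
  Σl (λ S → w S * p) (sets n) + Σl (λ S → w S * q) (sets n)
    ≡⟨ cong₂ _+_ (Σl-*ʳ w p (sets n)) (Σl-*ʳ w q (sets n)) ⟨
  Σl w (sets n) * p + Σl w (sets n) * q   ≡⟨ *-distribˡ-+ (Σl w (sets n)) p q ⟨
  Σl w (sets n) * (p + q)                 ≡⟨ cong (_* (p + q)) (sets-weight n p q) ⟩
  (p + q) ^ n * (p + q)                   ≡⟨ *-comm _ (p + q) ⟩
  (p + q) ^ suc n                         ∎
  where
  open ≡-Reasoning
  w : ∀ {n} → Vec Bool n → ℕ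
  w S = p ^ size S * q ^ size̅ S
  e₁ : ∀ p x y → p * x * y ≡ x * y * p
  e₁ = solve-∀
  e₂ : ∀ q x y → x * (q * y) ≡ x * y * q
  e₂ = solve-∀

ofSize : ℕ → ∀ n → ℕ
ofSize σ n = count (λ S → ⌊ size S ≟ σ ⌋) (sets n)

-- With r = n - σ, every set of size σ contributes σ^σ r^r to the expansion of (σ + r)^n, and
-- `power-ratio` bounds n^n by 4^σ r^n.
ofSize-bound : ∀ u σ → 0 < σ → ofSize σ (u + 2 * σ) * σ ^ σ ≤ 4 ^ σ * (u + σ) ^ σ
ofSize-bound u σ σ>0 = *-cancelʳ-≤′ (r ^ r) (^-pos r r r>0) (begin
  ofSize σ n * σ ^ σ * r ^ r          ≡⟨ *-assoc (ofSize σ n) _ _ ⟩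
  ofSize σ n * (σ ^ σ * r ^ r)        ≡⟨ Σl-*ʳ _ _ (sets n) ⟩
  Σl (λ S → β ⌊ size S ≟ σ ⌋ * (σ ^ σ * r ^ r)) (sets n)  ≤⟨ Σl-mono (sets n) (λ S _ → weigh S) ⟩
  Σl (λ S → σ ^ size S * r ^ size̅ S) (sets n)            ≡⟨ sets-weight n σ r ⟩
  (σ + r) ^ n                         ≡⟨ cong₂ _^_ (+-comm σ r) n≡ ⟩
  (r + σ) ^ (r + σ)                   ≤⟨ power-ratio σ u ⟩
  4 ^ σ * r ^ (r + σ)                 ≡⟨ cong (4 ^ σ *_) (trans (^-distribˡ-+-* r r σ) (*-comm (r ^ r) _)) ⟩
  4 ^ σ * (r ^ σ * r ^ r)             ≡⟨ *-assoc (4 ^ σ) _ _ ⟨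
  4 ^ σ * r ^ σ * r ^ r               ∎)
  where
  open ≤-Reasoning
  n = u + 2 * σ
  r = u + σ
  r>0 : 0 < r
  r>0 = ≤-trans σ>0 (m≤n+m σ u)
  n≡ : n ≡ r + σ
  n≡ = trans (cong (λ x → u + (σ + x)) (+-identityʳ σ)) (sym (+-assoc u σ σ))
  weigh : ∀ S → β ⌊ size S ≟ σ ⌋ * (σ ^ σ * r ^ r) ≤ σ ^ size S * r ^ size̅ S
  weigh S with size S ≟ σ
  ... | no _  = z≤n
  ... | yes p = ≤-reflexive (trans (+-identityʳ _) (cong₂ (λ x y → σ ^ x * r ^ y) (sym p)
    (sym (+-cancelˡ-≡ σ _ _ (trans (trans (cong (_+ size̅ S) (sym p)) (size+size̅ S)) (trans n≡ (+-comm r σ)))))))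

sumTo : (ℕ → ℕ) → ℕ → ℕ
sumTo f zero    = 0
sumTo f (suc k) = sumTo f k + f k

sumTo-mono : ∀ {f g : ℕ → ℕ} k → (∀ i → i < k → f i ≤ g i) → sumTo f k ≤ sumTo g k
sumTo-mono zero    h = z≤n
sumTo-mono (suc k) h = +-mono-≤ (sumTo-mono k λ i i<k → h i (m≤n⇒m≤1+n i<k)) (h k ≤-refl)

sumTo-const : ∀ c k → sumTo (λ _ → c) k ≡ k * c
sumTo-const c zero    = refl
sumTo-const c (suc k) = trans (cong (_+ c) (sumTo-const c k)) (+-comm _ c)

sumTo-*ʳ : ∀ f c k → sumTo f k * c ≡ sumTo (λ i → f i * c) k
sumTo-*ʳ f c zero    = refl
sumTo-*ʳ f c (suc k) = trans (*-distribʳ-+ c (sumTo f k) (f k)) (cong (_+ f k * c) (sumTo-*ʳ f c k))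

Σl-sumTo : ∀ {X : Set} (f : ℕ → X → ℕ) k xs → Σl (λ x → sumTo (λ i → f i x) k) xs ≡ sumTo (λ i → Σl (f i) xs) k
Σl-sumTo f zero    xs = Σl-0 xs
Σl-sumTo f (suc k) xs = trans (Σl-+ (λ x → sumTo (λ i → f i x) k) (f k) xs) (cong (_+ Σl (f k) xs) (Σl-sumTo f k xs))

term≤sumTo : ∀ f {i k} → i < k → f i ≤ sumTo f k
term≤sumTo f {i} {suc k} (s≤s i≤k) with m≤n⇒m<n∨m≡n i≤k
... | inj₁ i<k  = ≤-trans (term≤sumTo f i<k) (m≤m+n _ _)
... | inj₂ refl = m≤n+m _ _

-- Induction peels off the first row and the first column, whose sums agree.
symmetric-even : ∀ {n} (f : Fin n → Fin n → ℕ) → (∀ i j → f i j ≡ f j i) → (∀ i → f i i ≡ 0) →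
                 ∃ λ h → (∑ λ i → ∑ (f i)) ≡ 2 * h
symmetric-even {zero}  f sy dg = 0 , refl
symmetric-even {suc n} f sy dg with symmetric-even (λ i j → f (suc i) (suc j)) (λ i j → sy (suc i) (suc j)) (λ i → dg (suc i))
... | h , eq = x + h , (begin
  (f zero zero + x) + (∑ λ i → f (suc i) zero + ∑ (λ j → f (suc i) (suc j)))
    ≡⟨ cong₂ (λ a b → a + x + b) (dg zero) (∑-+ (λ i → f (suc i) zero) (λ i → ∑ (λ j → f (suc i) (suc j)))) ⟩
  x + ((∑ λ i → f (suc i) zero) + (∑ λ i → ∑ (λ j → f (suc i) (suc j))))
    ≡⟨ cong₂ (λ a b → x + (a + b)) (sum-cong-≗ (λ i → sy (suc i) zero)) eq ⟩
  x + (x + 2 * h) ≡⟨ e x h ⟩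
  2 * (x + h) ∎)
  where
  open ≡-Reasoning
  x = ∑ λ j → f zero (suc j)
  e : ∀ x h → x + (x + 2 * h) ≡ 2 * (x + h)
  e = solve-∀

inn-even : ∀ {n} {G : Graph n} → IsSimple G → ∀ S → ∃ λ h → inn S G ≡ 2 * h
inn-even {G = G} simple S = symmetric-even (λ i j → β (lookup S i) * β (lookup S j) * ad G i j)
  (λ i j → cong₂ _*_ (*-comm (β (lookup S i)) _) (ad-sym {G = G} simple i j))
  (λ i → trans (cong (β (lookup S i) * β (lookup S i) *_) (ad-diag {G = G} simple i)) (*-zeroʳ (β (lookup S i) * β (lookup S i))))

-- The factor σ - 1 in place of σ is what later leaves the surviving edges of a cut, see `half`.
-- Sets above n/2 are handled through their complements.
violates : ∀ {n} → ℕ → Vec Bool n → Graph n → Bool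
violates {n} K S G = ⌊ 2 ≤? size S ⌋ ∧ (⌊ 2 * size S ≤? n ⌋ ∧ ⌊ K * (size S ∸ 1) <? inn S G ⌋)

bad : ∀ {n} → ℕ → Graph n → Bool
bad {n} K G = any (λ S → violates K S G) (sets n)

β-any : ∀ {X : Set} (p : X → Bool) xs → β (any p xs) ≤ count p xs
β-any p []       = z≤n
β-any p (x ∷ xs) with p x
... | true  = s≤s z≤n
... | false = β-any p xs

any-false : ∀ {X : Set} (p : X → Bool) xs → any p xs ≡ false → ∀ {x} → x ∈ xs → p x ≡ false
any-false p (x ∷ xs) h (here refl) with p x
... | false = refl
any-false p (x ∷ xs) h (there y∈) with p x
... | false = any-false p xs h y∈

Σl-comm : ∀ {X Y : Set} (f : X → Y → ℕ) xs ys → Σl (λ x → Σl (f x) ys) xs ≡ Σl (λ y → Σl (λ x → f x y) xs) ys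
Σl-comm f []       ys = sym (Σl-0 ys)
Σl-comm f (x ∷ xs) ys = trans (cong (Σl (f x) ys +_) (Σl-comm f xs ys)) (sym (Σl-+ (f x) (λ y → Σl (λ x → f x y) xs) ys))

-- A geometric series and at most n terms of size M/n contribute at most M each. `partial` is the
-- bound M(1 - 2^-k) + kM/n for the first k terms, multiplied by 2^k n.
two-regimes : ∀ M n (y : ℕ → ℕ) → 0 < n → (∀ i → i < n → 2 ^ suc i * y i ≤ M ⊎ n * y i ≤ M) → sumTo y n ≤ 2 * M
two-regimes M n y n>0 h = *-cancelˡ-≤ (2 ^ n * n) {{>-nonZero (*-mono-≤ (^-pos 2 n z<s) n>0)}} (begin
  2 ^ n * n * sumTo y n               ≤⟨ m≤m+n _ (n * M) ⟩
  2 ^ n * n * sumTo y n + n * M       ≤⟨ partial n ≤-refl ⟩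
  2 ^ n * n * M + n * (2 ^ n * M)     ≡⟨ e (2 ^ n) n M ⟩
  2 ^ n * n * (2 * M)                 ∎)
  where
  open ≤-Reasoning
  e : ∀ p n M → p * n * M + n * (p * M) ≡ p * n * (2 * M)
  e = solve-∀
  partial : ∀ k → k ≤ n → 2 ^ k * n * sumTo y k + n * M ≤ 2 ^ k * n * M + k * (2 ^ k * M)
  partial zero    _   = ≤-reflexive (e₀ n M)
    where
    e₀ : ∀ n M → 1 * n * 0 + n * M ≡ 1 * n * M + 0
    e₀ = solve-∀
  partial (suc k) k<n = +-cancelʳ-≤ (n * M) _ _ (begin
    2 * p * n * (sumTo y k + y k) + n * M + n * M
      ≡⟨ e₁ p n (sumTo y k) (y k) M ⟩
    2 * (p * n * sumTo y k + n * M) + n * (2 * p * y k)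
      ≤⟨ +-mono-≤ (*-monoʳ-≤ 2 (partial k (<⇒≤ k<n))) (term (h k k<n)) ⟩
    2 * (p * n * M + k * (p * M)) + (n * M + 2 * p * M)
      ≡⟨ e₂ p n M k ⟩
    2 * p * n * M + suc k * (2 * p * M) + n * M ∎)
    where
    p = 2 ^ k
    e₁ : ∀ p n s y M → 2 * p * n * (s + y) + n * M + n * M ≡ 2 * (p * n * s + n * M) + n * (2 * p * y)
    e₁ = solve-∀
    e₂ : ∀ p n M k → 2 * (p * n * M + k * (p * M)) + (n * M + 2 * p * M) ≡ 2 * p * n * M + suc k * (2 * p * M) + n * M
    e₂ = solve-∀
    e₃ : ∀ p n y → n * (2 * p * y) ≡ 2 * p * (n * y)
    e₃ = solve-∀
    term : 2 ^ suc k * y k ≤ M ⊎ n * y k ≤ M → n * (2 * p * y k) ≤ n * M + 2 * p * M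
    term (inj₁ a) = ≤-trans (*-monoʳ-≤ n a) (m≤m+n _ _)
    term (inj₂ b) = ≤-trans (≤-reflexive (e₃ p n (y k))) (≤-trans (*-monoʳ-≤ (2 * p) b) (m≤n+m _ _))

suc≤2^ : ∀ k → suc k ≤ 2 ^ k
suc≤2^ zero    = ≤-refl
suc≤2^ (suc k) = begin
  2 + k           ≤⟨ +-mono-≤ (^-pos 2 k z<s) (suc≤2^ k) ⟩
  2 ^ k + 2 ^ k   ≡⟨ cong (2 ^ k +_) (+-identityʳ _) ⟨
  2 ^ suc k       ∎
  where open ≤-Reasoning

-- The summand 4 + 4 d serves small-bound; the k-th power of the product absorbs every constant of small-total.
threshold : ℕ → ℕ → ℕ
threshold d m = 4 + 4 * d + 128 * (m * (d * d)) * (256 * (d * d))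

-- The saving n^T with T = 2σ - 1 beats the n^σ sets by n^k, and n^k ≥ (Qσ)^k leaves Q^k against the
-- constants and σ^k against the powers of σ. The conclusion is geometric in σ, so the sizes can be
-- summed.
small-total : ∀ d m M X cnt n Q k → threshold d m ≤ Q → 0 < d → 0 < m → 0 < k → let σ = suc k ; T = k + σ in
  X * n ^ T ≤ cnt * (suc (σ * d) * (M * (4 * d * σ) ^ T)) → cnt * σ ^ σ ≤ 4 ^ σ * n ^ σ →
  Q * σ ≤ n → 2 ^ σ * (2 * m * X) ≤ M
small-total d m M X cnt n Q k Q-big d>0 m>0 k>0 hX hc Qσ≤n = *-cancelʳ-≤′ ((Q * σ) ^ k) (^-pos (Q * σ) k (*-mono-≤ Q>0 (z<s {k}))) (begin
  2 ^ σ * (2 * m * X) * (Q * σ) ^ k          ≤⟨ *-monoʳ-≤ (2 ^ σ * (2 * m * X)) (^-monoˡ-≤ k Qσ≤n) ⟩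
  2 ^ σ * (2 * m * X) * n ^ k                ≡⟨ e₁ (2 ^ σ) m X (n ^ k) ⟩
  2 ^ σ * (2 * m) * (X * n ^ k)              ≤⟨ *-monoʳ-≤ (2 ^ σ * (2 * m)) stripped ⟩
  2 ^ σ * (2 * m) * (suc (σ * d) * M * 4 ^ σ * (4 * d) ^ T * σ ^ k)
    ≡⟨ e₂ (2 ^ σ) m (suc (σ * d)) M (4 ^ σ) ((4 * d) ^ T) (σ ^ k) ⟩
  M * (2 ^ σ * (2 * m) * suc (σ * d) * 4 ^ σ * (4 * d) ^ T * σ ^ k)   ≤⟨ *-monoʳ-≤ M (*-monoˡ-≤ (σ ^ k) constants) ⟩
  M * (Q ^ k * σ ^ k)                        ≡⟨ cong (M *_) (^-distribʳ-* k Q σ) ⟨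
  M * (Q * σ) ^ k                            ∎)
  where
  open ≤-Reasoning
  q₀ = 128 * (m * (d * d))
  q₁ = 256 * (d * d)
  σ = suc k
  T = k + σ
  e₁ : ∀ p m X y → p * (2 * m * X) * y ≡ p * (2 * m) * (X * y)
  e₁ = solve-∀
  e₂ : ∀ p m s M f t y → p * (2 * m) * (s * M * f * t * y) ≡ M * (p * (2 * m) * s * f * t * y)
  e₂ = solve-∀
  Q>0 : 0 < Q
  Q>0 = ≤-trans z<s Q-big
  n>0 : 0 < n
  n>0 = ≤-trans (*-mono-≤ Q>0 (z<s {k})) Qσ≤n
  stripped : X * n ^ k ≤ suc (σ * d) * M * 4 ^ σ * (4 * d) ^ T * σ ^ k
  stripped = *-cancelʳ-≤′ (n ^ σ * σ ^ σ) (*-mono-≤ (^-pos n σ n>0) (^-pos σ σ z<s)) (begin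
    X * n ^ k * (n ^ σ * σ ^ σ)             ≡⟨ f₁ X (n ^ k) (n ^ σ) (σ ^ σ) ⟩
    X * (n ^ k * n ^ σ) * σ ^ σ             ≡⟨ cong (λ z → X * z * σ ^ σ) (^-distribˡ-+-* n k σ) ⟨
    X * n ^ T * σ ^ σ                       ≤⟨ *-monoˡ-≤ (σ ^ σ) hX ⟩
    cnt * (suc (σ * d) * (M * (4 * d * σ) ^ T)) * σ ^ σ        ≡⟨ f₂ cnt (suc (σ * d) * (M * (4 * d * σ) ^ T)) (σ ^ σ) ⟩
    cnt * σ ^ σ * (suc (σ * d) * (M * (4 * d * σ) ^ T))        ≤⟨ *-monoˡ-≤ _ hc ⟩
    4 ^ σ * n ^ σ * (suc (σ * d) * (M * (4 * d * σ) ^ T))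
      ≡⟨ cong (λ z → 4 ^ σ * n ^ σ * (suc (σ * d) * (M * z))) (trans (^-distribʳ-* T (4 * d) σ) (cong ((4 * d) ^ T *_) (^-distribˡ-+-* σ k σ))) ⟩
    4 ^ σ * n ^ σ * (suc (σ * d) * (M * ((4 * d) ^ T * (σ ^ k * σ ^ σ))))
      ≡⟨ f₃ (4 ^ σ) (n ^ σ) (suc (σ * d)) M ((4 * d) ^ T) (σ ^ k) (σ ^ σ) ⟩
    suc (σ * d) * M * 4 ^ σ * (4 * d) ^ T * σ ^ k * (n ^ σ * σ ^ σ) ∎)
    where
    f₁ : ∀ a b c d → a * b * (c * d) ≡ a * (b * c) * d
    f₁ = solve-∀
    f₂ : ∀ a b c → a * b * c ≡ a * c * b
    f₂ = solve-∀
    f₃ : ∀ f n s M t x y → f * n * (s * (M * (t * (x * y)))) ≡ s * M * f * t * x * (n * y)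
    f₃ = solve-∀
  lin : suc (σ * d) ≤ 2 * d * 2 ^ k
  lin = begin
    1 + σ * d                    ≤⟨ +-mono-≤ (*-mono-≤ (^-pos 2 k z<s) d>0) (*-monoˡ-≤ d (suc≤2^ k)) ⟩
    2 ^ k * d + 2 ^ k * d        ≡⟨ f (2 ^ k) d ⟩
    2 * d * 2 ^ k                ∎
    where
    f : ∀ p d → p * d + p * d ≡ 2 * d * p
    f = solve-∀
  q₀>0 : 0 < q₀
  q₀>0 = *-mono-≤ (z<s {127}) (*-mono-≤ m>0 (*-mono-≤ d>0 d>0))
  q₀≤ : ∀ {k} → 0 < k → q₀ ≤ q₀ ^ k
  q₀≤ {suc j} _ = ≤-trans (≤-reflexive (sym (*-identityʳ q₀))) (*-monoʳ-≤ q₀ (^-pos q₀ j q₀>0))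
  q₁≡ : q₁ ^ k ≡ 2 ^ k * (2 ^ k * (4 ^ k * ((4 * d) ^ k * (4 * d) ^ k)))
  q₁≡ = trans (cong (_^ k) (f d)) (trans (^-distribʳ-* k 2 _) (cong (2 ^ k *_) (trans (^-distribʳ-* k 2 _) (cong (2 ^ k *_)
    (trans (^-distribʳ-* k 4 _) (cong (4 ^ k *_) (^-distribʳ-* k (4 * d) (4 * d))))))))
    where
    f : ∀ d → 256 * (d * d) ≡ 2 * (2 * (4 * (4 * d * (4 * d))))
    f = solve-∀
  constants : 2 ^ σ * (2 * m) * suc (σ * d) * 4 ^ σ * (4 * d) ^ T ≤ Q ^ k
  constants = begin
    2 ^ σ * (2 * m) * suc (σ * d) * 4 ^ σ * (4 * d) ^ T
      ≤⟨ *-monoˡ-≤ ((4 * d) ^ T) (*-monoˡ-≤ (4 ^ σ) (*-monoʳ-≤ (2 ^ σ * (2 * m)) lin)) ⟩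
    2 ^ σ * (2 * m) * (2 * d * 2 ^ k) * 4 ^ σ * (4 * d) ^ T
      ≡⟨ cong (2 ^ σ * (2 * m) * (2 * d * 2 ^ k) * 4 ^ σ *_) (^-distribˡ-+-* (4 * d) k σ) ⟩
    2 ^ σ * (2 * m) * (2 * d * 2 ^ k) * 4 ^ σ * ((4 * d) ^ k * (4 * d * (4 * d) ^ k))
      ≡⟨ f (2 ^ k) m d (4 ^ k) ((4 * d) ^ k) ⟩
    q₀ * (2 ^ k * (2 ^ k * (4 ^ k * ((4 * d) ^ k * (4 * d) ^ k))))
      ≡⟨ cong (q₀ *_) q₁≡ ⟨
    q₀ * q₁ ^ k        ≤⟨ *-monoˡ-≤ (q₁ ^ k) (q₀≤ k>0) ⟩
    q₀ ^ k * q₁ ^ k    ≡⟨ ^-distribʳ-* k q₀ q₁ ⟨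
    (q₀ * q₁) ^ k      ≤⟨ ^-monoˡ-≤ k (≤-trans (m≤n+m (q₀ * q₁) (4 + 4 * d)) Q-big) ⟩
    Q ^ k              ∎
    where
    f : ∀ p m d f t → 2 * p * (2 * m) * (2 * d * p) * (4 * f) * (t * (4 * d * t)) ≡ 128 * (m * (d * d)) * (p * (p * (f * (t * t))))
    f = solve-∀

-- What the union bound leaves besides (4/5)^σ and a quadratic factor in σ: (5Q)^(2c) for the
-- shortened exponent, Q for n ≤ Qσ, d + 1 for the number of classes, 2m for the target.
large-constant : ℕ → ℕ → ℕ → ℕ → ℕ
large-constant d m Q c = 2 * m * Q * suc d * Q ^ (2 * c) * 5 ^ (2 * c)

-- At most (4r/σ)^σ sets, each with share (σ/(5r))^ρ, leave (4/5)^σ (5r/σ)^(2c), and r ≤ n ≤ Qσ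
-- bounds the last factor.
large-total : ∀ d m M X cnt Q u ρ c σ → σ ≡ ρ + 2 * c → 0 < σ → 0 < m →
  let n = u + 2 * σ ; r = u + σ in
  X * (r ^ ρ * 5 ^ ρ) ≤ cnt * (suc (σ * d) * (M * σ ^ ρ)) → cnt * σ ^ σ ≤ 4 ^ σ * r ^ σ →
  n ≤ Q * σ → 1728 * large-constant d m Q c ≤ σ → n * (2 * m * X) ≤ M
large-total d m M X cnt Q u ρ c σ σ≡ σ>0 m>0 hX hc n≤Qσ big = *-cancelʳ-≤′ (5 ^ σ) (^-pos 5 σ z<s) (begin
  n * (2 * m * X) * 5 ^ σ                     ≡⟨ cong (n * (2 * m * X) *_) (split 5) ⟩
  n * (2 * m * X) * (5 ^ ρ * 5 ^ (2 * c))     ≡⟨ e₁ n m X (5 ^ ρ) (5 ^ (2 * c)) ⟩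
  n * (2 * m * 5 ^ (2 * c)) * (X * 5 ^ ρ)     ≤⟨ *-mono-≤ (*-monoˡ-≤ (2 * m * 5 ^ (2 * c)) n≤Qσ) stripped ⟩
  Q * σ * (2 * m * 5 ^ (2 * c)) * (suc (σ * d) * M * 4 ^ σ * Q ^ (2 * c))
    ≡⟨ e₂ Q σ m (5 ^ (2 * c)) (suc (σ * d)) M (4 ^ σ) (Q ^ (2 * c)) ⟩
  2 * m * Q * (σ * suc (σ * d)) * Q ^ (2 * c) * 5 ^ (2 * c) * 4 ^ σ * M
    ≤⟨ *-monoˡ-≤ M (*-monoˡ-≤ (4 ^ σ) (*-monoˡ-≤ (5 ^ (2 * c)) (*-monoˡ-≤ (Q ^ (2 * c)) (*-monoʳ-≤ (2 * m * Q) lin)))) ⟩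
  2 * m * Q * (suc d * (suc σ * suc σ)) * Q ^ (2 * c) * 5 ^ (2 * c) * 4 ^ σ * M
    ≡⟨ e₃ (2 * m * Q) (suc d) (suc σ * suc σ) (Q ^ (2 * c)) (5 ^ (2 * c)) (4 ^ σ) M ⟩
  M * (large-constant d m Q c * (suc σ * suc σ) * 4 ^ σ)  ≤⟨ *-monoʳ-≤ M (exponential-wins (large-constant d m Q c) σ big) ⟩
  M * 5 ^ σ ∎)
  where
  open ≤-Reasoning
  n = u + 2 * σ
  r = u + σ
  r>0 : 0 < r
  r>0 = ≤-trans σ>0 (m≤n+m σ u)
  split : ∀ x → x ^ σ ≡ x ^ ρ * x ^ (2 * c)
  split x = trans (cong (x ^_) σ≡) (^-distribˡ-+-* x ρ (2 * c))
  e₁ : ∀ n m X a b → n * (2 * m * X) * (a * b) ≡ n * (2 * m * b) * (X * a)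
  e₁ = solve-∀
  e₂ : ∀ Q s m a t M f q → Q * s * (2 * m * a) * (t * M * f * q) ≡ 2 * m * Q * (s * t) * q * a * f * M
  e₂ = solve-∀
  e₃ : ∀ x d s q a f M → x * (d * s) * q * a * f * M ≡ M * (x * d * q * a * s * f)
  e₃ = solve-∀
  lin : σ * suc (σ * d) ≤ suc d * (suc σ * suc σ)
  lin = ≤-by (1 + σ + σ * σ + d + 2 * d * σ) (f σ d)
    where
    f : ∀ s d → suc d * (suc s * suc s) ≡ s * suc (s * d) + (1 + s + s * s + d + 2 * d * s)
    f = solve-∀
  stripped : X * 5 ^ ρ ≤ suc (σ * d) * M * 4 ^ σ * Q ^ (2 * c)
  stripped = *-cancelʳ-≤′ (r ^ ρ * σ ^ σ) (*-mono-≤ (^-pos r ρ r>0) (^-pos σ σ σ>0)) (begin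
    X * 5 ^ ρ * (r ^ ρ * σ ^ σ)                      ≡⟨ f₁ X (5 ^ ρ) (r ^ ρ) (σ ^ σ) ⟩
    X * (r ^ ρ * 5 ^ ρ) * σ ^ σ                      ≤⟨ *-monoˡ-≤ (σ ^ σ) hX ⟩
    cnt * (suc (σ * d) * (M * σ ^ ρ)) * σ ^ σ        ≡⟨ f₂ cnt (suc (σ * d) * (M * σ ^ ρ)) (σ ^ σ) ⟩
    cnt * σ ^ σ * (suc (σ * d) * (M * σ ^ ρ))        ≤⟨ *-monoˡ-≤ _ hc ⟩
    4 ^ σ * r ^ σ * (suc (σ * d) * (M * σ ^ ρ))      ≡⟨ cong (λ x → 4 ^ σ * x * (suc (σ * d) * (M * σ ^ ρ))) (split r) ⟩
    4 ^ σ * (r ^ ρ * r ^ (2 * c)) * (suc (σ * d) * (M * σ ^ ρ))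
      ≤⟨ *-monoˡ-≤ _ (*-monoʳ-≤ (4 ^ σ) (*-monoʳ-≤ (r ^ ρ) (^-monoˡ-≤ (2 * c) (≤-trans (+-monoʳ-≤ u (m≤m+n σ _)) n≤Qσ)))) ⟩
    4 ^ σ * (r ^ ρ * (Q * σ) ^ (2 * c)) * (suc (σ * d) * (M * σ ^ ρ))
      ≡⟨ cong (λ x → 4 ^ σ * (r ^ ρ * x) * (suc (σ * d) * (M * σ ^ ρ))) (^-distribʳ-* (2 * c) Q σ) ⟩
    4 ^ σ * (r ^ ρ * (Q ^ (2 * c) * σ ^ (2 * c))) * (suc (σ * d) * (M * σ ^ ρ))
      ≡⟨ f₃ (4 ^ σ) (r ^ ρ) (Q ^ (2 * c)) (σ ^ (2 * c)) (suc (σ * d)) M (σ ^ ρ) ⟩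
    suc (σ * d) * M * 4 ^ σ * Q ^ (2 * c) * (r ^ ρ * (σ ^ ρ * σ ^ (2 * c)))
      ≡⟨ cong (λ x → suc (σ * d) * M * 4 ^ σ * Q ^ (2 * c) * (r ^ ρ * x)) (split σ) ⟨
    suc (σ * d) * M * 4 ^ σ * Q ^ (2 * c) * (r ^ ρ * σ ^ σ) ∎)
    where
    f₁ : ∀ a b c d → a * b * (c * d) ≡ a * (c * b) * d
    f₁ = solve-∀
    f₂ : ∀ a b c → a * b * c ≡ a * c * b
    f₂ = solve-∀
    f₃ : ∀ f r q y t M z → f * (r * (q * y)) * (t * (M * z)) ≡ t * M * f * q * (r * (z * y))
    f₃ = solve-∀

-- Few regular graphs contain a dense set

module FewBad {d} (2≤d : 2 ≤ d) (K g m : ℕ) (2K≡ : 2 * K ≡ d + g) (4d≤gg : 4 * d ≤ g * g) (4≤g : 4 ≤ g) (4≤K : 4 ≤ K)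
              (m>0 : 0 < m) (Q L₀ : ℕ) (Q-big : threshold d m ≤ Q)
              (L₀-big : 1728 * large-constant d m Q (d * d + d + 2) + (2 * (d * d + d + 2) + 8) ≤ L₀) where

  private
    c = d * d + d + 2

    d>0 : 0 < d
    d>0 = ≤-trans (s≤s z≤n) 2≤d

  module _ {n} (n-big : Q * suc L₀ ≤ n) (Lall : List (Graph n)) (uniq : Unique Lall) (allReg : All (Regular d) Lall)
           (complete : ∀ G → Regular d G → G ∈ Lall) where

    private
      M = length Lall

      W : Vec Bool n → ℕ
      W S = count (violates K S) Lall

      X : ℕ → ℕ
      X σ = Σl (λ S → β ⌊ size S ≟ σ ⌋ * W S) (sets n)

      open module Sw (S : Vec Bool n) = Switching Lall uniq allReg complete S using (N; switching)

      N≤M : ∀ S E → N S E ≤ M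
      N≤M S E = count≤length _ Lall

      none : ∀ {p : Graph n → Bool} → (∀ G → G ∈ Lall → p G ≡ false) → count p Lall ≡ 0
      none h = n≤0⇒n≡0 (≤-trans (Σl-mono Lall λ G G∈ → ≤-reflexive (cong β (h G G∈))) (≤-reflexive (Σl-0 Lall)))

      inn≤ : ∀ S G → G ∈ Lall → inn S G ≤ size S * d
      inn≤ S G G∈ = ≤-trans (m≤m+n (inn S G) (cut S G)) (≤-reflexive (inn+cut {G = G} (All.lookup allReg G∈) S))

      N-top : ∀ S E → size S * d < E → N S E ≡ 0
      N-top S E h = none λ G G∈ → ⌊⌋-false (inn S G ≟ E) λ eq → <⇒≱ h (subst (_≤ size S * d) eq (inn≤ S G G∈))

      N-odd : ∀ S h → N S (1 + 2 * h) ≡ 0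
      N-odd S h = none λ G G∈ → odd G G∈
        where
        odd : ∀ G → G ∈ Lall → ⌊ inn S G ≟ 1 + 2 * h ⌋ ≡ false
        odd G G∈ with inn S G ≟ 1 + 2 * h
        ... | no _  = refl
        ... | yes p with inn-even {G = G} (proj₁ (All.lookup allReg G∈)) S
        ...   | h′ , eq = contradiction (trans (sym eq) p) (even≢odd h′ h)

      -- The internal degree sum takes one of the σd + 1 values up to σd, so a bound for single
      -- classes costs only this factor.
      W-classes : ∀ S A Bd → (∀ E → K * (size S ∸ 1) < E → N S E * A ≤ Bd) → W S * A ≤ suc (size S * d) * Bd
      W-classes S A Bd h = begin
        W S * A
          ≤⟨ *-monoˡ-≤ A (Σl-mono Lall classify) ⟩
        Σl (λ G → sumTo (λ E → f E G) (suc (size S * d))) Lall * A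
          ≡⟨ cong (_* A) (Σl-sumTo f (suc (size S * d)) Lall) ⟩
        sumTo (λ E → Σl (f E) Lall) (suc (size S * d)) * A
          ≡⟨ sumTo-*ʳ _ A (suc (size S * d)) ⟩
        sumTo (λ E → Σl (f E) Lall * A) (suc (size S * d))
          ≤⟨ sumTo-mono (suc (size S * d)) (λ E _ → bound E) ⟩
        sumTo (λ _ → Bd) (suc (size S * d))
          ≡⟨ sumTo-const Bd (suc (size S * d)) ⟩
        suc (size S * d) * Bd ∎
        where
        open ≤-Reasoning
        low = K * (size S ∸ 1)
        f : ℕ → Graph n → ℕ
        f E G = β ⌊ inn S G ≟ E ⌋ * β ⌊ low <? E ⌋
        classify : ∀ G → G ∈ Lall → β (violates K S G) ≤ sumTo (λ E → f E G) (suc (size S * d))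
        classify G G∈ = ≤-trans at (term≤sumTo (λ E → f E G) (s≤s (inn≤ S G G∈)))
          where
          at : β (violates K S G) ≤ f (inn S G) G
          at = ≤-trans (≤-reflexive (trans (β-∧ ⌊ 2 ≤? size S ⌋ _) (cong (β ⌊ 2 ≤? size S ⌋ *_) (β-∧ ⌊ 2 * size S ≤? n ⌋ _))))
            (≤-trans (*-mono-≤ (β≤1 ⌊ 2 ≤? size S ⌋) (*-monoˡ-≤ (β ⌊ low <? inn S G ⌋) (β≤1 ⌊ 2 * size S ≤? n ⌋)))
            (≤-reflexive (trans (+-identityʳ _) (cong (_* β ⌊ low <? inn S G ⌋) (sym (cong β (⌊⌋-true (inn S G ≟ inn S G) refl)))))))
        bound : ∀ E → Σl (f E) Lall * A ≤ Bd
        bound E = ≤-trans (≤-reflexive (cong (_* A) (sym (Σl-*ʳ _ (β ⌊ low <? E ⌋) Lall)))) (last (low <? E))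
          where
          last : (D : Dec (low < E)) → N S E * β ⌊ D ⌋ * A ≤ Bd
          last (yes p) = ≤-trans (≤-reflexive (cong (_* A) (*-identityʳ (N S E)))) (h E p)
          last (no _)  = ≤-trans (≤-reflexive (cong (_* A) (*-zeroʳ (N S E)))) z≤n

      X-bound : ∀ σ A Bd → (∀ S → size S ≡ σ → W S * A ≤ Bd) → X σ * A ≤ ofSize σ n * Bd
      X-bound σ A Bd h = begin
        X σ * A                                           ≡⟨ Σl-*ʳ _ A (sets n) ⟩
        Σl (λ S → β ⌊ size S ≟ σ ⌋ * W S * A) (sets n)    ≤⟨ Σl-mono (sets n) (λ S _ → each S (size S ≟ σ)) ⟩
        Σl (λ S → β ⌊ size S ≟ σ ⌋ * Bd) (sets n)         ≡⟨ Σl-*ʳ _ Bd (sets n) ⟨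
        ofSize σ n * Bd                                   ∎
        where
        open ≤-Reasoning
        each : ∀ S (D : Dec (size S ≡ σ)) → β ⌊ D ⌋ * W S * A ≤ β ⌊ D ⌋ * Bd
        each S (no _)  = z≤n
        each S (yes p) = ≤-trans (≤-reflexive (cong (_* A) (+-identityʳ (W S)))) (≤-trans (h S p) (≤-reflexive (sym (+-identityʳ Bd))))

      X-zero : ∀ σ → (∀ S G → size S ≡ σ → violates K S G ≡ false) → X σ ≡ 0
      X-zero σ h = n≤0⇒n≡0 (≤-trans (≤-reflexive (sym (*-identityʳ (X σ)))) (≤-trans
        (X-bound σ 1 0 (λ S p → ≤-reflexive (trans (*-identityʳ (W S)) (none λ G _ → h S G p)))) (≤-reflexive (*-zeroʳ (ofSize σ n)))))

      X-unbalanced : ∀ σ → ¬ (2 * σ ≤ n) → X σ ≡ 0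
      X-unbalanced σ h = X-zero σ λ S G p → trans
        (cong (λ b → ⌊ 2 ≤? size S ⌋ ∧ (b ∧ ⌊ K * (size S ∸ 1) <? inn S G ⌋))
          (⌊⌋-false (2 * size S ≤? n) (h ∘ subst (λ x → 2 * x ≤ n) p)))
        (∧-zeroʳ ⌊ 2 ≤? size S ⌋)

      X-tiny : ∀ σ → ¬ (2 ≤ σ) → X σ ≡ 0
      X-tiny σ h = X-zero σ λ S G p →
        cong (_∧ (⌊ 2 * size S ≤? n ⌋ ∧ ⌊ K * (size S ∸ 1) <? inn S G ⌋)) (⌊⌋-false (2 ≤? size S) (h ∘ subst (2 ≤_) p))

      n≡ : ∀ σ → 2 * σ ≤ n → (n ∸ 2 * σ) + 2 * σ ≡ n
      n≡ σ h = m∸n+n≡m h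

      sets-bound : ∀ σ → 0 < σ → 2 * σ ≤ n → ofSize σ n * σ ^ σ ≤ 4 ^ σ * ((n ∸ 2 * σ) + σ) ^ σ
      sets-bound σ σ>0 h = subst (λ x → ofSize σ x * σ ^ σ ≤ 4 ^ σ * ((n ∸ 2 * σ) + σ) ^ σ) (n≡ σ h) (ofSize-bound (n ∸ 2 * σ) σ σ>0)

      small : ∀ k → 0 < k → 2 * suc k ≤ n → Q * suc k ≤ n → 2 ^ suc k * (2 * m * X (suc k)) ≤ M
      small k k>0 2σ≤n Qσ≤n = small-total d m M (X σ) (ofSize σ n) n Q k Q-big d>0 m>0 k>0
        (X-bound σ (n ^ T) (suc (σ * d) * (M * (4 * d * σ) ^ T)) per-set)
        (≤-trans (sets-bound σ z<s 2σ≤n) (*-monoʳ-≤ (4 ^ σ) (^-monoˡ-≤ σ r≤n))) Qσ≤n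
        where
        open ≤-Reasoning
        σ = suc k
        T = k + σ
        u = n ∸ 2 * σ
        r≤n : u + σ ≤ n
        r≤n = ≤-trans (+-monoʳ-≤ u (m≤m+n σ _)) (≤-reflexive (n≡ σ 2σ≤n))
        n-large : 4 * σ + 4 * d ≤ u + 2 * σ
        n-large = begin
          4 * σ + 4 * d            ≤⟨ +-monoʳ-≤ (4 * σ) (m≤m*n (4 * d) σ) ⟩
          4 * σ + 4 * d * σ        ≡⟨ *-distribʳ-+ σ 4 (4 * d) ⟨
          (4 + 4 * d) * σ          ≤⟨ *-monoˡ-≤ σ (≤-trans (m≤m+n (4 + 4 * d) _) Q-big) ⟩
          Q * σ                    ≤⟨ Qσ≤n ⟩
          n                        ≡⟨ n≡ σ 2σ≤n ⟨
          u + 2 * σ                ∎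
        4k+1 : ∀ k → 4 * k + 1 ≡ 1 + 2 * (2 * k)
        4k+1 = solve-∀
        2T : ∀ k → 2 * (k + suc k) ≡ suc (4 * k + 1)
        2T = solve-∀
        per-set : ∀ S → size S ≡ σ → W S * n ^ T ≤ suc (σ * d) * (M * (4 * d * σ) ^ T)
        per-set S p = subst (λ x → W S * n ^ T ≤ suc (x * d) * (M * (4 * d * σ) ^ T)) p (W-classes S (n ^ T) _ each)
          where
          each : ∀ E → K * (size S ∸ 1) < E → N S E * n ^ T ≤ M * (4 * d * σ) ^ T
          each E h with m≤n⇒m<n∨m≡n 4k+1≤E
            where
            4k+1≤E : 4 * k + 1 ≤ E
            4k+1≤E = ≤-trans (≤-reflexive (+-comm (4 * k) 1)) (≤-trans (s≤s (*-monoˡ-≤ k 4≤K)) (subst (λ x → K * (x ∸ 1) < E) p h))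
          -- Internal degree sums are even, so E = 4k + 1 is void and E ≥ 4k + 2 = 2T. The exponent
          -- 2σ - 2 in place of T would leave no power of n to spare at σ = 2.
          ... | inj₂ refl = ≤-trans (≤-reflexive (cong (_* n ^ T) (trans (cong (N S) (4k+1 k)) (N-odd S (2 * k))))) z≤n
          ... | inj₁ 4k+1<E = subst (λ x → N S E * x ^ T ≤ M * (4 * d * σ) ^ T) (n≡ σ 2σ≤n)
            (small-bound (N S) M d σ u (N≤M S)
              (λ E → subst (λ x → N S (2 + E) * ((2 + E) * ((2 + E) + d * (n ∸ 2 * x) ∸ 2 * (d * d))) ≤ N S E * (x * d ∸ E) ^ 2) p
                (switching S E (subst (λ x → 2 * x ≤ n) (sym p) 2σ≤n)))
              T d>0 z<s (m≤n+m σ k) n-large (≤-trans (≤-reflexive (2T k)) 4k+1<E))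

      large : ∀ σ → 0 < σ → 2 * σ ≤ n → n < Q * σ → n * (2 * m * X σ) ≤ M
      large σ σ>0 2σ≤n n<Qσ = subst (λ x → x * (2 * m * X σ) ≤ M) (n≡ σ 2σ≤n)
        (large-total d m M (X σ) (ofSize σ n) Q u ρ c σ σ≡ σ>0 m>0
          (X-bound σ (r ^ ρ * 5 ^ ρ) (suc (σ * d) * (M * σ ^ ρ)) per-set)
          (sets-bound σ σ>0 2σ≤n) (<⇒≤ (subst (_< Q * σ) (sym (n≡ σ 2σ≤n)) n<Qσ)) (≤-trans (m≤m+n _ (2 * c + 8)) (≤-trans L₀-big L₀≤σ)))
        where
        open ≤-Reasoning
        u = n ∸ 2 * σ
        r = u + σ
        ρ = σ ∸ 2 * c
        -- In this regime n < Qσ, so the lower bound on n turns into one on σ.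
        L₀≤σ : L₀ ≤ σ
        L₀≤σ = <⇒≤ (*-cancelˡ-< Q L₀ σ (≤-<-trans (*-monoʳ-≤ Q (n≤1+n L₀)) (≤-<-trans n-big n<Qσ)))
        2c+8≤σ : 2 * c + 8 ≤ σ
        2c+8≤σ = ≤-trans (m≤n+m (2 * c + 8) (1728 * large-constant d m Q c)) (≤-trans L₀-big L₀≤σ)
        σ≡ : σ ≡ ρ + 2 * c
        σ≡ = sym (m∸n+n≡m (≤-trans (m≤m+n (2 * c) 8) 2c+8≤σ))
        B = σ * d / 4
        σd≡ : σ * d ≡ (σ * d) % 4 + 4 * B
        σd≡ = trans (m≡m%n+[m/n]*n (σ * d) 4) (cong ((σ * d) % 4 +_) (*-comm B 4))
        2≤B : 2 ≤ B
        2≤B = *-cancelˡ-≤ 4 (+-cancelˡ-≤ 3 8 (4 * B) (begin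
          3 + 8                      ≤⟨ m≤m+n 11 5 ⟩
          8 * 2                      ≤⟨ *-mono-≤ (≤-trans (m≤n+m 8 (2 * c)) 2c+8≤σ) 2≤d ⟩
          σ * d                      ≡⟨ σd≡ ⟩
          (σ * d) % 4 + 4 * B        ≤⟨ +-monoˡ-≤ (4 * B) (s≤s⁻¹ (m%n<n (σ * d) 4)) ⟩
          3 + 4 * B                  ∎))
        B≡ : 2 + (B ∸ 2) ≡ B
        B≡ = m+[n∸m]≡n 2≤B
        per-set : ∀ S → size S ≡ σ → W S * (r ^ ρ * 5 ^ ρ) ≤ suc (σ * d) * (M * σ ^ ρ)
        per-set S p = subst (λ x → W S * (r ^ ρ * 5 ^ ρ) ≤ suc (x * d) * (M * σ ^ ρ)) p (W-classes S (r ^ ρ * 5 ^ ρ) _ each)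
          where
          each : ∀ E → K * (size S ∸ 1) < E → N S E * (r ^ ρ * 5 ^ ρ) ≤ M * σ ^ ρ
          each E h = ≤-trans (≤-reflexive (sym (*-assoc (N S E) (r ^ ρ) (5 ^ ρ))))
            (large-bound (N S) M d σ u (N≤M S)
              (λ E → subst (λ x → N S (2 + E) * ((2 + E) * ((2 + E) + d * (n ∸ 2 * x) ∸ 2 * (d * d))) ≤ N S E * (x * d ∸ E) ^ 2) p
                (switching S E (subst (λ x → 2 * x ≤ n) (sym p) 2σ≤n)))
              (λ E h → N-top S E (subst (λ x → x * d < E) (sym p) h))
              K g (B ∸ 2) ρ c 2K≡ 4d≤gg 4≤g 2≤d ≤-refl σ≡
              (≤-trans (≤-reflexive (cong (4 *_) B≡)) (≤-trans (m≤n+m (4 * B) ((σ * d) % 4)) (≤-reflexive (sym σd≡))))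
              (≤-trans (≤-reflexive σd≡) (≤-trans (+-monoˡ-≤ (4 * B) (s≤s⁻¹ (m%n<n (σ * d) 4)))
                (≤-reflexive (trans (+-comm 3 (4 * B)) (cong (λ x → 4 * x + 3) (sym B≡))))))
              (<⇒≤ (subst (λ x → K * (x ∸ 1) < E) p h)))

      vanishing : ∀ {x} → x ≡ 0 → n * (2 * m * x) ≤ M
      vanishing refl = ≤-trans (≤-reflexive (trans (cong (n *_) (*-zeroʳ (2 * m))) (*-zeroʳ n))) z≤n

      term : ∀ i → 2 ^ suc i * (2 * m * X (suc i)) ≤ M ⊎ n * (2 * m * X (suc i)) ≤ M
      term i = go i (2 * suc i ≤? n) (Q * suc i ≤? n)
        where
        go : ∀ i → Dec (2 * suc i ≤ n) → Dec (Q * suc i ≤ n) → 2 ^ suc i * (2 * m * X (suc i)) ≤ M ⊎ n * (2 * m * X (suc i)) ≤ M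
        go i       (no h)     _          = inj₂ (vanishing {X (suc i)} (X-unbalanced (suc i) h))
        go i       (yes 2σ≤n) (no h)     = inj₂ (large (suc i) z<s 2σ≤n (≰⇒> h))
        go zero    (yes _)    (yes _)    = inj₂ (vanishing {X 1} (X-tiny 1 λ { (s≤s ()) }))
        go (suc i) (yes 2σ≤n) (yes Qσ≤n) = inj₁ (small (suc i) z<s 2σ≤n Qσ≤n)

      size≤n : ∀ S → size S ≤ n
      size≤n S = ≤-trans (m≤m+n (size S) (size̅ S)) (≤-reflexive (size+size̅ {n} S))

      by-size : ∀ S → W S ≤ sumTo (λ i → β ⌊ size S ≟ suc i ⌋ * W S) n
      by-size S = go (size S) refl
        where
        go : ∀ σ → size S ≡ σ → W S ≤ sumTo (λ i → β ⌊ size S ≟ suc i ⌋ * W S) n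
        go zero    p = ≤-trans (≤-reflexive (none λ G _ → cong (_∧ (⌊ 2 * size S ≤? n ⌋ ∧ ⌊ K * (size S ∸ 1) <? inn S G ⌋))
                         (cong (λ x → ⌊ 2 ≤? x ⌋) p))) z≤n
        go (suc i) p = ≤-trans (≤-reflexive (sym (trans (cong (λ b → β b * W S) (⌊⌋-true (size S ≟ suc i) p)) (+-identityʳ (W S)))))
          (term≤sumTo (λ i → β ⌊ size S ≟ suc i ⌋ * W S) (subst (_≤ n) p (size≤n S)))

    -- A bad graph is counted at least once among the pairs of a graph and a violating set; these
    -- are grouped by the size of the set. The target 2m matches the 2M of `two-regimes`.
    few-bad : m * count (bad K) Lall ≤ length Lall
    few-bad = *-cancelˡ-≤ 2 (begin
      2 * (m * count (bad K) Lall)            ≡⟨ *-assoc 2 m _ ⟨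
      2 * m * count (bad K) Lall              ≤⟨ *-monoʳ-≤ (2 * m) total ⟩
      2 * m * sumTo (λ i → X (suc i)) n       ≡⟨ trans (*-comm (2 * m) _) (sumTo-*ʳ (λ i → X (suc i)) (2 * m) n) ⟩
      sumTo (λ i → X (suc i) * (2 * m)) n     ≤⟨ sumTo-mono n (λ i _ → ≤-reflexive (*-comm (X (suc i)) (2 * m))) ⟩
      sumTo (λ i → 2 * m * X (suc i)) n       ≤⟨ two-regimes M n _ (≤-trans (*-mono-≤ (≤-trans z<s Q-big) (z<s {L₀})) n-big) (λ i _ → term i) ⟩
      2 * M                                   ∎)
      where
      open ≤-Reasoning
      total : count (bad K) Lall ≤ sumTo (λ i → X (suc i)) n
      total = begin
        count (bad K) Lall
          ≤⟨ Σl-mono Lall (λ G _ → β-any (λ S → violates K S G) (sets n)) ⟩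
        Σl (λ G → Σl (λ S → β (violates K S G)) (sets n)) Lall
          ≡⟨ Σl-comm (λ G S → β (violates K S G)) Lall (sets n) ⟩
        Σl W (sets n)
          ≤⟨ Σl-mono (sets n) (λ S _ → by-size S) ⟩
        Σl (λ S → sumTo (λ i → β ⌊ size S ≟ suc i ⌋ * W S) n) (sets n)
          ≡⟨ Σl-sumTo (λ i S → β ⌊ size S ≟ suc i ⌋ * W S) n (sets n) ⟩
        sumTo (λ i → X (suc i)) n ∎

-- Cuts and edge connectivity

Nontrivial : ∀ {n} → Vec Bool n → Set
Nontrivial S = ∃ (λ i → lookup S i ≡ true) × ∃ (λ j → lookup S j ≡ false)

boundary : ∀ {n} → Vec Bool n → Graph n → Graph n
boundary S G = graph λ i j → lookup (lookup G i) j ∧ (lookup S i xor lookup S j)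

lookup-boundary : ∀ {n} (S : Vec Bool n) G i j →
  lookup (lookup (boundary S G) i) j ≡ lookup (lookup G i) j ∧ (lookup S i xor lookup S j)
lookup-boundary S G = lookup-graph λ i j → lookup (lookup G i) j ∧ (lookup S i xor lookup S j)

boundary-⊆ : ∀ {n} (S : Vec Bool n) {G} → IsSimple G → boundary S G ⊆G G
boundary-⊆ S {G} (dg , sy) =
  ((λ i → trans (lookup-boundary S G i i) (cong (_∧ (lookup S i xor lookup S i)) (dg i))) ,
   (λ i j → trans (lookup-boundary S G i j) (trans (cong₂ _∧_ (sy i j) (xor-comm (lookup S i) (lookup S j))) (sym (lookup-boundary S G j i))))) ,
  λ i j h → proj₁ (∧-true (trans (sym (lookup-boundary S G i j)) h))

ad-boundary : ∀ {n} (S : Vec Bool n) G i j → ad (boundary S G) i j ≡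
  β (lookup S i) * β (not (lookup S j)) * ad G i j + β (not (lookup S i)) * β (lookup S j) * ad G i j
ad-boundary S G i j = trans (cong β (lookup-boundary S G i j)) (bits (lookup (lookup G i) j) (lookup S i) (lookup S j))
  where
  bits : ∀ g x y → β (g ∧ (x xor y)) ≡ β x * β (not y) * β g + β (not x) * β y * β g
  bits false false false = refl
  bits false false true  = refl
  bits false true  false = refl
  bits false true  true  = refl
  bits true  false false = refl
  bits true  false true  = refl
  bits true  true  false = refl
  bits true  true  true  = refl

degSum-boundary : ∀ {n} (S : Vec Bool n) {G} → IsSimple G → degSum (boundary S G) ≡ 2 * cut S G
degSum-boundary S {G} simple = begin
  degSum (boundary S G)
    ≡⟨ trans (degSum-∑ (boundary S G)) (sum-cong-≗ λ i → sum-cong-≗ λ j → ad-boundary S G i j) ⟩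
  (∑ λ i → ∑ λ j → β (lookup S i) * β (not (lookup S j)) * ad G i j + β (not (lookup S i)) * β (lookup S j) * ad G i j)
    ≡⟨ ∑∑-+ (λ i j → β (lookup S i) * β (not (lookup S j)) * ad G i j) (λ i j → β (not (lookup S i)) * β (lookup S j) * ad G i j) ⟩
  cut S G + (∑ λ i → ∑ λ j → β (not (lookup S i)) * β (lookup S j) * ad G i j)
    ≡⟨ cong (cut S G +_) (trans (cut-sym {G = G} simple S) (sym (+-identityʳ _))) ⟩
  2 * cut S G ∎
  where open ≡-Reasoning

-simple : ∀ {n} {G H : Graph n} → IsSimple G → IsSimple H → IsSimple (G −G H)
-simple {G = G} {H} (dg , sy) (_ , sh) =
  (λ i → trans (lookup-− G H i i) (cong (_∧ not (lookup (lookup H i) i)) (dg i))) ,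
  (λ i j → trans (lookup-− G H i j) (trans (cong₂ (λ x y → x ∧ not y) (sy i j) (sh i j)) (sym (lookup-− G H j i))))

cut-zero : ∀ {n} (S : Vec Bool n) G {i j} → cut S G ≡ 0 → lookup S i ≡ true → lookup S j ≡ false → ¬ Adj G i j
cut-zero S G {i} {j} c≡0 si sj ij = contradiction (subst (1 ≤_) c≡0 (≤-trans one
  (≤-trans (term≤∑ (λ l → β (lookup S i) * β (not (lookup S l)) * ad G i l) j)
           (term≤∑ (λ i → ∑ λ l → β (lookup S i) * β (not (lookup S l)) * ad G i l) i)))) λ ()
  where
  one : 1 ≤ β (lookup S i) * β (not (lookup S j)) * ad G i j
  one rewrite si | sj | ij = ≤-refl

cut-disconnects : ∀ {n} (S : Vec Bool n) {G} → Nontrivial S → cut S G ≡ 0 → ¬ Connected G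
cut-disconnects S {G} ((i , si) , (j , sj)) c≡0 conn = contradiction (trans (sym (stays (conn i j))) sj) λ ()
  where
  stays : ∀ {l} → Reach G i l → lookup S l ≡ true
  stays here = si
  stays (step {j = u} {l} r adj) with lookup S l in eq
  ... | true  = refl
  ... | false = contradiction adj (cut-zero S G c≡0 (stays r) eq)

cut-−boundary : ∀ {n} (S : Vec Bool n) G → cut S (G −G boundary S G) ≡ 0
cut-−boundary {n} S G = trans (sum-cong-≗ λ i → trans (sum-cong-≗ λ j → pt i j) (∑-0 n)) (∑-0 n)
  where
  bits : ∀ g x y → β x * β (not y) * β (g ∧ not (g ∧ (x xor y))) ≡ 0
  bits g     false y     = refl
  bits g     true  true  = refl
  bits false true  false = refl
  bits true  true  false = refl
  pt : ∀ i j → β (lookup S i) * β (not (lookup S j)) * ad (G −G boundary S G) i j ≡ 0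
  pt i j rewrite lookup-− G (boundary S G) i j | lookup-boundary S G i j = bits (lookup (lookup G i) j) (lookup S i) (lookup S j)

small-cut-¬EdgeConn : ∀ {n} k (S : Vec Bool n) {G} → IsSimple G → Nontrivial S → cut S G ≤ k ∸ 1 → ¬ EdgeConn k G
small-cut-¬EdgeConn k S {G} simple nt small conn = cut-disconnects S {G −G boundary S G} nt (cut-−boundary S G)
  (conn (boundary S G) (boundary-⊆ S {G} simple) (≤-trans (≤-reflexive (degSum-boundary S {G} simple)) (*-monoʳ-≤ 2 small)))

size-insert : ∀ {n} (S : Vec Bool n) v → lookup S v ≡ false → size (S [ v ]≔ true) ≡ suc (size S)
size-insert (false ∷ S) zero    refl = refl
size-insert (b ∷ S)     (suc v) h    = trans (cong (β b +_) (size-insert S v h)) (+-suc (β b) (size S))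

size≤ : ∀ {n} (S : Vec Bool n) → size S ≤ n
size≤ S = ≤-trans (m≤m+n (size S) (size̅ S)) (≤-reflexive (size+size̅ S))

lookup-insert : ∀ {n} (S : Vec Bool n) v u → lookup (S [ v ]≔ true) u ≡ true → u ≡ v ⊎ lookup S u ≡ true
lookup-insert S v u h with u F.≟ v
... | yes p = inj₁ p
... | no p  = inj₂ (trans (sym (V.lookup∘update′ p S true)) h)

insert-mono : ∀ {n} (S : Vec Bool n) v u → lookup S u ≡ true → lookup (S [ v ]≔ true) u ≡ true
insert-mono S v u h with u F.≟ v
... | yes refl = V.lookup∘update u S true
... | no p     = trans (V.lookup∘update′ p S true) h

Closed : ∀ {n} → Graph n → Vec Bool n → Set
Closed G S = ∀ u v → lookup S u ≡ true → Adj G u v → lookup S v ≡ true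

-- The set {i} grows along edges that leave it; every step adds a vertex, so n steps are enough
-- fuel.
reachable-set : ∀ {n} (G : Graph n) i →
  ∃ λ S → lookup S i ≡ true × (∀ v → lookup S v ≡ true → Reach G i v) × Closed G S
reachable-set {n} G i = grow n S₀ (V.lookup∘update i (V.replicate n false) true) start (m≤m+n n _)
  where
  S₀ = V.replicate n false [ i ]≔ true
  start : ∀ v → lookup S₀ v ≡ true → Reach G i v
  start v h with lookup-insert (V.replicate n false) i v h
  ... | inj₁ refl = here
  ... | inj₂ p    = contradiction (trans (sym p) (V.lookup-replicate v false)) λ ()
  Exit : Vec Bool n → Set
  Exit S = ∃ λ u → ∃ λ v → (lookup S u ≡ true × Adj G u v) × lookup S v ≡ false
  exit? : ∀ S → Dec (Exit S)
  exit? S = F.any? λ u → F.any? λ v → ((lookup S u B.≟ true) ×-dec (lookup (lookup G u) v B.≟ true)) ×-dec (lookup S v B.≟ false)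
  grow : ∀ f S → lookup S i ≡ true → (∀ v → lookup S v ≡ true → Reach G i v) → n ≤ f + size S →
         ∃ λ S → lookup S i ≡ true × (∀ v → lookup S v ≡ true → Reach G i v) × Closed G S
  grow f S si reach room with exit? S
  ... | no ¬exit = S , si , reach , λ u v su uv → closed u v su uv
    where
    closed : Closed G S
    closed u v su uv with lookup S v in eq
    ... | true  = refl
    ... | false = contradiction (u , v , (su , uv) , eq) ¬exit
  grow zero    S si reach room | yes (u , v , (su , uv) , sv) =
    contradiction (≤-trans (≤-reflexive (sym (size-insert S v sv))) (size≤ (S [ v ]≔ true))) (≤⇒≯ room)
  grow (suc f) S si reach room | yes (u , v , (su , uv) , sv) =
    grow f (S [ v ]≔ true) (insert-mono S v i si) reach′
      (≤-trans room (≤-reflexive (trans (sym (+-suc f (size S))) (cong (f +_) (sym (size-insert S v sv))))))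
    where
    reach′ : ∀ w → lookup (S [ v ]≔ true) w ≡ true → Reach G i w
    reach′ w h with lookup-insert S v w h
    ... | inj₁ refl = step (reach u su) uv
    ... | inj₂ p    = reach w p

-- If j is not reached from i in G - H, every edge of G leaving the reachable set belongs to H, and
-- H has at least k edges.
large-cuts-EdgeConn : ∀ {n} k {G : Graph n} → 1 ≤ k → (∀ S → Nontrivial S → k ≤ cut S G) → EdgeConn k G
large-cuts-EdgeConn {n} k {G} 1≤k cuts H (Hsimple , H⊆G) few i j with reachable-set (G −G H) i
... | S , si , reach , closed with lookup S j in sj
...   | true  = reach j sj
...   | false = contradiction (begin-strict
  k ∸ 1         <⟨ ∸-monoʳ-< {k} {1} {0} z<s 1≤k ⟩
  k             ≤⟨ cuts S ((i , si) , (j , sj)) ⟩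
  cut S G       ≤⟨ ∑-mono (λ u → ∑-mono λ v → pt u v (lookup S u) (lookup S v) refl refl) ⟩
  cut S H       ≤⟨ *-cancelˡ-≤ 2 (≤-trans 2cut few) ⟩
  k ∸ 1         ∎) (n≮n _)
  where
  open ≤-Reasoning
  2cut : 2 * cut S H ≤ degSum H
  2cut = begin
    2 * cut S H             ≡⟨ degSum-boundary S {H} Hsimple ⟨
    degSum (boundary S H)   ≡⟨ degSum-∑ (boundary S H) ⟩
    (∑ λ i → ∑ (ad (boundary S H) i)) ≤⟨ ∑-mono (λ u → ∑-mono λ v → β-mono (proj₂ (boundary-⊆ S {H} Hsimple) u v)) ⟩
    (∑ λ i → ∑ (ad H i))    ≡⟨ degSum-∑ H ⟨
    degSum H                ∎
  pt : ∀ u v x y → lookup S u ≡ x → lookup S v ≡ y → β x * β (not y) * ad G u v ≤ β x * β (not y) * ad H u v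
  pt u v false y     su sv = z≤n
  pt u v true  true  su sv = z≤n
  pt u v true  false su sv = *-monoʳ-≤ 1 (β-mono {lookup (lookup G u) v} crossing)
    where
    crossing : Adj G u v → Adj H u v
    crossing guv with lookup (lookup H u) v in eq
    ... | true  = refl
    ... | false = contradiction (trans (sym (closed u v su (trans (lookup-− G H u v) (cong₂ (λ x y → x ∧ not y) guv eq)))) sv) λ ()

complement : ∀ {n} → Vec Bool n → Vec Bool n
complement = V.map not

lookup-complement : ∀ {n} (S : Vec Bool n) i → lookup (complement S) i ≡ not (lookup S i)
lookup-complement S i = V.lookup-map i not S

cut-complement : ∀ {n} (S : Vec Bool n) {G} → IsSimple G → cut (complement S) G ≡ cut S G
cut-complement S {G} simple = trans (sum-cong-≗ λ i → sum-cong-≗ λ j →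
  cong₂ (λ x y → β x * β y * ad G i j) (lookup-complement S i) (trans (cong not (lookup-complement S j)) (not-involutive (lookup S j)))) (cut-sym {G = G} simple S)

size-complement : ∀ {n} (S : Vec Bool n) → size (complement S) ≡ size̅ S
size-complement S = sum-cong-≗ λ i → cong β (lookup-complement S i)

-- Without loops the diagonal of S × S stays free. For a single vertex this gives `inn` = 0, a case
-- that `violates` leaves out.
inn+size : ∀ {n} (S : Vec Bool n) {G} → IsSimple G → inn S G + size S ≤ size S * size S
inn+size S {G} simple = begin
  inn S G + size S
    ≡⟨ cong (inn S G +_) (sum-cong-≗ λ i → trans (sym (β-idem (lookup S i))) (sym (∑-δ′ i (λ j → s i * s j)))) ⟩
  inn S G + (∑ λ i → ∑ λ j → s i * s j * δ i j)
    ≡⟨ ∑∑-+ (λ i j → s i * s j * ad G i j) (λ i j → s i * s j * δ i j) ⟨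
  (∑ λ i → ∑ λ j → s i * s j * ad G i j + s i * s j * δ i j)
    ≤⟨ ∑-mono (λ i → ∑-mono λ j → ≤-trans (≤-reflexive (sym (*-distribˡ-+ (s i * s j) (ad G i j) (δ i j))))
         (≤-trans (*-monoʳ-≤ (s i * s j) (le i j)) (≤-reflexive (*-identityʳ _)))) ⟩
  (∑ λ i → ∑ λ j → s i * s j)
    ≡⟨ trans (sum-cong-≗ λ i → ∑-pull (s i) s) (∑-pullʳ (size S) s) ⟩
  size S * size S ∎
  where
  open ≤-Reasoning
  s = λ i → β (lookup S i)
  le : ∀ i j → ad G i j + δ i j ≤ 1
  le i j with i F.≟ j
  ... | yes refl rewrite proj₁ simple i = ≤-refl
  ... | no _     = ≤-trans (≤-reflexive (+-identityʳ _)) (β≤1 (lookup (lookup G i) j))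

cut-remove : ∀ {n} (S : Vec Bool n) G H r → (∀ i → deg H i ≤ r) → cut S G ≤ cut S (G −G H) + size S * r
cut-remove S G H r degH = begin
  cut S G
    ≤⟨ ∑-mono (λ i → ∑-mono λ j → ≤-trans (*-monoʳ-≤ (c i j) (le i j)) (≤-reflexive (*-distribˡ-+ (c i j) (ad (G −G H) i j) (ad H i j)))) ⟩
  (∑ λ i → ∑ λ j → c i j * ad (G −G H) i j + c i j * ad H i j)
    ≡⟨ ∑∑-+ (λ i j → c i j * ad (G −G H) i j) (λ i j → c i j * ad H i j) ⟩
  cut S (G −G H) + (∑ λ i → ∑ λ j → c i j * ad H i j)
    ≤⟨ +-monoʳ-≤ (cut S (G −G H)) (∑-mono λ i → row i) ⟩
  cut S (G −G H) + (∑ λ i → s i * r) ≡⟨ cong (cut S (G −G H) +_) (∑-pullʳ r s) ⟩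
  cut S (G −G H) + size S * r ∎
  where
  open ≤-Reasoning
  s = λ i → β (lookup S i)
  c = λ i j → β (lookup S i) * β (not (lookup S j))
  le : ∀ i j → ad G i j ≤ ad (G −G H) i j + ad H i j
  le i j rewrite lookup-− G H i j = bits (lookup (lookup G i) j) (lookup (lookup H i) j)
    where
    bits : ∀ x y → β x ≤ β (x ∧ not y) + β y
    bits false y     = z≤n
    bits true  true  = ≤-refl
    bits true  false = ≤-refl
  row : ∀ i → (∑ λ j → c i j * ad H i j) ≤ s i * r
  row i = begin
    (∑ λ j → c i j * ad H i j)
      ≤⟨ ∑-mono (λ j → *-monoˡ-≤ (ad H i j) (≤-trans (*-monoʳ-≤ (s i) (β≤1 (not (lookup S j)))) (≤-reflexive (*-identityʳ (s i))))) ⟩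
    (∑ λ j → s i * ad H i j)  ≡⟨ ∑-pull (s i) (ad H i) ⟩
    s i * ∑ (ad H i)          ≡⟨ cong (s i *_) (deg-∑ H i) ⟨
    s i * deg H i             ≤⟨ *-monoʳ-≤ (s i) (degH i) ⟩
    s i * r                   ∎

-- Cuts after the deletion of a subgraph of bounded degree

module _ {n d} {G : Graph n} (reg : Regular d G) (K : ℕ) (good : bad K G ≡ false) where

  private
    sparse : ∀ S → 1 ≤ size S → 2 * size S ≤ n → inn S G ≤ K * (size S ∸ 1)
    sparse S 1≤σ 2σ≤n with 2 ≤? size S in eq₁ | K * (size S ∸ 1) <? inn S G in eq₂
    ... | _       | no h  = ≮⇒≥ h
    ... | no h    | yes _ = ≤-trans (≤-reflexive (n≤0⇒n≡0 (+-cancelʳ-≤ 1 _ 0 (subst (λ x → inn S G + x ≤ x * x) σ≡1 (inn+size S {G} (proj₁ reg)))))) z≤n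
      where
      σ≡1 : size S ≡ 1
      σ≡1 = ≤-antisym (s≤s⁻¹ (≰⇒> h)) 1≤σ
    ... | yes 2≤σ | yes h = contradiction (trans (sym viol) (any-false (λ S → violates K S G) (sets n) good (∈-sets S))) λ ()
      where
      viol : violates K S G ≡ true
      viol = ∧-intro (⌊⌋-true (2 ≤? size S) 2≤σ) (∧-intro (⌊⌋-true (2 * size S ≤? n) 2σ≤n) (⌊⌋-true (K * (size S ∸ 1) <? inn S G) h))

    -- Regularity gives (r + k)σ = inn + cut ≤ K(σ - 1) + cut(G - H) + rσ; with K ≤ k, what remains
    -- is kσ ≤ k(σ - 1) + cut(G - H).
    half : ∀ {H r k} → (∀ i → deg H i ≤ r) → r + k ≡ d → K ≤ k → ∀ S → 1 ≤ size S → 2 * size S ≤ n → k ≤ cut S (G −G H)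
    half {H} {r} {k} degH refl K≤k S 1≤σ 2σ≤n = +-cancelˡ-≤ (k * (σ ∸ 1)) k _ (begin
      k * (σ ∸ 1) + k                   ≡⟨ cong (k * (σ ∸ 1) +_) (*-identityʳ k) ⟨
      k * (σ ∸ 1) + k * 1               ≡⟨ *-distribˡ-+ k (σ ∸ 1) 1 ⟨
      k * (σ ∸ 1 + 1)                   ≡⟨ cong (k *_) (m∸n+n≡m 1≤σ) ⟩
      k * σ                             ≤⟨ +-cancelʳ-≤ (σ * r) _ _ total ⟩
      K * (σ ∸ 1) + cut S (G −G H)      ≤⟨ +-monoˡ-≤ _ (*-monoˡ-≤ (σ ∸ 1) K≤k) ⟩
      k * (σ ∸ 1) + cut S (G −G H)      ∎)
      where
      open ≤-Reasoning
      σ = size S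
      total : k * σ + σ * r ≤ K * (σ ∸ 1) + cut S (G −G H) + σ * r
      total = begin
        k * σ + σ * r                   ≡⟨ trans (+-comm (k * σ) _) (trans (cong (σ * r +_) (*-comm k σ)) (sym (*-distribˡ-+ σ r k))) ⟩
        σ * (r + k)                     ≡⟨ inn+cut {G = G} reg S ⟨
        inn S G + cut S G               ≤⟨ +-mono-≤ (sparse S 1≤σ 2σ≤n) (cut-remove S G H r degH) ⟩
        K * (σ ∸ 1) + (cut S (G −G H) + σ * r)  ≡⟨ +-assoc (K * (σ ∸ 1)) _ _ ⟨
        K * (σ ∸ 1) + cut S (G −G H) + σ * r ∎

  resilient-cuts : ∀ {H r k} → H ⊆G G → (∀ i → deg H i ≤ r) → r + k ≡ d → K ≤ k → ∀ S → Nontrivial S → k ≤ cut S (G −G H)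
  resilient-cuts {H} {r} {k} H⊆G degH rk K≤k S ((i , si) , (j , sj)) with 2 * size S ≤? n
  ... | yes h = half {H} degH rk K≤k S (≤-trans (≤-reflexive (sym (cong β si))) (term≤∑ (β ∘ lookup S) i)) h
  ... | no h  = subst (k ≤_) (cut-complement S {G −G H} (-simple {G = G} {H} (proj₁ reg) (proj₁ H⊆G)))
    (half {H} degH rk K≤k (complement S)
      (≤-trans (≤-reflexive (sym (cong β (trans (lookup-complement S j) (cong not sj))))) (term≤∑ (β ∘ lookup (complement S)) j))
      (subst (λ x → 2 * x ≤ n) (sym (size-complement S)) (begin
        2 * size̅ S                ≡⟨ cong (size̅ S +_) (+-identityʳ (size̅ S)) ⟩
        size̅ S + size̅ S           ≤⟨ +-monoˡ-≤ (size̅ S) small ⟩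
        size S + size̅ S            ≡⟨ size+size̅ S ⟩
        n ∎)))
    where
    open ≤-Reasoning
    small : size̅ S ≤ size S
    small = +-cancelˡ-≤ (size S) _ _ (begin
      size S + size̅ S   ≡⟨ size+size̅ S ⟩
      n                  ≤⟨ ≰⇒≥ h ⟩
      2 * size S         ≡⟨ cong (size S +_) (+-identityʳ (size S)) ⟩
      size S + size S    ∎)

-- Partitions with many neighbours on the own side, after Stiebitz

any-bool? : {P : Bool → Set} → (∀ b → Dec (P b)) → Dec (∃ P)
any-bool? P? with P? true | P? false
... | yes p | _     = yes (true , p)
... | no _  | yes q = yes (false , q)
... | no p  | no q  = no λ { (true , x) → p x ; (false , x) → q x }

-- Generic in the search over a single entry, so it serves for vertex sets and, applied twice, for
-- adjacency matrices.
any-vec? : {X : Set} → (∀ {P : X → Set} → (∀ x → Dec (P x)) → Dec (∃ P)) →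
           ∀ n {P : Vec X n → Set} → (∀ v → Dec (P v)) → Dec (∃ P)
any-vec? any zero    P? with P? []
... | yes p = yes ([] , p)
... | no ¬p = no λ { ([] , p) → ¬p p }
any-vec? any (suc n) P? with any (λ x → any-vec? any n (λ v → P? (x ∷ v)))
... | yes (x , v , p) = yes (x ∷ v , p)
... | no ¬p           = no λ { (x ∷ v , p) → ¬p (x , v , p) }

_⊑_ : ∀ {n} → Vec Bool n → Vec Bool n → Set
A ⊑ B = ∀ v → lookup A v ≡ true → lookup B v ≡ true

removed : ∀ {n} (A : Vec Bool n) x → lookup (A [ x ]≔ false) x ≡ false
removed A x = V.lookup∘update x A false

remove-⊑ : ∀ {n} (A : Vec Bool n) x → (A [ x ]≔ false) ⊑ A
remove-⊑ A x v h with v F.≟ x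
... | yes refl = contradiction (trans (sym h) (removed A x)) λ ()
... | no p     = trans (sym (V.lookup∘update′ p A false)) h

remove-≢ : ∀ {n} (A : Vec Bool n) x v → lookup (A [ x ]≔ false) v ≡ true → v ≢ x
remove-≢ A x v h refl = contradiction (trans (sym h) (removed A x)) λ ()

remove-keep : ∀ {n} (A : Vec Bool n) x v → v ≢ x → lookup A v ≡ true → lookup (A [ x ]≔ false) v ≡ true
remove-keep A x v p h = trans (V.lookup∘update′ p A false) h

size-remove : ∀ {n} (A : Vec Bool n) x → lookup A x ≡ true → suc (size (A [ x ]≔ false)) ≡ size A
size-remove (true ∷ A) zero    refl = refl
size-remove (b ∷ A)    (suc x) h    = trans (sym (+-suc (β b) _)) (cong (β b +_) (size-remove A x h))

module Friendly {n d} {G : Graph n} (reg : Regular d G) where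

  degIn : Vec Bool n → Fin n → ℕ
  degIn A v = ∑ λ j → β (lookup A j) * ad G v j

  degIn-mono : ∀ {A B} → A ⊑ B → ∀ v → degIn A v ≤ degIn B v
  degIn-mono h v = ∑-mono λ j → *-monoˡ-≤ (ad G v j) (β-mono (h j))

  degIn-remove : ∀ A x v → degIn A v ≤ suc (degIn (A [ x ]≔ false) v)
  degIn-remove A x v = begin
    degIn A v                                                                 ≤⟨ ∑-mono le ⟩
    ∑ (λ j → δ x j + β (lookup (A [ x ]≔ false) j) * ad G v j)                ≡⟨ ∑-+ (δ x) _ ⟩
    ∑ (δ x) + degIn (A [ x ]≔ false) v                                        ≡⟨ cong (_+ degIn (A [ x ]≔ false) v) (∑-δ1 x) ⟩
    suc (degIn (A [ x ]≔ false) v)                                            ∎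
    where
    open ≤-Reasoning
    le : ∀ j → β (lookup A j) * ad G v j ≤ δ x j + β (lookup (A [ x ]≔ false) j) * ad G v j
    le j with x F.≟ j
    ... | yes refl = ≤-trans (*-mono-≤ (β≤1 (lookup A j)) (β≤1 (lookup (lookup G v) j))) (m≤m+n 1 _)
    ... | no p     = ≤-reflexive (cong (λ b → β b * ad G v j) (sym (V.lookup∘update′ (p ∘ sym) A false)))

  Complementary : Vec Bool n → Vec Bool n → Set
  Complementary A B = ∀ v → lookup B v ≡ not (lookup A v)

  compl-sym : ∀ {A B} → Complementary A B → Complementary B A
  compl-sym {A} h v = trans (sym (not-involutive (lookup A v))) (cong not (sym (h v)))

  compl-move : ∀ {A B} x → Complementary A B → Complementary (A [ x ]≔ false) (B [ x ]≔ true)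
  compl-move {A} {B} x h v with v F.≟ x
  ... | yes refl = trans (V.lookup∘update x B true) (cong not (sym (removed A x)))
  ... | no p     = trans (V.lookup∘update′ p B true) (trans (h v) (cong not (sym (V.lookup∘update′ p A false))))

  degIn-compl : ∀ {A B} → Complementary A B → ∀ v → degIn A v + degIn B v ≡ d
  degIn-compl {A} {B} h v = trans (sym (∑-+ (λ j → β (lookup A j) * ad G v j) (λ j → β (lookup B j) * ad G v j)))
    (trans (sum-cong-≗ λ j → trans (sym (*-distribʳ-+ (ad G v j) (β (lookup A j)) (β (lookup B j))))
      (trans (cong (_* ad G v j) (trans (cong (λ b → β (lookup A j) + β b) (h j)) (β-not (lookup A j)))) (+-identityʳ _)))
      (row-sum {G = G} reg v))

  Core : ℕ → Vec Bool n → Set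
  Core t A = ∃ (λ v → lookup A v ≡ true) × (∀ v → lookup A v ≡ true → t ≤ degIn A v)

  -- The negation for `suc s` says that A induces an s-degenerate graph.
  HasCore : ℕ → Vec Bool n → Set
  HasCore t A = ∃ λ C → C ⊑ A × Core t C

  hasCore? : ∀ t A → Dec (HasCore t A)
  hasCore? t A = any-vec? any-bool? n λ C →
    F.all? (λ v → (lookup C v B.≟ true) →-dec (lookup A v B.≟ true)) ×-dec
    (F.any? (λ v → lookup C v B.≟ true) ×-dec F.all? (λ v → (lookup C v B.≟ true) →-dec (t ≤? degIn C v)))

  -- Every other vertex loses at most one neighbour. The rest is not empty, since x itself has a
  -- neighbour in A.
  core-remove : ∀ {s A} x → Core (suc s) A → Core s (A [ x ]≔ false)
  core-remove {s} {A} x ((v , av) , deg≥) = nonempty , λ u h →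
    s≤s⁻¹ (≤-trans (deg≥ u (remove-⊑ A x u h)) (degIn-remove A x u))
    where
    nonempty : ∃ λ u → lookup (A [ x ]≔ false) u ≡ true
    nonempty with v F.≟ x
    ... | no p     = v , remove-keep A x v p av
    ... | yes refl with ∑-pos (λ j → β (lookup A j) * ad G v j) (≤-trans z<s (deg≥ v av))
    ...   | j , pos with lookup A j in aj | lookup (lookup G v) j in gvj
    ...     | true | true = j , remove-keep A v j (λ { refl → contradiction (trans (sym gvj) (proj₁ (proj₁ reg) v)) λ () }) aj

  Separated : ℕ → Vec Bool n → Set
  Separated s S = Nontrivial S × (∀ v → lookup S v ≡ true → s ≤ degIn S v) × (∀ v → lookup S v ≡ false → s ≤ degIn (complement S) v)

  complement-compl : ∀ S → Complementary S (complement S)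
  complement-compl S = lookup-complement S

  -- A absorbs vertices outside B that have s neighbours in it. At the end a vertex outside both
  -- sets has at most s neighbours in A, hence at least d - s ≥ s on the other side.
  extend : ∀ {s} → 2 * s ≤ d → ∀ A B → Core s A → Core s B → (∀ v → lookup A v ≡ true → lookup B v ≡ false) → ∃ (Separated s)
  extend {s} 2s≤d A B coreA coreB disj = go n A coreA disj (m≤m+n n _)
    where
    Addable : Vec Bool n → Set
    Addable A = ∃ λ v → (lookup A v ≡ false × lookup B v ≡ false) × s ≤ degIn A v
    addable? : ∀ A → Dec (Addable A)
    addable? A = F.any? λ v → ((lookup A v B.≟ false) ×-dec (lookup B v B.≟ false)) ×-dec (s ≤? degIn A v)
    go : ∀ f A → Core s A → (∀ v → lookup A v ≡ true → lookup B v ≡ false) → n ≤ f + size A → ∃ (Separated s)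
    go f A ((a , aa) , deg≥) disj room with addable? A
    go zero    A ((a , aa) , deg≥) disj room | yes (v , (av , bv) , enough) =
      contradiction (≤-trans (≤-reflexive (sym (size-insert A v av))) (size≤ (A [ v ]≔ true))) (≤⇒≯ room)
    go (suc f) A ((a , aa) , deg≥) disj room | yes (v , (av , bv) , enough) = go f (A [ v ]≔ true)
      ((v , V.lookup∘update v A true) , deg′) disj′
      (≤-trans room (≤-reflexive (trans (sym (+-suc f (size A))) (cong (f +_) (sym (size-insert A v av))))))
      where
      deg′ : ∀ u → lookup (A [ v ]≔ true) u ≡ true → s ≤ degIn (A [ v ]≔ true) u
      deg′ u h with lookup-insert A v u h
      ... | inj₁ refl = ≤-trans enough (degIn-mono {A} {A [ v ]≔ true} (insert-mono A v) u)
      ... | inj₂ au   = ≤-trans (deg≥ u au) (degIn-mono {A} {A [ v ]≔ true} (insert-mono A v) u)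
      disj′ : ∀ u → lookup (A [ v ]≔ true) u ≡ true → lookup B u ≡ false
      disj′ u h with lookup-insert A v u h
      ... | inj₁ refl = bv
      ... | inj₂ au   = disj u au
    go f A ((a , aa) , deg≥) disj room | no ¬add = A , ((a , aa) , (b , notA b bb)) , deg≥ , outside
      where
      b  = proj₁ (proj₁ coreB)
      bb = proj₂ (proj₁ coreB)
      notA : ∀ v → lookup B v ≡ true → lookup A v ≡ false
      notA v bv with lookup A v in av
      ... | false = refl
      ... | true  = contradiction (trans (sym bv) (disj v av)) λ ()
      outside : ∀ v → lookup A v ≡ false → s ≤ degIn (complement A) v
      outside v av with lookup B v in bv
      ... | true  = ≤-trans (proj₂ coreB v bv) (degIn-mono {B} {complement A}
                      (λ u bu → trans (lookup-complement A u) (not-false (notA u bu))) v)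
      ... | false = +-cancelˡ-≤ (degIn A v) _ _ (begin
        degIn A v + s                           ≤⟨ +-monoˡ-≤ s (≰⇒≥ λ h → ¬add (v , (av , bv) , h)) ⟩
        s + s                                   ≡⟨ cong (s +_) (+-identityʳ s) ⟨
        2 * s                                   ≤⟨ 2s≤d ⟩
        d                                       ≡⟨ degIn-compl {A} {complement A} (complement-compl A) v ⟨
        degIn A v + degIn (complement A) v      ∎)
        where open ≤-Reasoning

  -- Edges from x to B leave the cut and edges from x to A enter it; the direction stated is the one
  -- the descent uses.
  cut-move : ∀ {A B} → Complementary A B → ∀ x → lookup A x ≡ true →
             cut (A [ x ]≔ false) G + degIn B x ≤ cut A G + degIn A x
  cut-move {A} {B} compl x ax = begin
    cut A′ G + degIn B x
      ≡⟨ cong (cut A′ G +_) (∑-δ x (degIn B)) ⟨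
    cut A′ G + (∑ λ i → δ x i * degIn B i)
      ≡⟨ cong (cut A′ G +_) (sum-cong-≗ λ i → sym (∑-pull (δ x i) (λ j → β (lookup B j) * ad G i j))) ⟩
    cut A′ G + (∑ λ i → ∑ λ j → δ x i * (β (lookup B j) * ad G i j))
      ≡⟨ ∑∑-+ (λ i j → β (lookup A′ i) * β (not (lookup A′ j)) * ad G i j) (λ i j → δ x i * (β (lookup B j) * ad G i j)) ⟨
    (∑ λ i → ∑ λ j → β (lookup A′ i) * β (not (lookup A′ j)) * ad G i j + δ x i * (β (lookup B j) * ad G i j))
      ≤⟨ ∑-mono (λ i → ∑-mono λ j → pt i j) ⟩
    (∑ λ i → ∑ λ j → β (lookup A i) * β (not (lookup A j)) * ad G i j + β (lookup A i) * ad G i j * δ x j)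
      ≡⟨ ∑∑-+ (λ i j → β (lookup A i) * β (not (lookup A j)) * ad G i j) (λ i j → β (lookup A i) * ad G i j * δ x j) ⟩
    cut A G + (∑ λ i → ∑ λ j → β (lookup A i) * ad G i j * δ x j)
      ≡⟨ cong (cut A G +_) (sum-cong-≗ λ i → trans (∑-δ′ x (λ j → β (lookup A i) * ad G i j))
           (cong (β (lookup A i) *_) (ad-sym {G = G} (proj₁ reg) i x))) ⟩
    cut A G + degIn A x ∎
    where
    open ≤-Reasoning
    A′ = A [ x ]≔ false
    pt : ∀ i j → β (lookup A′ i) * β (not (lookup A′ j)) * ad G i j + δ x i * (β (lookup B j) * ad G i j)
               ≤ β (lookup A i) * β (not (lookup A j)) * ad G i j + β (lookup A i) * ad G i j * δ x j
    pt i j with x F.≟ i | x F.≟ j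
    ... | yes refl | yes refl rewrite removed A x | compl x | ax = z≤n
    ... | yes refl | no q rewrite removed A x | compl j | ax = ≤-trans (≤-reflexive (+-identityʳ _))
        (≤-trans (≤-reflexive (cong (_* ad G x j) (sym (+-identityʳ (β (not (lookup A j))))))) (m≤m+n _ _))
    ... | no p | yes refl rewrite removed A x | ax | V.lookup∘update′ (p ∘ sym) A false = ≤-reflexive (bits (lookup A i) (ad G i x))
      where
      bits : ∀ b g → β b * 1 * g + 0 ≡ β b * 0 * g + β b * g * 1
      bits false g = refl
      bits true  g = trans (+-identityʳ (1 * g)) (sym (*-identityʳ (1 * g)))
    ... | no p | no q rewrite V.lookup∘update′ (p ∘ sym) A false | V.lookup∘update′ (q ∘ sym) A false =
        +-monoʳ-≤ (β (lookup A i) * β (not (lookup A j)) * ad G i j) z≤n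

  cut-compl : ∀ {A B} → Complementary A B → cut B G ≡ cut A G
  cut-compl {A} {B} h = trans (sum-cong-≗ λ i → sum-cong-≗ λ j → cong₂ (λ x y → β x * β y * ad G i j)
    (trans (h i) (sym (lookup-complement A i))) (cong not (trans (h j) (sym (lookup-complement A j))))) (cut-complement A {G} (proj₁ reg))

  module _ {s} (2s<d : 2 * s < d) (2+s≤d : 2 + s ≤ d) (v₀ : Fin n) where

    private
      s<d : suc s ≤ d
      s<d = ≤-trans (n≤1+n _) 2+s≤d

      -- If no vertex of A qualifies, A is its own core or empty; in the latter case B is the whole
      -- vertex set, a core because s < d.
      low : ∀ A B → Complementary A B → ¬ HasCore (suc s) A → ¬ HasCore (suc s) B → ∃ λ x → lookup A x ≡ true × degIn A x ≤ s
      low A B compl ¬A ¬B with F.any? (λ x → (lookup A x B.≟ true) ×-dec (degIn A x ≤? s))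
      ... | yes h = h
      ... | no ¬low with F.any? (λ x → lookup A x B.≟ true)
      ...   | yes a = contradiction (A , (λ _ h → h) , a , λ v av → ≰⇒> λ h → ¬low (v , av , h)) ¬A
      ...   | no ¬a = contradiction (B , (λ _ h → h) , (v₀ , full v₀) , λ v _ →
                        ≤-trans s<d (≤-reflexive (trans (sym (degIn-compl {A} {B} compl v)) (cong (_+ degIn B v) (none v))))) ¬B
        where
        empty : ∀ v → lookup A v ≡ false
        empty v with lookup A v in eq
        ... | false = refl
        ... | true  = contradiction (v , eq) ¬a
        full : ∀ v → lookup B v ≡ true
        full v = trans (compl v) (not-false (empty v))
        none : ∀ v → degIn A v ≡ 0
        none v = trans (sum-cong-≗ λ j → cong (λ b → β b * ad G v j) (empty j)) (∑-0 n)

      sub-core : ∀ {A B} → A ⊑ B → HasCore (suc s) A → HasCore (suc s) B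
      sub-core A⊑B (C , C⊑A , core) = C , (λ v h → A⊑B v (C⊑A v h)) , core

      cut-decreases : ∀ {A B} → Complementary A B → ∀ x → lookup A x ≡ true → degIn A x ≤ s → cut (A [ x ]≔ false) G < cut A G
      cut-decreases {A} {B} compl x ax few = +-cancelʳ-< (degIn A x) _ _ (begin-strict
        cut (A [ x ]≔ false) G + degIn A x    <⟨ +-monoʳ-< (cut (A [ x ]≔ false) G) more ⟩
        cut (A [ x ]≔ false) G + degIn B x    ≤⟨ cut-move {A} {B} compl x ax ⟩
        cut A G + degIn A x                   ∎)
        where
        open ≤-Reasoning
        more : degIn A x < degIn B x
        more = +-cancelˡ-< (degIn A x) _ _ (begin-strict
          degIn A x + degIn A x     ≤⟨ +-mono-≤ few few ⟩
          s + s                     ≡⟨ cong (s +_) (+-identityʳ s) ⟨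
          2 * s                     <⟨ 2s<d ⟩
          d                         ≡⟨ degIn-compl {A} {B} compl x ⟨
          degIn A x + degIn B x     ∎)

      -- A vertex with at most s neighbours on its own side has more than s on the other, so moving
      -- it shrinks the cut, which bounds the recursion. The descent goes on while one of the two
      -- moves creates no core; otherwise the two new cores are combined.
      descend : ∀ f A B → Complementary A B → ¬ HasCore (suc s) A → ¬ HasCore (suc s) B → cut A G < f → ∃ (Separated s)
      descend (suc f) A B compl ¬A ¬B (s≤s cut≤f) with low A B compl ¬A ¬B | low B A (compl-sym {A} {B} compl) ¬B ¬A
      ... | x , ax , fewx | y , by , fewy with hasCore? (suc s) (B [ x ]≔ true) | hasCore? (suc s) (A [ y ]≔ true)
      ...   | no ¬Bx | _ = descend f (A [ x ]≔ false) (B [ x ]≔ true) (compl-move {A} {B} x compl)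
                (¬A ∘ sub-core {A [ x ]≔ false} {A} (remove-⊑ A x)) ¬Bx
                (≤-trans (cut-decreases {A} {B} compl x ax fewx) cut≤f)
      ...   | yes _ | no ¬Ay = descend f (B [ y ]≔ false) (A [ y ]≔ true) (compl-move {B} {A} y (compl-sym {A} {B} compl))
                (¬B ∘ sub-core {B [ y ]≔ false} {B} (remove-⊑ B y)) ¬Ay
                (≤-trans (cut-decreases {B} {A} (compl-sym {A} {B} compl) y by fewy) (≤-trans (≤-reflexive (cut-compl {A} {B} compl)) cut≤f))
      ...   | yes (D , D⊑ , coreD) | yes (C , C⊑ , coreC) =
        -- C ⊑ A + y and D ⊑ B + x, so deleting x from C and y from D leaves disjoint s-cores
        extend (<⇒≤ 2s<d) (C [ x ]≔ false) (D [ y ]≔ false) (core-remove {s} {C} x coreC) (core-remove {s} {D} y coreD) disjoint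
        where
        inA : ∀ v → lookup (C [ x ]≔ false) v ≡ true → v ≢ y → lookup A v ≡ true
        inA v h v≢y with lookup-insert A y v (C⊑ v (remove-⊑ C x v h))
        ... | inj₁ p = contradiction p v≢y
        ... | inj₂ p = p
        inB : ∀ v → lookup (D [ y ]≔ false) v ≡ true → v ≢ x → lookup B v ≡ true
        inB v h v≢x with lookup-insert B x v (D⊑ v (remove-⊑ D y v h))
        ... | inj₁ p = contradiction p v≢x
        ... | inj₂ p = p
        disjoint : ∀ v → lookup (C [ x ]≔ false) v ≡ true → lookup (D [ y ]≔ false) v ≡ false
        disjoint v cv with lookup (D [ y ]≔ false) v in dv
        ... | false = refl
        ... | true  = contradiction (trans (sym (trans (compl v) (cong not (inA v cv (remove-≢ D y v dv))))) (inB v dv (remove-≢ C x v cv))) λ ()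

      -- Core vertices of B move to A one at a time. If A acquires a core C, then C - x and D are
      -- disjoint; if B loses its last core first, neither side has one and the descent takes over.
      ascend : ∀ f A B → Complementary A B → ¬ HasCore (suc s) A → HasCore (suc s) B → size B ≤ f → ∃ (Separated s)
      ascend f A B compl ¬A (D , D⊑B , coreD@((x , dx) , degD)) room with hasCore? (suc s) (A [ x ]≔ true) | hasCore? (suc s) (B [ x ]≔ false)
      ... | yes (C , C⊑ , coreC) | _ =
        extend (<⇒≤ 2s<d) (C [ x ]≔ false) D (core-remove {s} {C} x coreC) (proj₁ coreD , λ v h → ≤-trans (n≤1+n s) (degD v h)) disjoint
        where
        disjoint : ∀ v → lookup (C [ x ]≔ false) v ≡ true → lookup D v ≡ false
        disjoint v cv with lookup D v in dv
        ... | false = refl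
        ... | true with lookup-insert A x v (C⊑ v (remove-⊑ C x v cv))
        ...   | inj₁ p  = contradiction p (remove-≢ C x v cv)
        ...   | inj₂ av = contradiction (trans (sym (D⊑B v dv)) (trans (compl v) (cong not av))) λ ()
      ... | no ¬Ax | no ¬Bx = descend (suc (cut (A [ x ]≔ true) G)) (A [ x ]≔ true) (B [ x ]≔ false)
              (compl-sym {B [ x ]≔ false} {A [ x ]≔ true} (compl-move {B} {A} x (compl-sym {A} {B} compl))) ¬Ax ¬Bx ≤-refl
      ascend zero A B compl ¬A (D , D⊑B , coreD@((x , dx) , degD)) room | no ¬Ax | yes Bx =
        contradiction (subst (_≤ 0) (sym (size-remove B x (D⊑B x dx))) room) λ ()
      ascend (suc f) A B compl ¬A (D , D⊑B , coreD@((x , dx) , degD)) room | no ¬Ax | yes Bx =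
        ascend f (A [ x ]≔ true) (B [ x ]≔ false)
          (compl-sym {B [ x ]≔ false} {A [ x ]≔ true} (compl-move {B} {A} x (compl-sym {A} {B} compl))) ¬Ax Bx
          (s≤s⁻¹ (≤-trans (≤-reflexive (size-remove B x (D⊑B x dx))) room))

    separation : ∃ (Separated s)
    separation = ascend n (V.replicate n false) (V.replicate n true)
      (λ v → trans (V.lookup-replicate v true) (cong not (sym (V.lookup-replicate v false))))
      (λ { (C , C⊑ , (v , cv) , _) → contradiction (trans (sym (C⊑ v cv)) (V.lookup-replicate v false)) λ () })
      (V.replicate n true , (λ _ h → h) , (v₀ , V.lookup-replicate v₀ true) , λ v _ → ≤-trans s<d (≤-reflexive (sym (full v))))
      (size≤ (V.replicate n true))
      where
      full : ∀ v → degIn (V.replicate n true) v ≡ d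
      full v = trans (sum-cong-≗ λ j → trans (cong (λ b → β b * ad G v j) (V.lookup-replicate j true)) (+-identityʳ _)) (row-sum {G = G} reg v)

-- Local resilience

square : ∀ x → x ^ 2 ≡ x * x
square x = cong (x *_) (*-identityʳ x)

least : {P : ℕ → Set} → (∀ r → Dec (P r)) → ∀ b → P b → ∃ λ r → r ≤ b × P r × (∀ s → s < r → ¬ P s)
least P? zero    p = zero , z≤n , p , λ _ ()
least P? (suc b) p with P? zero
... | yes p₀ = zero , z≤n , p₀ , λ _ ()
... | no ¬p₀ with least (P? ∘ suc) b p
...   | r , r≤b , pr , min = suc r , s≤s r≤b , pr , λ { zero _ → ¬p₀ ; (suc s) (s≤s s<r) → min s s<r }

maximum : ∀ {n} (f : Fin (suc n) → ℕ) → ∃ λ i → ∀ j → f j ≤ f i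
maximum {zero}  f = zero , λ { zero → ≤-refl }
maximum {suc n} f with maximum (f ∘ suc)
... | i , max with ≤-total (f (suc i)) (f zero)
...   | inj₁ le = zero , λ { zero → ≤-refl ; (suc j) → ≤-trans (max j) le }
...   | inj₂ le = suc i , λ { zero → le ; (suc j) → max j }

choose : ∀ {n} (v : Vec Bool n) t → t ≤ size v → ∃ λ w → w ⊑ v × size w ≡ t
choose {n} v       zero    _ = V.replicate _ false , (λ i h → contradiction (trans (sym h) (V.lookup-replicate i false)) λ ()) ,
                               trans (sum-cong-≗ {n} {β ∘ lookup (V.replicate n false)} λ i → cong β (V.lookup-replicate i false)) (∑-0 n)
choose (true ∷ v)  (suc t) (s≤s h) with choose v t h
... | w , w⊑v , eq = true ∷ w , (λ { zero _ → refl ; (suc i) p → w⊑v i p }) , cong suc eq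
choose (false ∷ v) (suc t) h with choose v (suc t) h
... | w , w⊑v , eq = false ∷ w , (λ { zero p → p ; (suc i) p → w⊑v i p }) , eq

-- A decidable form of the failure of k-edge connectivity after the deletion: a vertex set with a
-- small cut witnesses it, so the least degree r can be found by search.
Breaks : ∀ {n} → ℕ → Graph n → ℕ → Set
Breaks k G r = ∃ λ H → (H ⊆G G × MaxDeg H r) × ∃ λ S → Nontrivial S × cut S (G −G H) ≤ k ∸ 1

breaks? : ∀ {n} k (G : Graph n) r → Dec (Breaks k G r)
breaks? {n} k G r = any-vec? (any-vec? any-bool? n) n λ H → (⊆G? H ×-dec maxDeg? H) ×-dec
  any-vec? any-bool? n λ S → (F.any? (λ i → lookup S i B.≟ true) ×-dec F.any? (λ j → lookup S j B.≟ false)) ×-dec (cut S (G −G H) ≤? k ∸ 1)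
  where
  ⊆G? : ∀ H → Dec (H ⊆G G)
  ⊆G? H = (F.all? (λ i → lookup (lookup H i) i B.≟ false) ×-dec F.all? (λ i → F.all? λ j → lookup (lookup H i) j B.≟ lookup (lookup H j) i))
          ×-dec F.all? (λ i → F.all? λ j → (lookup (lookup H i) j B.≟ true) →-dec (lookup (lookup G i) j B.≟ true))
  maxDeg? : ∀ H → Dec (MaxDeg H r)
  maxDeg? H = F.all? (λ i → deg H i ≤? r) ×-dec F.any? (λ i → deg H i ≟ r)

breaks⇒¬EdgeConn : ∀ {n k r} {G : Graph n} → IsSimple G → Breaks k G r → Σ _ (λ H → H ⊆G G × MaxDeg H r × ¬ EdgeConn k (G −G H))
breaks⇒¬EdgeConn {k = k} {G = G} simple (H , (H⊆ , max) , S , nt , small) =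
  H , H⊆ , max , small-cut-¬EdgeConn k S {G −G H} (-simple {G = G} {H} simple (proj₁ H⊆)) nt small

¬breaks⇒EdgeConn : ∀ {n k s} {G : Graph n} → 1 ≤ k → ¬ Breaks k G s → ∀ H → H ⊆G G → MaxDeg H s → EdgeConn k (G −G H)
¬breaks⇒EdgeConn {k = k} {G = G} 1≤k ¬b H H⊆ max = large-cuts-EdgeConn k {G −G H} 1≤k λ S nt →
  ≤-trans (≤-reflexive (sym (m+[n∸m]≡n 1≤k))) (≰⇒> λ small → ¬b (H , (H⊆ , max) , S , nt , small))

module _ {n d} {G : Graph n} (reg : Regular d G) where

  private
    simple = proj₁ reg

  star : ∀ v t → t ≤ d → ∃ λ H → H ⊆G G × deg H v ≡ t × (∀ i → i ≢ v → deg H i ≤ 1)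
  star v t t≤d with choose (lookup G v) t (≤-trans t≤d (≤-reflexive (sym (row-sum {G = G} reg v))))
  ... | w , w⊑ , size≡ = H , (((λ i → trans (lookH i i) (diag i)) , (λ i j → trans (lookH i j) (trans (∨-comm (⌊ v F.≟ i ⌋ ∧ lookup w j) _) (sym (lookH j i))))) ,
      λ i j h → sub i j (trans (sym (lookH i j)) h)) , degv , degi
    where
    h : Fin n → Fin n → Bool
    h i j = (⌊ v F.≟ i ⌋ ∧ lookup w j) ∨ (⌊ v F.≟ j ⌋ ∧ lookup w i)
    H = graph h
    lookH = lookup-graph h
    wv : lookup w v ≡ false
    wv with lookup w v in eq
    ... | false = refl
    ... | true  = contradiction (trans (sym (w⊑ v eq)) (proj₁ simple v)) λ ()
    diag : ∀ i → h i i ≡ false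
    diag i with v F.≟ i
    ... | yes refl rewrite wv = refl
    ... | no _ = refl
    sub : ∀ i j → h i j ≡ true → Adj G i j
    sub i j p with v F.≟ i | v F.≟ j
    ... | yes refl | yes refl rewrite wv = contradiction p λ ()
    ... | yes refl | no _     = w⊑ j (trans (sym (∨-identityʳ (lookup w j))) p)
    ... | no _     | yes refl = trans (proj₂ simple i v) (w⊑ i p)
    ... | no _     | no _     = contradiction p λ ()
    degv : deg H v ≡ t
    degv = trans (deg-∑ H v) (trans (sum-cong-≗ λ j → trans (cong β (lookH v j)) (pt j)) size≡)
      where
      pt : ∀ j → β (h v j) ≡ β (lookup w j)
      pt j rewrite wv with v F.≟ v | v F.≟ j
      ... | no p  | _     = contradiction refl p
      ... | yes _ | yes _ = cong β (∨-identityʳ (lookup w j))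
      ... | yes _ | no _  = cong β (∨-identityʳ (lookup w j))
    degi : ∀ i → i ≢ v → deg H i ≤ 1
    degi i i≢v = ≤-trans (≤-reflexive (deg-∑ H i)) (≤-trans (∑-mono λ j → ≤-trans (≤-reflexive (cong β (lookH i j))) (pt j)) (≤-reflexive (∑-δ1 v)))
      where
      pt : ∀ j → β (h i j) ≤ δ v j
      pt j with v F.≟ i | v F.≟ j
      ... | yes p | _     = contradiction (sym p) i≢v
      ... | no _  | yes _ = β≤1 (lookup w i)
      ... | no _  | no _  = z≤n

  -- Deleting d - k + 1 edges at v leaves k - 1 there; the other vertices lose at most one edge
  -- each, so the maximum degree is attained at v.
  star-breaks : ∀ v k → 1 ≤ k → k ≤ d → Breaks k G (d ∸ k + 1)
  star-breaks v k 1≤k k≤d with star v (d ∸ k + 1) t≤d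
    where
    t≤d : d ∸ k + 1 ≤ d
    t≤d = ≤-trans (+-monoʳ-≤ (d ∸ k) 1≤k) (≤-reflexive (m∸n+n≡m k≤d))
  ... | H , H⊆ , degv , degi = H , (H⊆ , bounded , v , degv) , S , ((v , trans (V.lookup∘tabulate _ v) (⌊⌋-true (v F.≟ v) refl)) , other) , small
    where
    t = d ∸ k + 1
    S = tabulate λ i → ⌊ v F.≟ i ⌋
    bounded : ∀ i → deg H i ≤ t
    bounded i with i F.≟ v
    ... | yes refl = ≤-reflexive degv
    ... | no p     = ≤-trans (degi i p) (m≤n+m 1 (d ∸ k))
    other : ∃ λ j → lookup S j ≡ false
    other with ∑-pos (ad G v) (≤-trans (≤-trans 1≤k k≤d) (≤-reflexive (sym (row-sum {G = G} reg v))))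
    ... | j , pos = j , trans (V.lookup∘tabulate _ j) notv
      where
      notv : ⌊ v F.≟ j ⌋ ≡ false
      notv with v F.≟ j
      ... | no _     = refl
      ... | yes refl = contradiction (subst (0 <_) (ad-diag {G = G} simple v) pos) λ ()
    rowH : ∑ (ad (G −G H) v) + t ≡ d
    rowH = trans (cong (∑ (ad (G −G H) v) +_) (trans (sym degv) (deg-∑ H v)))
      (trans (sym (∑-+ (ad (G −G H) v) (ad H v))) (trans (sum-cong-≗ pt) (row-sum {G = G} reg v)))
      where
      pt : ∀ j → ad (G −G H) v j + ad H v j ≡ ad G v j
      pt j rewrite lookup-− G H v j with lookup (lookup H v) j in hv | lookup (lookup G v) j in gv
      ... | false | false = refl
      ... | false | true  = refl
      ... | true  | true  = refl
      ... | true  | false = contradiction (trans (sym (proj₂ H⊆ v j hv)) gv) λ ()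
    small : cut S (G −G H) ≤ k ∸ 1
    small = begin
      cut S (G −G H)
        ≤⟨ ∑-mono (λ i → ∑-mono λ j → *-monoˡ-≤ (ad (G −G H) i j) (≤-trans (*-monoʳ-≤ (β (lookup S i)) (β≤1 (not (lookup S j))))
             (≤-reflexive (trans (*-identityʳ _) (cong β (V.lookup∘tabulate (λ i → ⌊ v F.≟ i ⌋) i)))))) ⟩
      (∑ λ i → ∑ λ j → δ v i * ad (G −G H) i j)
        ≡⟨ trans (sum-cong-≗ λ i → ∑-pull (δ v i) (ad (G −G H) i)) (∑-δ v (λ i → ∑ (ad (G −G H) i))) ⟩
      ∑ (ad (G −G H) v)
        ≤⟨ +-cancelʳ-≤ t _ _ (≤-reflexive (trans rowH (sym (begin-equality
             k ∸ 1 + (d ∸ k + 1)     ≡⟨ e (k ∸ 1) (d ∸ k) ⟩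
             d ∸ k + (k ∸ 1 + 1)     ≡⟨ cong (d ∸ k +_) (m∸n+n≡m 1≤k) ⟩
             d ∸ k + k               ≡⟨ m∸n+n≡m k≤d ⟩
             d                       ∎)))) ⟩
      k ∸ 1 ∎
      where
      open ≤-Reasoning
      e : ∀ x y → x + (y + 1) ≡ y + (x + 1)
      e = solve-∀

  -- The whole cut of the partition is deleted: a vertex with s neighbours on its own side loses at
  -- most d - s edges, and an empty cut refutes connectivity for every k.
  separation-breaks : ∀ s k → 2 * s < d → 2 + s ≤ d → Fin n → ∃ λ r → r + s ≤ d × Breaks k G r
  separation-breaks s k 2s<d 2+s≤d v₀ with Friendly.separation {G = G} reg {s} 2s<d 2+s≤d v₀
  ... | S , nt , inS , outS = r , rs , boundary S G , (boundary-⊆ S {G} simple , max , i , refl) , S , nt ,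
        ≤-trans (≤-reflexive (cut-−boundary S G)) z≤n
    where
    open Friendly {G = G} reg using (degIn; degIn-compl; complement-compl)
    -- A vertex shows that n is positive, as `maximum` requires.
    maximum′ : Fin n → (f : Fin n → ℕ) → ∃ λ i → ∀ j → f j ≤ f i
    maximum′ zero    = maximum
    maximum′ (suc _) = maximum
    i   = proj₁ (maximum′ v₀ (deg (boundary S G)))
    max = proj₂ (maximum′ v₀ (deg (boundary S G)))
    r   = deg (boundary S G) i
    deg-in : lookup S i ≡ true → r ≡ degIn (complement S) i
    deg-in si = trans (deg-∑ (boundary S G) i) (sum-cong-≗ λ j → trans (ad-boundary S G i j)
      (trans (cong (λ b → β b * β (not (lookup S j)) * ad G i j + β (not b) * β (lookup S j) * ad G i j) si)
      (trans (+-identityʳ _) (cong (_* ad G i j) (trans (+-identityʳ _) (cong β (sym (lookup-complement S j))))))))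
    deg-out : lookup S i ≡ false → r ≡ degIn S i
    deg-out si = trans (deg-∑ (boundary S G) i) (sum-cong-≗ λ j → trans (ad-boundary S G i j)
      (trans (cong (λ b → β b * β (not (lookup S j)) * ad G i j + β (not b) * β (lookup S j) * ad G i j) si)
      (cong (_* ad G i j) (+-identityʳ (β (lookup S j))))))
    total : degIn S i + degIn (complement S) i ≡ d
    total = degIn-compl {S} {complement S} (complement-compl S) i
    rs : r + s ≤ d
    rs with lookup S i in si
    ... | true  = ≤-trans (+-mono-≤ (≤-reflexive (deg-in si)) (inS i si)) (≤-reflexive (trans (+-comm _ (degIn S i)) total))
    ... | false = ≤-trans (+-mono-≤ (≤-reflexive (deg-out si)) (outS i si)) (≤-reflexive total)

expT-mono : ∀ {a b} N → a ≤ b → expT a N ≤ expT b N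
expT-mono zero    h = ≤-refl
expT-mono (suc N) h = +-mono-≤ (*-monoʳ-≤ (suc N) (expT-mono N h)) (^-monoˡ-≤ (suc N) h)

-- from N = 7 on the next term of the series of e^4 is at most half the current one
expT-4 : ∀ N → expT 4 N ≤ 3 ^ 5 * N !
expT-4 0 = toWitness {a? = expT 4 0 ≤? 3 ^ 5 * 0 !} _
expT-4 1 = toWitness {a? = expT 4 1 ≤? 3 ^ 5 * 1 !} _
expT-4 2 = toWitness {a? = expT 4 2 ≤? 3 ^ 5 * 2 !} _
expT-4 3 = toWitness {a? = expT 4 3 ≤? 3 ^ 5 * 3 !} _
expT-4 4 = toWitness {a? = expT 4 4 ≤? 3 ^ 5 * 4 !} _
expT-4 5 = toWitness {a? = expT 4 5 ≤? 3 ^ 5 * 5 !} _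
expT-4 6 = toWitness {a? = expT 4 6 ≤? 3 ^ 5 * 6 !} _
expT-4 (suc (suc (suc (suc (suc (suc (suc M))))))) = ≤-trans (m≤m+n _ (4 ^ (7 + M))) (tail M)
  where
  open ≤-Reasoning
  tail : ∀ M → expT 4 (7 + M) + 4 ^ (7 + M) ≤ 3 ^ 5 * (7 + M) !
  tail zero    = toWitness {a? = expT 4 7 + 4 ^ 7 ≤? 3 ^ 5 * 7 !} _
  tail (suc M) = begin
    (8 + M) * expT 4 (7 + M) + 4 * 4 ^ (7 + M) + 4 * 4 ^ (7 + M)   ≤⟨ ≤-by (M * 4 ^ (7 + M)) (e (expT 4 (7 + M)) (4 ^ (7 + M)) M) ⟩
    (8 + M) * (expT 4 (7 + M) + 4 ^ (7 + M))                       ≤⟨ *-monoʳ-≤ (8 + M) (tail M) ⟩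
    (8 + M) * (3 ^ 5 * (7 + M) !)                                  ≡⟨ e′ (8 + M) (3 ^ 5) ((7 + M) !) ⟩
    3 ^ 5 * ((8 + M) * (7 + M) !)                                  ∎
    where
    e : ∀ x y M → (8 + M) * (x + y) ≡ (8 + M) * x + 4 * y + 4 * y + M * y
    e = solve-∀
    e′ : ∀ a b c → a * (b * c) ≡ b * (a * c)
    e′ = solve-∀

-- The partition already gives r ≤ d/2 + 1, so the exponent (2r - d)² is at most 4, and e^4 ≤ 3^5 ≤
-- d^5 ≤ d^(64d).
upperLn : ∀ d r → 3 ≤ d → 2 * r ≤ d + 2 → UpperLn d r
upperLn d r 3≤d h N = begin
  expT ((2 * r ∸ d) ^ 2) N     ≤⟨ expT-mono N (^-monoˡ-≤ 2 (m≤n+o⇒m∸n≤o (2 * r) d h)) ⟩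
  expT 4 N                     ≤⟨ expT-4 N ⟩
  3 ^ 5 * N !                  ≤⟨ *-monoˡ-≤ (N !) (≤-trans (^-monoˡ-≤ 5 3≤d) (^-monoʳ-≤ d {{>-nonZero (≤-trans (s≤s z≤n) 3≤d)}} 5≤64d)) ⟩
  d ^ (64 * d) * N !           ∎
  where
  open ≤-Reasoning
  5≤64d : 5 ≤ 64 * d
  5≤64d = ≤-trans (m≤m+n 5 59) (*-monoʳ-≤ 64 (≤-trans (s≤s z≤n) 3≤d))

-- s = ⌊(d-1)/2⌋
half-degree : ∀ d → 3 ≤ d → ∃ λ s → 2 * s < d × 2 + s ≤ d × d ≤ 2 * s + 2
half-degree (suc zero)             (s≤s ())
half-degree (suc (suc zero))       (s≤s (s≤s ()))
half-degree (suc (suc (suc zero))) _ = 1 , s≤s (s≤s (s≤s z≤n)) , s≤s (s≤s (s≤s z≤n)) , s≤s (s≤s (s≤s z≤n))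
half-degree (suc (suc (suc (suc zero)))) _ = 1 , s≤s (s≤s (s≤s z≤n)) , s≤s (s≤s (s≤s z≤n)) , s≤s (s≤s (s≤s (s≤s z≤n)))
half-degree (suc (suc d@(suc (suc (suc _))))) _ with half-degree d (s≤s (s≤s (s≤s z≤n)))
... | s , a , b , c = suc s ,
  ≤-trans (≤-reflexive (cong suc (e s))) (s≤s (s≤s a)) ,
  ≤-trans (s≤s b) (n≤1+n (suc d)) ,
  ≤-trans (s≤s (s≤s c)) (≤-reflexive (cong (_+ 2) (sym (e s))))
  where
  e : ∀ s → 2 * suc s ≡ 2 + 2 * s
  e = solve-∀

-- From the absence of dense sets to the values of the resilience

module Criterion {d} (3≤d : 3 ≤ d) (K : ℕ) (K-above : 4 * d ≤ (2 * K ∸ d) ^ 2) (K-least : ∀ k → k < K → ¬ (4 * d ≤ (2 * k ∸ d) ^ 2)) where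

  private
    K≤ : ∀ k → 4 * d ≤ (2 * k ∸ d) ^ 2 → K ≤ k
    K≤ k h = ≮⇒≥ λ k<K → K-least k k<K h

    <K : ∀ k → (2 * k ∸ d) ^ 2 < 4 * d → k < K
    <K k h = ≰⇒> λ K≤k → <⇒≱ h (≤-trans K-above (^-monoˡ-≤ 2 (∸-monoˡ-≤ d (*-monoʳ-≤ 2 K≤k))))

    1≤K : 1 ≤ K
    1≤K = n≢0⇒n>0 λ { refl → contradiction (subst (λ x → 4 * d ≤ x ^ 2) (0∸n≡0 d) K-above)
      (<⇒≱ (≤-trans (≤-trans (s≤s z≤n) 3≤d) (m≤n*m d 4))) }

  good : ∀ {n} {G : Graph n} → Fin n → Regular d G → bad K G ≡ false → Good d G
  good {n} {G} v₀ reg ok = dense , sparse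
    where
    simple = proj₁ reg

    no-break : ∀ {r k l} → r + l ≡ d → K ≤ l → 1 ≤ k → k ≤ l → ¬ Breaks k G r
    no-break {r} {k} {l} rl K≤l 1≤k k≤l (H , (H⊆ , max) , S , nt , small) =
      <⇒≱ (≤-trans (∸-monoʳ-< {k} {1} {0} z<s 1≤k) k≤l) (≤-trans (resilient-cuts {G = G} reg K ok {H} H⊆ (proj₁ max) rl K≤l S nt) small)

    dense : ∀ k → 4 * d ≤ (2 * k ∸ d) ^ 2 → k ≤ d → IsLocRes (EdgeConn k) G (d ∸ k + 1)
    dense k k-above k≤d = breaks⇒¬EdgeConn {k = k} {G = G} simple (star-breaks {G = G} reg v₀ k 1≤k k≤d) , λ H s H⊆ max s<r →
      ¬breaks⇒EdgeConn {k = k} {s} {G} 1≤k (no-break {s} {k} {d ∸ s} (m+[n∸m]≡n (s≤d s s<r)) (≤-trans K≤k (k≤ s s<r)) 1≤k (k≤ s s<r)) H H⊆ max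
      where
      K≤k = K≤ k k-above
      1≤k = ≤-trans 1≤K K≤k
      s≤d-k : ∀ s → s < d ∸ k + 1 → s ≤ d ∸ k
      s≤d-k s h = s≤s⁻¹ (≤-trans h (≤-reflexive (+-comm (d ∸ k) 1)))
      s≤d : ∀ s → s < d ∸ k + 1 → s ≤ d
      s≤d s h = ≤-trans (s≤d-k s h) (m∸n≤m d k)
      k≤ : ∀ s → s < d ∸ k + 1 → k ≤ d ∸ s
      k≤ s h = m+n≤o⇒m≤o∸n k (≤-trans (≤-reflexive (+-comm k s)) (≤-trans (+-monoˡ-≤ k (s≤d-k s h)) (≤-reflexive (m∸n+n≡m k≤d))))

    sparse : ∀ k → 1 ≤ k → (2 * k ∸ d) ^ 2 < 4 * d →
      Σ ℕ (λ r → IsLocRes (EdgeConn k) G r × (d ∸ 2 * r) ^ 2 < 4 * d × r ≤ d ∸ k + 1 × UpperLn d r)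
    sparse k 1≤k k-below with half-degree d 3≤d
    ... | s , 2s<d , 2+s≤d , d≤2s+2 with separation-breaks {G = G} reg s k 2s<d 2+s≤d v₀
    ...   | r₂ , r₂+s≤d , breaks₂ with least (breaks? k G) r₂ breaks₂
    -- The resilience is the least breaking degree. The partition starts the search and bounds r by
    -- r₂; by minimality the star bounds it by d - k + 1.
    ...     | r , r≤r₂ , breaks , minimal =
      r , (breaks⇒¬EdgeConn {k = k} {G = G} simple breaks ,
           λ H s H⊆ max s<r → ¬breaks⇒EdgeConn {k = k} {s} {G} 1≤k (minimal s s<r) H H⊆ max) ,
      ≰⇒> lower ,
      ≮⇒≥ (λ star<r → minimal _ star<r (star-breaks {G = G} reg v₀ k 1≤k k≤d)) ,
      upperLn d r 3≤d 2r≤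
      where
      open ≤-Reasoning
      -- If k > d, then 2k - d ≥ d + 2, and (d + 2)² ≥ 4d contradicts the range of k.
      k≤d : k ≤ d
      k≤d = ≮⇒≥ λ d<k → <⇒≱ k-below (begin
        4 * d                  ≤⟨ ≤-by (d * d + 4) (e d) ⟩
        (d + 2) * (d + 2)      ≤⟨ *-mono-≤ (wide d<k) (wide d<k) ⟩
        (2 * k ∸ d) * (2 * k ∸ d)  ≡⟨ square (2 * k ∸ d) ⟨
        (2 * k ∸ d) ^ 2        ∎)
        where
        e : ∀ d → (d + 2) * (d + 2) ≡ 4 * d + (d * d + 4)
        e = solve-∀
        e′ : ∀ d → d + 2 + d ≡ 2 * suc d
        e′ = solve-∀
        wide : d < k → d + 2 ≤ 2 * k ∸ d
        wide h = m+n≤o⇒m≤o∸n (d + 2) (≤-trans (≤-reflexive (e′ d)) (*-monoʳ-≤ 2 h))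
      -- If r ≤ d/2 - √d, then d - r ≥ d/2 + √d, so K ≤ d - r by the choice of K. Every cut then
      -- keeps d - r > k - 1 edges and r cannot break.
      lower : ¬ (4 * d ≤ (d ∸ 2 * r) ^ 2)
      lower h = no-break {r} {k} {d ∸ r} (m+[n∸m]≡n r≤d) K≤d-r 1≤k (≤-trans (<⇒≤ (<K k k-below)) K≤d-r) breaks
        where
        r≤d : r ≤ d
        r≤d = ≤-trans r≤r₂ (≤-trans (m≤m+n r₂ s) r₂+s≤d)
        flip : 2 * (d ∸ r) ∸ d ≡ d ∸ 2 * r
        flip = begin-equality
          2 * (d ∸ r) ∸ d        ≡⟨ cong (_∸ d) (*-distribˡ-∸ 2 d r) ⟩
          2 * d ∸ 2 * r ∸ d      ≡⟨ ∸-+-assoc (2 * d) (2 * r) d ⟩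
          2 * d ∸ (2 * r + d)    ≡⟨ cong (2 * d ∸_) (+-comm (2 * r) d) ⟩
          2 * d ∸ (d + 2 * r)    ≡⟨ ∸-+-assoc (2 * d) d (2 * r) ⟨
          2 * d ∸ d ∸ 2 * r      ≡⟨ cong (_∸ 2 * r) (trans (m+n∸m≡n d (d + 0)) (+-identityʳ d)) ⟩
          d ∸ 2 * r              ∎
        K≤d-r : K ≤ d ∸ r
        K≤d-r = K≤ (d ∸ r) (subst (λ x → 4 * d ≤ x ^ 2) (sym flip) h)
      2r≤ : 2 * r ≤ d + 2
      2r≤ = +-cancelʳ-≤ (2 * s) _ _ (begin
        2 * r + 2 * s       ≡⟨ *-distribˡ-+ 2 r s ⟨
        2 * (r + s)         ≤⟨ *-monoʳ-≤ 2 (≤-trans (+-monoˡ-≤ s r≤r₂) r₂+s≤d) ⟩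
        2 * d               ≡⟨ cong (d +_) (+-identityʳ d) ⟩
        d + d               ≤⟨ +-monoʳ-≤ d d≤2s+2 ⟩
        d + (2 * s + 2)     ≡⟨ e d s ⟩
        d + 2 + 2 * s       ∎)
        where
        e : ∀ d s → d + (2 * s + 2) ≡ d + 2 + 2 * s
        e = solve-∀

count-filter : ∀ {X : Set} (p : X → Bool) xs → length xs ≡ length (filter (λ x → p x B.≟ false) xs) + count p xs
count-filter p []       = refl
count-filter p (x ∷ xs) with p x
... | false = cong suc (count-filter p xs)
... | true  = trans (cong suc (count-filter p xs)) (sym (+-suc _ _))

-- Exceptional graphs and the choice of constants

module _ {d} (3≤d : 3 ≤ d) (K : ℕ) (K-above : 4 * d ≤ (2 * K ∸ d) ^ 2) (K-least : ∀ k → k < K → ¬ (4 * d ≤ (2 * k ∸ d) ^ 2)) where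

  few-exceptions : ∀ m Q L₀ → 1 ≤ m → threshold d m ≤ Q →
    1728 * large-constant d m Q (d * d + d + 2) + (2 * (d * d + d + 2) + 8) ≤ L₀ →
    ∀ n → Q * suc L₀ ≤ n → (Lall : List (Graph n)) → Unique Lall → All (Regular d) Lall →
    (∀ G → Regular d G → G ∈ Lall) →
    Σ (List (Graph n)) (λ L → Unique L × All (λ G → Regular d G × Good d G) L × m * length Lall ≤ m * length L + length Lall)
  -- The lower bound on n excludes the graph without vertices; the criterion needs a vertex.
  few-exceptions m Q L₀ 1≤m Q-big L₀-big zero n-big = contradiction (≤-trans (*-mono-≤ (≤-trans z<s Q-big) (z<s {L₀})) n-big) λ ()
  few-exceptions m Q L₀ 1≤m Q-big L₀-big (suc n) n-big Lall uniq allReg complete =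
    filter ok? Lall , Unique.filter⁺ ok? uniq , All.tabulate kept , (begin
      m * length Lall                                            ≡⟨ cong (m *_) (count-filter (bad K) Lall) ⟩
      m * (length (filter ok? Lall) + count (bad K) Lall)        ≡⟨ *-distribˡ-+ m _ _ ⟩
      m * length (filter ok? Lall) + m * count (bad K) Lall      ≤⟨ +-monoʳ-≤ _ few ⟩
      m * length (filter ok? Lall) + length Lall                 ∎)
    where
    open ≤-Reasoning
    g = 2 * K ∸ d
    4d≤gg : 4 * d ≤ g * g
    4d≤gg = ≤-trans K-above (≤-reflexive (square g))
    -- From d ≥ 3: g ≤ 3 would give g² ≤ 9 < 12 ≤ 4d.
    4≤g : 4 ≤ g
    4≤g = ≰⇒> λ g≤3 → <⇒≱ (≤-trans (s≤s (*-mono-≤ g≤3 g≤3)) (≤-trans (m≤m+n 10 2) (*-monoʳ-≤ 4 3≤d))) 4d≤gg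
    2K≡ : 2 * K ≡ d + g
    2K≡ = sym (m+[n∸m]≡n (<⇒≤ (m∸n≢0⇒n<m {2 * K} {d} λ g≡0 → contradiction (subst (4 ≤_) g≡0 4≤g) λ ())))
    -- From 2K = d + g ≥ 7. A violating set then spans more than 2(σ - 1) edges, which yields the
    -- exponent 2σ - 1 for small sets.
    4≤K : 4 ≤ K
    4≤K = *-cancelˡ-< 2 3 K (≤-trans (+-mono-≤ 3≤d 4≤g) (≤-reflexive (sym 2K≡)))
    few : m * count (bad K) Lall ≤ length Lall
    few = FewBad.few-bad {d} (≤-trans (n≤1+n 2) 3≤d) K g m 2K≡ 4d≤gg 4≤g 4≤K 1≤m Q L₀ Q-big L₀-big n-big Lall uniq allReg complete
    ok? : (G : Graph (suc n)) → Dec (bad K G ≡ false)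
    ok? G = bad K G B.≟ false
    kept : ∀ {G} → G ∈ filter ok? Lall → Regular d G × Good d G
    kept {G} G∈ with ∈-filter⁻ ok? {xs = Lall} G∈
    ... | G∈Lall , ok = All.lookup allReg G∈Lall , Criterion.good 3≤d K K-above K-least {G = G} zero (All.lookup allReg G∈Lall) ok

-- The search is bounded by 2d: there 2K - d = 3d, and 9d² ≥ 4d.
least-K : ∀ d → 3 ≤ d → ∃ λ K → 4 * d ≤ (2 * K ∸ d) ^ 2 × (∀ k → k < K → ¬ (4 * d ≤ (2 * k ∸ d) ^ 2))
least-K d 3≤d with least (λ k → 4 * d ≤? (2 * k ∸ d) ^ 2) (2 * d) (begin
    4 * d                            ≤⟨ m≤n*m (4 * d) d {{>-nonZero (≤-trans (s≤s z≤n) 3≤d)}} ⟩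
    d * (4 * d)                      ≤⟨ ≤-by (5 * (d * d)) (e′ d) ⟩
    3 * d * (3 * d)                  ≡⟨ square (3 * d) ⟨
    (3 * d) ^ 2                      ≡⟨ cong (_^ 2) (trans (cong (_∸ d) (e d)) (m+n∸m≡n d (3 * d))) ⟨
    (2 * (2 * d) ∸ d) ^ 2            ∎)
  where
  open ≤-Reasoning
  e : ∀ d → 2 * (2 * d) ≡ d + 3 * d
  e = solve-∀
  e′ : ∀ d → 3 * d * (3 * d) ≡ d * (4 * d) + 5 * (d * d)
  e′ = solve-∀
... | K , _ , above , minimal = K , above , minimal

theorem1 : (d : ℕ) → 3 ≤ d → WHP d
theorem1 d 3≤d m 1≤m with least-K d 3≤d
... | K , above , minimal = Q * suc L₀ , λ n n-big _ → few-exceptions 3≤d K above minimal m Q L₀ 1≤m ≤-refl ≤-refl n n-big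
  where
  Q L₀ : ℕ
  Q  = threshold d m
  L₀ = 1728 * large-constant d m Q (d * d + d + 2) + (2 * (d * d + d + 2) + 8)
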